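{- Let $n\ge 1$ and let $\Theta$ be the map $d\mapsto(\lambda\setminus\mu,\omega)$ from $n$-diagrams to labeled skew shapes given by the compass-direction algorithm described in the context. Then: (a) $\Theta$ induces a bijection between the set of $n$-diagrams and the set of BJS-equivalence classes of labeled skew shapes all of whose labels are positive integers less than $n$. (b) For any $n$-diagram $d$, the row reading word of $\Theta(d)$ is the Jones normal form of $d$, and the column reading word of $\Theta(d)$ is the dual Jones normal form of $d$.
   Context: **Diagrams.** An $n$-diagram is a planar perfect matching: a set partition of $\{1,\dots,n\}\sqcup\{1',\dots,n'\}$ into $2$-element blocks (edges) such that, with $1,\dots,n$ placed left to right on a (northern) line and $1',\dots,n'$ placed left to right directly below on a parallel (southern) line ($k'$ directly below $k$), the edges can be drawn as pairwise non-intersecting arcs between the two lines. For a commutative ring $\Bbbk$ and $\delta\in\Bbbk$, the product of $n$-diagrams is $D_1D_2=\delta^L D_3$, where $D_1$ is stacked on top of $D_2$, the middle vertices are identified, $L$ is the number of closed loops formed and $D_3$ is the $n$-diagram obtained by removing loops and middle vertices. The span of the $n$-diagrams is the Temperley--Lieb algebra $\mathrm{TL}_n(\delta)$; $e_i$ ($1\le i\le n-1$) is the $n$-diagram with edges $\{i,i+1\}$, $\{i',(i+1)'\}$ and $\{j,j'\}$ for $j\ne i,i+1$. The empty product is the identity diagram with edges $\{j,j'\}$, $1 \le j\le n$. **Normal forms.** A word is in Jones normal form if it is $(e_{j_1}e_{j_1-1}\cdots e_{k_1})(e_{j_2}e_{j_2-1}\cdots e_{k_2})\cdots(e_{j_r}e_{j_r-1}\cdots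 e_{k_r})$ with $r\ge0$, $0<j_1<\cdots<j_r<n$, $0<k_1<\cdots<k_r<n$ and $j_i\ge k_i$ for all $i$. Every $n$-diagram equals exactly one word in Jones normal form; this is the Jones normal form of $d$. The dual version, obtained by interchanging left and right, is $(e_{a_1}e_{a_1+1}\cdots e_{b_1})(e_{a_2}e_{a_2+1}\cdots e_{b_2})\cdots(e_{a_r}e_{a_r+1}\cdots e_{b_r})$ with $n>a_1>\cdots>a_r>0$, $n>b_1>\cdots>b_r>0$ and $a_i\le b_i$ for all $i$; the dual Jones normal form of $d$ is the unique word of this form equal to $d$. **Labeled skew shapes.** Use coordinates on $\mathbb{R}^2$ in which $(x,y)$ is $x$ units south and $y$ units east of the origin. A skew shape $\lambda\setminus\mu$ (the set difference of Young diagrams of partitions $\mu\subset\lambda$, in English notation, possibly empty) is embedded in the plane with corners of boxes in $\mathbb{Z}\times\mathbb{Z}$ (any integral translate is allowed), and each unit box is identified with its southeastern corner $(i,j)\in\mathbb{Z}\times\mathbb{Z}$. The label of box $(i,j)$ is $\omega(i,j)=i-j$; a skew shape with this labeling is a labeled skew shape $(\lambda\setminus\mu,\omega)$. Two labeled skew shapes $(\lambda\setminus\mu,\omega)$, $(\alpha\setminus\beta,\omega)$ are BJS-equivalent if there is an order-preserving bijection $f:\lambda\setminus\mu\to\alpha\setminus\beta$ (for the product order on $\mathbb{Z}\times\mathbb{Z}$) that preserves labels: $f(i,j)=(h,k)$ implies $i-j=h-k$. The row (resp. column) reading sequence $(i_1,\dots,i_l)$ lists the labels across rows left to right, rows taken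 from top to bottom (resp. down columns top to bottom, columns taken from left to right); the row (resp. column) reading word is $e_{i_1}e_{i_2}\cdots e_{i_l}$. **The map $\Theta$.** Given an $n$-diagram $d$, for $k\in\{1,\dots,n\}$ set $\xi(k)=W$ if the vertex $k$ is connected to a vertex strictly to its right, and $\xi(k)=S$ otherwise; set $\xi(k')=N$ if $k'$ is connected to a vertex weakly to its right, and $\xi(k')=E$ otherwise. Let $\xi(d)=(\xi(1),\dots,\xi(n),\xi(n'),\dots,\xi(1'))$. Starting at $(0,0)$, move one unit in each successive compass direction of $\xi(d)$; this gives a closed polygonal path of $2n$ unit segments. Discard all unit segments that are traversed twice; what remains bounds a skew shape $\lambda\setminus\mu$ embedded in the plane, whose boxes are labeled by $\omega(i,j)=i-j$. Then $\Theta(d)=(\lambda\setminus\mu,\omega)$. -}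

module Defs where

open import Algebra.Bundles using (CommutativeRing)
open import Data.Fin as Fin using (Fin; toℕ; fromℕ<)
import Data.Fin.Properties as Fin
open import Data.Integer as ℤ using (ℤ; +_; 0ℤ; 1ℤ)
import Data.Integer.Properties as ℤ
open import Data.List.Base
  using (List; []; _∷_; [_]; _++_; map; concatMap; length; filter; reverse; foldr;
         allFin; upTo; applyUpTo; applyDownFrom; cartesianProduct)
open import Data.List.Relation.Binary.Pointwise using (Pointwise)
open import Data.List.Relation.Unary.All using (All)
open import Data.List.Relation.Unary.Linked using (Linked)
open import Data.Nat as ℕ using (ℕ; zero; suc; _∸_)
import Data.Nat.Properties as ℕ
open import Data.Product using (Σ; ∃-syntax; Σ-syntax; _×_; _,_; proj₁; proj₂; swap)
open import Data.Product.Properties as × using ()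
open import Data.Sum using (_⊎_; inj₁; inj₂)
open import Data.Sum.Properties as ⊎ using ()
open import Data.Bool.Base using (if_then_else_)
open import Function.Base using (_on_)
open import Function.Bundles using (_⇔_)
open import Function.Definitions using (Congruent; Bijective)
open import Level using (Level; 0ℓ; _⊔_)
open import Relation.Binary.Construct.Closure.Equivalence using (EqClosure)
open import Relation.Binary.Core using (Rel)
open import Relation.Binary.Definitions using (Decidable; DecidableEquality)
open import Relation.Binary.PropositionalEquality using (_≡_; _≢_; refl; sym; trans; cong)
open import Relation.Nullary using (¬_; yes; no; does; contradiction)
open import Relation.Nullary.Decidable using (map′; _×-dec_)
open import Relation.Unary as Unary using (Pred)

private
  variable
    n : ℕ

-- `north k` and `south k` stand for the vertices k+1 and (k+1)', since
-- elements of Fin n are counted from 0.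

data Vertex (n : ℕ) : Set where
  north south : Fin n → Vertex n

column : Vertex n → Fin n
column (north k) = k
column (south k) = k

-- The order 1, …, n, n', …, 1' of the vertices along the boundary of the
-- strip between the two lines.

data _≺_ {n : ℕ} : Rel (Vertex n) 0ℓ where
  north≺north : ∀ {j k} → j Fin.< k → north j ≺ north k
  north≺south : ∀ {j k} → north j ≺ south k
  south≺south : ∀ {j k} → k Fin.< j → south j ≺ south k

-- A perfect matching is given by the map sending a vertex to the other
-- vertex of its block.  The blocks can be drawn in the strip as disjoint
-- arcs exactly when no two of them interleave along its boundary.

record Diagram (n : ℕ) : Set where
  field
    partner    : Vertex n → Vertex n
    involutive : ∀ v → partner (partner v) ≡ v
    no-fixed   : ∀ v → partner v ≢ v
    planar     : ∀ {u v} → u ≺ v → v ≺ partner u → ¬ (partner u ≺ partner v)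

open Diagram public

infix 4 _≈_ _≟ⱽ_ _≈?_

_≈_ : Rel (Diagram n) 0ℓ
d ≈ d′ = ∀ v → partner d v ≡ partner d′ v

_≟ⱽ_ : DecidableEquality (Vertex n)
north j ≟ⱽ north k = map′ (cong north) (λ { refl → refl }) (j Fin.≟ k)
north j ≟ⱽ south k = no λ ()
south j ≟ⱽ north k = no λ ()
south j ≟ⱽ south k = map′ (cong south) (λ { refl → refl }) (j Fin.≟ k)

_≈?_ : Decidable (_≈_ {n})
d ≈? d′ = map′
  (λ { (p , q) (north k) → p k ; (p , q) (south k) → q k })
  (λ p → (λ k → p (north k)) , (λ k → p (south k)))
  (Fin.all? (λ k → partner d (north k) ≟ⱽ partner d′ (north k))
    ×-dec Fin.all? (λ k → partner d (south k) ≟ⱽ partner d′ (south k)))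

identity : Diagram n
identity {n} = record
  { partner    = p
  ; involutive = λ { (north _) → refl ; (south _) → refl }
  ; no-fixed   = λ { (north _) () ; (south _) () }
  ; planar     = planar′
  }
  where
  p : Vertex n → Vertex n
  p (north k) = south k
  p (south k) = north k

  planar′ : ∀ {u v} → u ≺ v → v ≺ p u → ¬ (p u ≺ p v)
  planar′ (north≺north j<k) north≺south (south≺south k<j) = ℕ.<-asym j<k k<j
  planar′ north≺south (south≺south _) ()
  planar′ (south≺south _) () _

module Hook (l r : Fin n) (adjacent : toℕ r ≡ suc (toℕ l)) where

  data Role : Fin n → Set where
    left    : Role l
    right   : Role r
    through : ∀ {j} → j ≢ l → j ≢ r → Role j

  role : ∀ j → Role j
  role j with j Fin.≟ l | j Fin.≟ r
  ... | yes refl | _        = left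
  ... | no _     | yes refl = right
  ... | no j≢l   | no j≢r   = through j≢l j≢r

  north-partner south-partner : ∀ {j} → Role j → Vertex n
  north-partner left                = north r
  north-partner right               = north l
  north-partner (through {j} _ _)   = south j
  south-partner left                = south r
  south-partner right               = south l
  south-partner (through {j} _ _)   = north j

  hook-partner : Vertex n → Vertex n
  hook-partner (north j) = north-partner (role j)
  hook-partner (south j) = south-partner (role j)

  private
    l<r : l Fin.< r
    l<r = ℕ.≤-reflexive (sym adjacent)

    l≢r : l ≢ r
    l≢r l≡r = ℕ.<-irrefl (cong toℕ l≡r) l<r

    no-between : ∀ {j : Fin n} → l Fin.< j → ¬ (j Fin.< r)
    no-between l<j j<r = ℕ.<-irrefl refl
      (ℕ.<-≤-trans j<r (ℕ.≤-trans (ℕ.≤-reflexive adjacent) l<j))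

    north-left : ∀ {j} (ρ : Role j) → j ≡ l → north-partner ρ ≡ north r
    north-left left          _   = refl
    north-left right         r≡l = contradiction (sym r≡l) l≢r
    north-left (through p _) j≡l = contradiction j≡l p

    north-right : ∀ {j} (ρ : Role j) → j ≡ r → north-partner ρ ≡ north l
    north-right left          l≡r = contradiction l≡r l≢r
    north-right right         _   = refl
    north-right (through _ q) j≡r = contradiction j≡r q

    north-through : ∀ {j} (ρ : Role j) → j ≢ l → j ≢ r → north-partner ρ ≡ south j
    north-through left          p _ = contradiction refl p
    north-through right         _ q = contradiction refl q
    north-through (through _ _) _ _ = refl

    south-left : ∀ {j} (ρ : Role j) → j ≡ l → south-partner ρ ≡ south r
    south-left left          _   = refl
    south-left right         r≡l = contradiction (sym r≡l) l≢r
    south-left (through p _) j≡l = contradiction j≡l p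

    south-right : ∀ {j} (ρ : Role j) → j ≡ r → south-partner ρ ≡ south l
    south-right left          l≡r = contradiction l≡r l≢r
    south-right right         _   = refl
    south-right (through _ q) j≡r = contradiction j≡r q

    south-through : ∀ {j} (ρ : Role j) → j ≢ l → j ≢ r → south-partner ρ ≡ north j
    south-through left          p _ = contradiction refl p
    south-through right         _ q = contradiction refl q
    south-through (through _ _) _ _ = refl

    involutive-north : ∀ {j} (ρ : Role j) → hook-partner (north-partner ρ) ≡ north j
    involutive-north left          = north-right (role r) refl
    involutive-north right         = north-left (role l) refl
    involutive-north (through p q) = south-through (role _) p q

    involutive-south : ∀ {j} (ρ : Role j) → hook-partner (south-partner ρ) ≡ south j
    involutive-south left          = south-right (role r) refl
    involutive-south right         = south-left (role l) refl
    involutive-south (through p q) = north-through (role _) p q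

    no-fixed-north : ∀ {j} (ρ : Role j) → north-partner ρ ≢ north j
    no-fixed-north left          refl = l≢r refl
    no-fixed-north right         refl = l≢r refl
    no-fixed-north (through _ _) ()

    no-fixed-south : ∀ {j} (ρ : Role j) → south-partner ρ ≢ south j
    no-fixed-south left          refl = l≢r refl
    no-fixed-south right         refl = l≢r refl
    no-fixed-south (through _ _) ()

    planar-nn : ∀ {j k} (ρ : Role j) (σ : Role k) → j Fin.< k →
                north k ≺ north-partner ρ → ¬ (north-partner ρ ≺ north-partner σ)
    planar-nn left  _ l<k (north≺north k<r) _ = no-between l<k k<r
    planar-nn right _ r<k (north≺north k<l) _ =
      ℕ.<-asym l<r (ℕ.<-trans r<k k<l)
    planar-nn (through _ _) left          _   _ ()
    planar-nn (through _ _) right         _   _ ()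
    planar-nn (through _ _) (through _ _) j<k _ (south≺south k<j) = ℕ.<-asym j<k k<j

    planar-ns : ∀ {j k} (ρ : Role j) (σ : Role k) →
                south k ≺ north-partner ρ → ¬ (north-partner ρ ≺ south-partner σ)
    planar-ns (through _ _) left (south≺south j<l) (south≺south r<j) =
      ℕ.<-asym l<r (ℕ.<-trans r<j j<l)
    planar-ns (through _ _) right (south≺south j<r) (south≺south l<j) = no-between l<j j<r
    planar-ns (through _ _) (through _ _) _ ()

    planar-ss : ∀ {j k} (ρ : Role j) → k Fin.< j → ¬ (south k ≺ south-partner ρ)
    planar-ss left          k<l (south≺south r<k) = ℕ.<-asym l<r (ℕ.<-trans r<k k<l)
    planar-ss right         k<r (south≺south l<k) = no-between l<k k<r
    planar-ss (through _ _) _   ()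

    hook-planar : ∀ {u v} → u ≺ v → v ≺ hook-partner u → ¬ (hook-partner u ≺ hook-partner v)
    hook-planar (north≺north j<k) v≺pu pu≺pv = planar-nn (role _) (role _) j<k v≺pu pu≺pv
    hook-planar {north j} {south k} north≺south v≺pu pu≺pv =
      planar-ns (role j) (role k) v≺pu pu≺pv
    hook-planar (south≺south k<j) v≺pu _ = planar-ss (role _) k<j v≺pu

  hook : Diagram n
  hook = record
    { partner    = hook-partner
    ; involutive = λ { (north j) → involutive-north (role j) ; (south j) → involutive-south (role j) }
    ; no-fixed   = λ { (north j) → no-fixed-north (role j) ; (south j) → no-fixed-south (role j) }
    ; planar     = hook-planar
    }

-- eᵢ joins i with i+1 and i' with (i+1)'; these are the vertices counted
-- from 0 as i-1 and i.

e : (i : ℕ) → 0 ℕ.< i → i ℕ.< n → Diagram n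
e (suc i) _ i+1<n = Hook.hook (fromℕ< i<n) (fromℕ< i+1<n)
  (trans (Fin.toℕ-fromℕ< i+1<n) (cong suc (sym (Fin.toℕ-fromℕ< i<n))))
  where
  i<n = ℕ.<-trans (ℕ.n<1+n i) i+1<n

data StackVertex (n : ℕ) : Set where
  top middle bottom : Fin n → StackVertex n

upper lower outer : Vertex n → StackVertex n
upper (north k) = top k
upper (south k) = middle k
lower (north k) = middle k
lower (south k) = bottom k
outer (north k) = top k
outer (south k) = bottom k

module _ (D₁ D₂ : Diagram n) where

  data Edge : Rel (StackVertex n) 0ℓ where
    upper-edge : ∀ v → Edge (upper v) (upper (partner D₁ v))
    lower-edge : ∀ v → Edge (lower v) (lower (partner D₂ v))

  Joined : Rel (StackVertex n) 0ℓ
  Joined = EqClosure Edge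

  OnLoop : Pred (Fin n) 0ℓ
  OnLoop m = ∀ v → ¬ Joined (middle m) (outer v)

  -- There are exactly L closed loops: `representative` picks one middle
  -- vertex on each of them.

  record LoopCount (L : ℕ) : Set where
    field
      representative : Fin L → Fin n
      on-loop        : ∀ a → OnLoop (representative a)
      distinct       : ∀ {a b} → Joined (middle (representative a)) (middle (representative b)) → a ≡ b
      exhaustive     : ∀ {m} → OnLoop m → ∃[ a ] Joined (middle m) (middle (representative a))

  -- D₁ D₂ = δ ^ L D₃.  The component of an outer vertex in the stacked
  -- graph is a path with exactly two outer vertices, its ends.

  record StackedProduct (L : ℕ) (D₃ : Diagram n) : Set where
    field
      loops : LoopCount L
      paths : ∀ v → Joined (outer v) (outer (partner D₃ v))

-- The word e_{i₁} ⋯ e_{iₗ} is represented by the list of its indices.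

Word : Set
Word = List ℤ

descending ascending : ℕ × ℕ → List ℕ
descending (j , k) = applyDownFrom (k ℕ.+_) (suc j ∸ k)
ascending  (a , b) = applyUpTo (a ℕ.+_) (suc b ∸ a)

JonesNormal : ℕ → Pred Word 0ℓ
JonesNormal n w = ∃[ jks ]
  Linked ℕ._<_ (0 ∷ map proj₁ jks ++ [ n ]) ×
  Linked ℕ._<_ (0 ∷ map proj₂ jks ++ [ n ]) ×
  All (λ { (j , k) → j ℕ.≥ k }) jks ×
  w ≡ map +_ (concatMap descending jks)

DualJonesNormal : ℕ → Pred Word 0ℓ
DualJonesNormal n w = ∃[ abs ]
  Linked ℕ._>_ (n ∷ map proj₁ abs ++ [ 0 ]) ×
  Linked ℕ._>_ (n ∷ map proj₂ abs ++ [ 0 ]) ×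
  All (λ { (a , b) → a ℕ.≤ b }) abs ×
  w ≡ map +_ (concatMap ascending abs)

module TemperleyLieb {c ℓ : Level} (𝕜 : CommutativeRing c ℓ) (δ : CommutativeRing.Carrier 𝕜) where

  open CommutativeRing 𝕜 using (Carrier; 0#; 1#; _+_; _*_; semiring) renaming (_≈_ to _≈𝕜_)
  open import Algebra.Properties.Semiring.Exp semiring using (_^_)

  -- Elements of the span of the n-diagrams are formal sums, identified
  -- when every diagram has the same coefficient in both.

  TL : ℕ → Set c
  TL n = List (Carrier × Diagram n)

  ⟨_⟩ : Diagram n → TL n
  ⟨ D ⟩ = [ 1# , D ]

  coefficient : Diagram n → TL n → Carrier
  coefficient D = foldr (λ { (a , D′) s → if does (D′ ≈? D) then a + s else s }) 0#

  infix 4 _≋_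

  _≋_ : Rel (TL n) ℓ
  x ≋ y = ∀ D → coefficient D x ≈𝕜 coefficient D y

  TermProduct : (Carrier × Diagram n) × (Carrier × Diagram n) → Carrier × Diagram n → Set ℓ
  TermProduct ((a , D₁) , (b , D₂)) (s , D₃) =
    ∃[ L ] StackedProduct D₁ D₂ L D₃ × s ≈𝕜 (a * b) * δ ^ L

  -- `Product x y z` says that x y = z; it is the bilinear extension of the
  -- product of diagrams.

  Product : TL n → TL n → TL n → Set (c ⊔ ℓ)
  Product x y z = Pointwise TermProduct (cartesianProduct x y) z

  data Evaluates {n : ℕ} : Word → TL n → Set (c ⊔ ℓ) where
    empty : Evaluates [] ⟨ identity ⟩
    cons  : ∀ {i w x y} (0<i : 0 ℕ.< i) (i<n : i ℕ.< n) →
            Evaluates w x → Product ⟨ e i 0<i i<n ⟩ x y → Evaluates (+ i ∷ w) y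

  infix 4 _Equals_

  _Equals_ : Word → Diagram n → Set (c ⊔ ℓ)
  w Equals d = ∃[ x ] Evaluates w x × x ≋ ⟨ d ⟩

  IsJonesNormalFormOf IsDualJonesNormalFormOf : Diagram n → Word → Set (c ⊔ ℓ)
  IsJonesNormalFormOf     {n} d w = JonesNormal n w × w Equals d
  IsDualJonesNormalFormOf {n} d w = DualJonesNormal n w × w Equals d

-- (x , y) is x units south and y units east of the origin.

Point : Set
Point = ℤ × ℤ

infix 4 _≤ᴾ_

_≤ᴾ_ : Rel Point 0ℓ
(i , j) ≤ᴾ (h , k) = i ℤ.≤ h × j ℤ.≤ k

ω : Point → ℤ
ω (i , j) = i ℤ.- j

record Partition : Set where
  field
    parts      : List ℕ
    decreasing : Linked ℕ._≥_ parts
    positive   : All (0 ℕ.<_) parts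

open Partition public

-- Rows are counted from 0, and the rows beyond the last part are empty.

row : List ℕ → ℕ → ℕ
row []       _       = 0
row (p ∷ _)  zero    = p
row (_ ∷ ps) (suc r) = row ps r

-- The shape λ∖μ, translated so that `origin` is the northwestern corner of
-- the Young diagrams of λ and μ.

record SkewShape : Set where
  field
    λ′ μ   : Partition
    μ⊆λ    : ∀ r → row (parts μ) r ℕ.≤ row (parts λ′) r
    origin : Point

  -- (r , c) indexes the box in row r and column c, both counted from 0.

  Cell : Pred (ℕ × ℕ) 0ℓ
  Cell (r , c) = row (parts μ) r ℕ.≤ c × c ℕ.< row (parts λ′) r

  cell? : Unary.Decidable Cell
  cell? (r , c) = (row (parts μ) r ℕ.≤? c) ×-dec (c ℕ.<? row (parts λ′) r)

  corner : ℕ × ℕ → Point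
  corner (r , c) = proj₁ origin ℤ.+ + suc r , proj₂ origin ℤ.+ + suc c

open SkewShape public

-- Boxes are identified with their southeastern corners.

infix 4 _∈ˢ_

_∈ˢ_ : Point → SkewShape → Set
p ∈ˢ S = ∃[ rc ] Cell S rc × p ≡ corner S rc

Box : SkewShape → Set
Box S = ∃[ p ] p ∈ˢ S

_≡ᴮ_ : {S : SkewShape} → Rel (Box S) 0ℓ
_≡ᴮ_ = _≡_ on proj₁

-- For skew shapes the inverse of f is automatically order-preserving:
-- boxes whose labels differ by at most 1 are always comparable, and these
-- comparisons generate the order.

record BJSEquivalent (S T : SkewShape) : Set where
  field
    f                : Box S → Box T
    congruent        : Congruent (_≡ᴮ_ {S}) (_≡ᴮ_ {T}) f
    bijective        : Bijective (_≡ᴮ_ {S}) (_≡ᴮ_ {T}) f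
    order-preserving : ∀ b b′ → proj₁ b ≤ᴾ proj₁ b′ → proj₁ (f b) ≤ᴾ proj₁ (f b′)
    label-preserving : ∀ b → ω (proj₁ (f b)) ≡ ω (proj₁ b)

LabelsBelow : ℕ → Pred SkewShape 0ℓ
LabelsBelow n S = ∀ p → p ∈ˢ S → 0ℤ ℤ.< ω p × ω p ℤ.< + n

rowReading columnReading : SkewShape → Word
rowReading S = map (λ rc → ω (corner S rc))
  (filter (cell? S)
    (cartesianProduct (upTo (length (parts (λ′ S)))) (upTo (row (parts (λ′ S)) 0))))
columnReading S = map (λ rc → ω (corner S rc))
  (filter (cell? S)
    (map swap (cartesianProduct (upTo (row (parts (λ′ S)) 0)) (upTo (length (parts (λ′ S)))))))

data Direction : Set where
  N S E W : Direction

ξ : Diagram n → Vertex n → Direction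
ξ d (north k) = if does (k Fin.<? column (partner d (north k))) then W else S
ξ d (south k) = if does (k Fin.≤? column (partner d (south k))) then N else E

ξ-sequence : Diagram n → List Direction
ξ-sequence {n} d =
  map (λ k → ξ d (north k)) (allFin n) ++ map (λ k → ξ d (south k)) (reverse (allFin n))

-- A unit segment is recorded, without direction, by its western or
-- northern endpoint.

Segment : Set
Segment = Point ⊎ Point

pattern eastward p  = inj₁ p
pattern southward p = inj₂ p

_≟ˢ_ : DecidableEquality Segment
_≟ˢ_ = ⊎.≡-dec (×.≡-dec ℤ._≟_ ℤ._≟_) (×.≡-dec ℤ._≟_ ℤ._≟_)

step : Direction → Point → Point
step N (x , y) = x ℤ.- 1ℤ , y
step S (x , y) = x ℤ.+ 1ℤ , y
step E (x , y) = x , y ℤ.+ 1ℤ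
step W (x , y) = x , y ℤ.- 1ℤ

traversed : Direction → Point → Segment
traversed N p = southward (step N p)
traversed S p = southward p
traversed E p = eastward p
traversed W p = eastward (step W p)

walk : Point → List Direction → List Segment
walk p []       = []
walk p (θ ∷ θs) = traversed θ p ∷ walk (step θ p) θs

-- A unit segment survives the discarding when it is traversed exactly
-- once; none is traversed more than twice.

Remains : Diagram n → Pred Segment 0ℓ
Remains d s = length (filter (s ≟ˢ_) (walk (0ℤ , 0ℤ) (ξ-sequence d))) ≡ 1

-- The boxes north and south, or west and east, of a segment, each given by
-- its southeastern corner.

sides : Segment → Point × Point
sides (eastward  (x , y)) = (x , y ℤ.+ 1ℤ) , (x ℤ.+ 1ℤ , y ℤ.+ 1ℤ)
sides (southward (x , y)) = (x ℤ.+ 1ℤ , y) , (x ℤ.+ 1ℤ , y ℤ.+ 1ℤ)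

OnBoundary : SkewShape → Pred Segment 0ℓ
OnBoundary T s =
  let b , b′ = sides s
  in (b ∈ˢ T × ¬ (b′ ∈ˢ T)) ⊎ (¬ (b ∈ˢ T) × b′ ∈ˢ T)

-- Θ(d) = T.  Since T is finite, its set of boxes is determined by its
-- boundary.

IsΘ : Diagram n → SkewShape → Set
IsΘ d T = ∀ s → Remains d s ⇔ OnBoundary T s

-- The classes are handled through the equivalence itself: Θ respects it, is
-- injective up to it and meets every class.

InducesBijection : (Diagram n → SkewShape) → Set
InducesBijection {n} Θ =
  Σ[ inRange ∈ (∀ d → LabelsBelow n (Θ d)) ]
  let Θ′ : Diagram n → Σ SkewShape (LabelsBelow n)
      Θ′ d = Θ d , inRange d
  in Congruent _≈_ (BJSEquivalent on proj₁) Θ′ ×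
     Bijective _≈_ (BJSEquivalent on proj₁) Θ′

{-# OPTIONS --safe #-}
module Submission where

-- Let U k and V k be the rows in which the northern and the southern half of
-- the path of ξ(d) meet the diagonal x − y = k; then Θ(d) has V k − U k boxes
-- labelled k, half the number of edges of d crossing the vertical line between
-- the columns k and k + 1.  Call an end of an edge closing if the edge arrives
-- there from the left.  The directions ξ tell which vertices are closing, and
-- by planarity this determines d: if two diagrams with the same closing
-- vertices first differ at v, the nearer of the two partners of v would be
-- matched to the left of v in one of them.  Counting closing vertices in the
-- first k columns gives U ≤ V, so the path bounds a skew shape.
--
-- Removing a minimal box labelled k from a region between two such paths moves
-- the upper path by a corner, and undoing this multiplies a diagram by e_k
-- without closing a loop.  Hence every linear extension of the boxes, in
-- particular the reading by rows or by columns, spells a word for the diagram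
-- of the region.  Since the boundary paths of any skew shape with labels in
-- {1, …, n − 1} bound such a region, this also gives surjectivity.

open import Defs
open import Algebra.Bundles using (CommutativeRing)
open import Data.Nat using (ℕ; _≤_)
open import Data.Product using (_×_; Σ-syntax)
open import Level using (Level)

open import Data.Bool.Base using (Bool; true; false; not; if_then_else_)
open import Data.Fin.Base as Fin using (Fin; toℕ; fromℕ<)
import Data.Fin.Properties as Fin
open import Data.Integer.Base as ℤ using (ℤ; +_; 0ℤ; 1ℤ)
import Data.Integer.Properties as ℤ
open import Algebra.Properties.AbelianGroup ℤ.+-0-abelianGroup using (∙-cancelˡ; ∙-cancelʳ)
import Data.Integer.Tactic.RingSolver as ℤ-Solver
open import Data.List.Base
  using (List; []; _∷_; [_]; _++_; _∷ʳ_; map; filter; length; lookup; tabulate; reverse; allFin;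
         upTo; applyUpTo; applyDownFrom; cartesianProduct; concat; concatMap)
open import Data.List.Membership.DecPropositional _≟ˢ_ using (_∈?_)
open import Data.List.Membership.Propositional using (_∈_; _∉_)
open import Data.List.Membership.Propositional.Properties
  using (∈-lookup; ∈-filter⁺; ∈-filter⁻; ∈-map⁺; ∈-map⁻; ∈-cartesianProduct⁺; ∈-cartesianProduct⁻;
         ∈-upTo⁺; ∈-upTo⁻; ∈-applyUpTo⁺; ∈-applyUpTo⁻)
open import Data.List.Properties
  using (length-map; length-++; length-tabulate; map-∘; map-cong; map-cong-local; map-tabulate;
         map-applyUpTo; map-concatMap; concatMap-map; reverse-map; unfold-reverse; filter-accept;
         filter-reject; filter-none; filter-++)
open import Data.List.Relation.Binary.Permutation.Propositional.Properties
  using (↭-reverse; filter-↭; ↭-length)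
open import Data.List.Relation.Binary.Pointwise using ([]; _∷_)
open import Data.List.Relation.Unary.All as All using (All; []; _∷_)
import Data.List.Relation.Unary.All.Properties as All
open import Data.List.Relation.Unary.AllPairs as AllPairs using (AllPairs; []; _∷_)
import Data.List.Relation.Unary.AllPairs.Properties as AllPairs
open import Data.List.Relation.Unary.Any as Any using (here; there)
import Data.List.Relation.Unary.Any.Properties as Any
open import Data.List.Relation.Unary.Linked as Linked using (Linked; []; [-]; _∷_)
open import Data.List.Relation.Unary.Linked.Properties using (AllPairs⇒Linked)
open import Data.List.Relation.Unary.Unique.Propositional using (Unique)
import Data.List.Relation.Unary.Unique.Propositional.Properties as Unique
open import Data.Nat.Base as ℕ using (zero; suc; _+_; _∸_; _<_; _>_; _≥_; s≤s; z≤n)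
open import Data.Nat.Induction using (<-rec)
import Data.Nat.Properties as ℕ
import Data.Nat.Tactic.RingSolver as ℕ-Solver
open import Data.Product.Base as Product using (_,_; proj₁; proj₂; ∃-syntax; swap)
open import Data.Sum.Base as Sum using (_⊎_; inj₁; inj₂)
open import Function.Base using (_∘_; case_of_)
open import Function.Bundles using (_⇔_; mk⇔; module Equivalence)
open import Function.Properties.Equivalence using () renaming (sym to ⇔-sym; trans to ⇔-trans)
open import Level using (0ℓ)
open import Relation.Binary.Construct.Closure.Equivalence as EqClosure using ()
open import Relation.Binary.Core using (Rel)
open import Relation.Binary.Definitions using (DecidableEquality; tri<; tri≈; tri>)
open import Relation.Binary.PropositionalEquality
  using (_≡_; _≢_; refl; sym; trans; cong; cong₂; subst; subst₂; module ≡-Reasoning)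
open import Relation.Nullary using (¬_; Dec; yes; no; does; contradiction; ¬?)
open import Relation.Nullary.Decidable
  using (decidable-stable; toSum; dec-true; dec-false; does-⇔) renaming (map to map-dec)
open import Relation.Unary using (Pred)
import Relation.Unary as Unary

-- A region does not determine its two paths. Where they coincide, a common step may go south or
-- west without changing the set of boxes; `ξ` always goes south there, while the boundary of an
-- arbitrary skew shape may go west. `Traces` therefore lets a west step count only beside a box,
-- and one diagram traces many pairs of paths. Any two of these have equal heights V - U, and
-- parallel upper steps wherever U < V, so their regions differ by diagonal translations of pieces:
-- the freedom in a BJS-equivalence.
--
-- Conversely, an equivalence preserves the number of boxes with each label, hence all heights. The
-- only thing that heights leave open is whether two paths at constant positive height both go south
-- or both go west between two diagonals; the order among the least boxes of these diagonals decides
-- it.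
--
-- The word of a reading is never compared with d directly. The recursion builds some diagram that
-- the word spells, together with its traces, and the closing vertices identify it with d.

private
  variable
    n : ℕ

open Equivalence using (to; from)

-- The order of the vertices along the boundary

≺-trans : {u v w : Vertex n} → u ≺ v → v ≺ w → u ≺ w
≺-trans (north≺north p) (north≺north q) = north≺north (ℕ.<-trans p q)
≺-trans (north≺north _) north≺south     = north≺south
≺-trans north≺south     (south≺south _) = north≺south
≺-trans (south≺south p) (south≺south q) = south≺south (ℕ.<-trans q p)

≺-irrefl : {v : Vertex n} → ¬ (v ≺ v)
≺-irrefl (north≺north p) = ℕ.<-irrefl refl p
≺-irrefl (south≺south p) = ℕ.<-irrefl refl p

≺-asym : {u v : Vertex n} → u ≺ v → ¬ (v ≺ u)
≺-asym p q = ≺-irrefl (≺-trans p q)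

≺⇒≢ : {u v : Vertex n} → u ≺ v → u ≢ v
≺⇒≢ p refl = ≺-irrefl p

≺-connex : {u v : Vertex n} → u ≢ v → u ≺ v ⊎ v ≺ u
≺-connex {u = north j} {north k} u≢v with Fin.<-cmp j k
... | tri< j<k _ _ = inj₁ (north≺north j<k)
... | tri≈ _ refl _ = contradiction refl u≢v
... | tri> _ _ k<j = inj₂ (north≺north k<j)
≺-connex {u = north j} {south k} _ = inj₁ north≺south
≺-connex {u = south j} {north k} _ = inj₂ north≺south
≺-connex {u = south j} {south k} u≢v with Fin.<-cmp j k
... | tri< j<k _ _ = inj₂ (south≺south j<k)
... | tri≈ _ refl _ = contradiction refl u≢v
... | tri> _ _ k<j = inj₁ (south≺south k<j)

-- Of the two endpoints of an edge drawn from left to right, v is the one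
-- at which it arrives; a vertical edge arrives at its north end.

ArrivesFrom : Vertex n → Vertex n → Set
ArrivesFrom w (north k) = toℕ (column w) ≤ toℕ k
ArrivesFrom w (south k) = toℕ (column w) < toℕ k

arrivesFrom? : (w v : Vertex n) → Dec (ArrivesFrom w v)
arrivesFrom? w (north k) = _ ℕ.≤? _
arrivesFrom? w (south k) = _ ℕ.<? _

arrives⇒column≤ : (w v : Vertex n) → ArrivesFrom w v → toℕ (column w) ≤ toℕ (column v)
arrives⇒column≤ w (north k) p = p
arrives⇒column≤ w (south k) p = ℕ.<⇒≤ p

arrives-connex : (w v : Vertex n) → w ≢ v → ¬ ArrivesFrom w v → ArrivesFrom v w
arrives-connex (north j) (north k) _   ¬a = ℕ.≰⇒≥ ¬a
arrives-connex (south j) (north k) _   ¬a = ℕ.≰⇒> ¬a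
arrives-connex (north j) (south k) _   ¬a = ℕ.≮⇒≥ ¬a
arrives-connex (south j) (south k) w≢v ¬a =
  ℕ.≤∧≢⇒< (ℕ.≮⇒≥ ¬a) (w≢v ∘ sym ∘ cong south ∘ Fin.toℕ-injective)

arrives-asym : (w v : Vertex n) → w ≢ v → ArrivesFrom w v → ¬ ArrivesFrom v w
arrives-asym (north j) (north k) w≢v j≤k k≤j =
  w≢v (cong north (Fin.toℕ-injective (ℕ.≤-antisym j≤k k≤j)))
arrives-asym (south j) (north k) _   j≤k k<j = ℕ.<⇒≱ k<j j≤k
arrives-asym (north j) (south k) _   j<k k≤j = ℕ.<⇒≱ j<k k≤j
arrives-asym (south j) (south k) _   j<k k<j = ℕ.<-asym j<k k<j

-- Nested edges and the two ends of an edge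

module _ (d : Diagram n) where

  partner-injective : ∀ {u v} → partner d u ≡ partner d v → u ≡ v
  partner-injective {u} {v} eq =
    trans (sym (involutive d u)) (trans (cong (partner d) eq) (involutive d v))

  -- Leaving past `partner d u` is the crossing that `planar` forbids for `u` and `x`; leaving past
  -- `u` is the one that it forbids for `partner d x` and `u`.
  inside : ∀ {u x} → u ≺ x → x ≺ partner d u → u ≺ partner d x × partner d x ≺ partner d u
  inside {u} {x} u≺x x≺pu = u≺px , px≺pu
    where
    px≺pu : partner d x ≺ partner d u
    px≺pu with ≺-connex (≺⇒≢ u≺x ∘ sym ∘ partner-injective)
    ... | inj₁ lt = lt
    ... | inj₂ gt = contradiction gt (planar d u≺x x≺pu)

    u≺px : u ≺ partner d x
    u≺px with ≺-connex {u = u} {partner d x}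
                (λ eq → ≺⇒≢ x≺pu (sym (trans (cong (partner d) eq) (involutive d x))))
    ... | inj₁ lt = lt
    ... | inj₂ gt = contradiction
      (subst (_≺ partner d u) (sym (involutive d x)) x≺pu)
      (planar d gt (subst (u ≺_) (sym (involutive d x)) u≺x))

  -- Were `partner d x` strictly between the ends, `inside` would put its own partner `x` there too.
  outside : ∀ {u x} → u ≺ partner d u → x ≺ u ⊎ partner d u ≺ x →
            partner d x ≺ u ⊎ partner d u ≺ partner d x
  outside {u} {x} u≺pu out with partner d x ≟ⱽ u | partner d x ≟ⱽ partner d u
  outside {u} {x} u≺pu (inj₁ x≺u)  | yes refl | _ =
    contradiction (subst (partner d x ≺_) (involutive d x) u≺pu) (≺-asym x≺u)
  outside {u} {x} u≺pu (inj₂ pu≺x) | yes refl | _ =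
    contradiction (subst (_≺ x) (involutive d x) pu≺x) ≺-irrefl
  outside {u} {x} u≺pu (inj₁ x≺u)  | no _ | yes eq =
    contradiction (partner-injective eq) (≺⇒≢ x≺u)
  outside {u} {x} u≺pu (inj₂ pu≺x) | no _ | yes eq with refl ← partner-injective eq =
    contradiction pu≺x (≺-asym u≺pu)
  outside {u} {x} u≺pu out | no px≢u | no px≢pu with ≺-connex px≢u | ≺-connex px≢pu
  ... | inj₁ px≺u | _          = inj₁ px≺u
  ... | inj₂ _    | inj₂ pu≺px = inj₂ pu≺px
  ... | inj₂ u≺px | inj₁ px≺pu with inside u≺px px≺pu
  ...   | u≺ppx , ppx≺pu rewrite involutive d x =
    Sum.[ contradiction u≺ppx ∘ ≺-asym , contradiction ppx≺pu ∘ ≺-asym ] out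

  Closing : Pred (Vertex n) 0ℓ
  Closing v = ArrivesFrom (partner d v) v

  closing? : Unary.Decidable Closing
  closing? v = arrivesFrom? (partner d v) v

  ¬closing⇒partner-closing : ∀ {v} → ¬ Closing v → Closing (partner d v)
  ¬closing⇒partner-closing {v} ¬c = subst (λ w → ArrivesFrom w (partner d v)) (sym (involutive d v))
    (arrives-connex (partner d v) v (no-fixed d v) ¬c)

  closing⇒partner-¬closing : ∀ {v} → Closing v → ¬ Closing (partner d v)
  closing⇒partner-¬closing {v} c c′ = arrives-asym (partner d v) v (no-fixed d v) c
    (subst (λ w → ArrivesFrom w (partner d v)) (involutive d v) c′)

-- Nearer v x y: going from v to the left and around along the boundary of
-- the strip, x is met before y.

data Nearer {n} : (v x y : Vertex n) → Set where
  north-nn : ∀ {k i j} → j Fin.< i → Nearer (north k) (north i) (north j)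
  north-ns : ∀ {k i j} → Nearer (north k) (north i) (south j)
  north-ss : ∀ {k i j} → i Fin.< j → Nearer (north k) (south i) (south j)
  south-ss : ∀ {k i j} → j Fin.< i → Nearer (south k) (south i) (south j)
  south-sn : ∀ {k i j} → Nearer (south k) (south i) (north j)
  south-nn : ∀ {k i j} → i Fin.< j → Nearer (south k) (north i) (north j)

nearer-connex : (v : Vertex n) {x y : Vertex n} → x ≢ y → Nearer v x y ⊎ Nearer v y x
nearer-connex v x≢y with ≺-connex x≢y
nearer-connex (north k) x≢y | inj₁ (north≺north i<j) = inj₂ (north-nn i<j)
nearer-connex (north k) x≢y | inj₁ north≺south       = inj₁ north-ns
nearer-connex (north k) x≢y | inj₁ (south≺south j<i) = inj₂ (north-ss j<i)
nearer-connex (north k) x≢y | inj₂ (north≺north i<j) = inj₁ (north-nn i<j)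
nearer-connex (north k) x≢y | inj₂ north≺south       = inj₂ north-ns
nearer-connex (north k) x≢y | inj₂ (south≺south j<i) = inj₁ (north-ss j<i)
nearer-connex (south k) x≢y | inj₁ (north≺north i<j) = inj₁ (south-nn i<j)
nearer-connex (south k) x≢y | inj₁ north≺south       = inj₂ south-sn
nearer-connex (south k) x≢y | inj₁ (south≺south j<i) = inj₁ (south-ss j<i)
nearer-connex (south k) x≢y | inj₂ (north≺north i<j) = inj₂ (south-nn i<j)
nearer-connex (south k) x≢y | inj₂ north≺south       = inj₁ south-sn
nearer-connex (south k) x≢y | inj₂ (south≺south j<i) = inj₂ (south-ss j<i)

≺north⇒column< : ∀ {w : Vertex n} {k} → w ≺ north k → toℕ (column w) < toℕ k
≺north⇒column< (north≺north p) = p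

south≺⇒column< : ∀ {w : Vertex n} {k} → south k ≺ w → toℕ (column w) < toℕ k
south≺⇒column< (south≺south p) = p

module _ (d : Diagram n) where

  -- An edge arriving at v separates the vertices nearer to v than its other
  -- end from all vertices in the columns beyond v.

  nearer-column : ∀ {v u} → u ≢ v → ArrivesFrom u v → Closing d v →
                  Nearer v u (partner d v) → toℕ (column (partner d u)) < toℕ (column v)
  nearer-column {v} {u} = lemma v u (partner d v) refl
    where
    flip : ∀ {v u′} → u′ ≡ partner d v → partner d u′ ≡ v
    flip refl = involutive d _

    lemma : ∀ v u u′ → u′ ≡ partner d v → u ≢ v → ArrivesFrom u v → ArrivesFrom u′ v →
            Nearer v u u′ → toℕ (column (partner d u)) < toℕ (column v)
    lemma (north k) (north i) (north j) eq u≢v i≤k _ (north-nn j<i) =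
      ≺north⇒column< (subst (partner d (north i) ≺_) (flip eq)
        (proj₂ (inside d {north j} {north i} (north≺north j<i) (subst (north i ≺_) (sym (flip eq))
             (north≺north (ℕ.≤∧≢⇒< i≤k (u≢v ∘ cong north ∘ Fin.toℕ-injective)))))))
    lemma (north k) u u′@(south j) eq u≢v u≤v j≤k nearer =
      Sum.[ ≺north⇒column<
          , (λ u′≺w → ℕ.<-≤-trans (south≺⇒column< (subst (_≺ partner d u) (sym eq) u′≺w)) j≤k) ]
        (outside d {north k} {u} (subst (north k ≺_) eq north≺south)
             (Sum.map₂ (subst (_≺ u) eq) (left-out nearer)))
      where
      left-out : Nearer (north k) u u′ → u ≺ north k ⊎ u′ ≺ u
      left-out north-ns       = inj₁
        (north≺north (ℕ.≤∧≢⇒< u≤v (u≢v ∘ cong north ∘ Fin.toℕ-injective)))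
      left-out (north-ss i<j) = inj₂ (south≺south i<j)
    lemma (south k) (south i) (south j) eq u≢v i<k j<k (south-ss j<i) =
      south≺⇒column< (proj₁
        (inside d {south k} {south i} (south≺south i<k) (subst (south i ≺_) eq (south≺south j<i))))
    lemma (south k) u u′@(north j) eq u≢v u<v j<k nearer =
      Sum.[ (λ w≺u′ → ℕ.<-trans (≺north⇒column< w≺u′) j<k)
          , (λ v≺w → south≺⇒column< (subst (_≺ partner d u) (flip eq) v≺w)) ]
        (outside d {north j} {u} (subst (north j ≺_) (sym (flip eq)) north≺south)
             (Sum.map₂ (subst (_≺ u) (sym (flip eq))) (left-out nearer)))
      where
      left-out : Nearer (south k) u u′ → u ≺ north j ⊎ south k ≺ u
      left-out south-sn       = inj₂ (south≺south u<v)
      left-out (south-nn i<j) = inj₁ (north≺north i<j)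

-- Closing vertices determine the diagram

module _ (d d′ : Diagram n) (agree : ∀ v → Closing d v ⇔ Closing d′ v) where

  private
    AgreeAt : ℕ → Set
    AgreeAt m = ∀ v → toℕ (column v) ≡ m → Closing d v → partner d v ≡ partner d′ v

    -- If the partners of v differ, the nearer one has in the other diagram a
    -- partner to the left of v, where the diagrams are already known to agree.

    agree-at : ∀ m → (∀ {m′} → m′ < m → AgreeAt m′) → AgreeAt m
    agree-at m rec v refl c with partner d v ≟ⱽ partner d′ v
    ... | yes eq = eq
    ... | no u≢u′ = Sum.[ (λ near → contradiction (u-unmoved near) (u≢u′ ∘ sym)) ,
          (λ near → contradiction (u′-unmoved near) u≢u′) ]
      (nearer-connex v u≢u′)
      where
      c′ : Closing d′ v
      c′ = to (agree v) c

      u-unmoved : Nearer v (partner d v) (partner d′ v) → partner d′ v ≡ partner d v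
      u-unmoved near = trans (cong (partner d′) v≡w) (involutive d′ _)
        where
        -- `w` closes in both diagrams and lies to the left of `v`, so by induction both join it to
        -- `partner d v`; but in `d` that vertex is joined to `v`.
        w = partner d′ (partner d v)
        w-closing : Closing d w
        w-closing = from (agree w)
          (¬closing⇒partner-closing d′ (closing⇒partner-¬closing d c ∘ from (agree _)))
        v≡w : v ≡ w
        v≡w = partner-injective d (sym (trans
          (rec (nearer-column d′ (no-fixed d v) c c′ near) w refl w-closing) (involutive d′ _)))

      u′-unmoved : Nearer v (partner d′ v) (partner d v) → partner d v ≡ partner d′ v
      u′-unmoved near = trans (cong (partner d) v≡w) (involutive d _)
        where
        w = partner d (partner d′ v)
        w-closing : Closing d w
        w-closing = ¬closing⇒partner-closing d (closing⇒partner-¬closing d′ c′ ∘ to (agree _))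
        v≡w : v ≡ w
        v≡w = partner-injective d′ (sym (trans
          (sym (rec (nearer-column d (no-fixed d′ v) c′ c near) w refl w-closing))
            (involutive d _)))

    agree-closing : ∀ v → Closing d v → partner d v ≡ partner d′ v
    agree-closing v = <-rec AgreeAt agree-at _ v refl

  closing-determines : d ≈ d′
  closing-determines v with closing? d v
  ... | yes c = agree-closing v c
  ... | no ¬c = partner-injective d′ (trans
    (sym (agree-closing (partner d v) (¬closing⇒partner-closing d ¬c)))
    (trans (involutive d v) (sym (involutive d′ v))))

-- Multiplication by a hook

module Transposition {A : Set} (_≟_ : DecidableEquality A) (x y : A) where

  transpose : A → A
  transpose z with z ≟ x | z ≟ y
  ... | yes _ | _     = y
  ... | no _  | yes _ = x
  ... | no _  | no _  = z

  transpose-first : transpose x ≡ y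
  transpose-first with x ≟ x
  ... | yes _  = refl
  ... | no x≢x = contradiction refl x≢x

  transpose-second : transpose y ≡ x
  transpose-second with y ≟ x | y ≟ y
  ... | yes y≡x | _      = y≡x
  ... | no _    | yes _  = refl
  ... | no _    | no y≢y = contradiction refl y≢y

  transpose-other : ∀ {z} → z ≢ x → z ≢ y → transpose z ≡ z
  transpose-other {z} z≢x z≢y with z ≟ x | z ≟ y
  ... | yes z≡x | _       = contradiction z≡x z≢x
  ... | no _    | yes z≡y = contradiction z≡y z≢y
  ... | no _    | no _    = refl

  transpose-involutive : ∀ z → transpose (transpose z) ≡ z
  transpose-involutive z with z ≟ x in eq₁ | z ≟ y in eq₂
  ... | yes refl | _        = transpose-second
  ... | no _     | yes refl = transpose-first
  ... | no z≢x   | no z≢y   = transpose-other z≢x z≢y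

-- The product e D, where e is the hook at the columns l and r, when D does
-- not close the arc of e to a loop: the partners of l and r in D become
-- joined to each other.  As a matching this is D conjugated by a transposition.

module Prepend (D : Diagram n) {l r : Fin n} (adjacent : toℕ r ≡ suc (toℕ l))
               (no-loop : partner D (north l) ≢ north r) where

  private
    p = partner D
    L = north l
    R = north r

  a b : Vertex n
  a = p L
  b = p R

  -- Exchanging `a` and `R` turns the edges {L, a}, {R, b} of `D` into {L, R}, {a, b} and fixes all
  -- others. Conjugation keeps an involution without fixed points, so only planarity needs a case
  -- analysis.
  open Transposition _≟ⱽ_ a R

  prepend-partner : Vertex n → Vertex n
  prepend-partner v = transpose (p (transpose v))

  l<r : l Fin.< r
  l<r = ℕ.≤-reflexive (sym adjacent)

  private
    q = prepend-partner

    L≺R : L ≺ R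
    L≺R = north≺north l<r

    before-R : ∀ {x} → x ≢ L → x ≺ R → x ≺ L
    before-R {north x} x≢L (north≺north x<r) = north≺north
      (ℕ.≤∧≢⇒< (ℕ.s≤s⁻¹ (subst (suc (toℕ x) ≤_) adjacent x<r))
        (x≢L ∘ cong north ∘ Fin.toℕ-injective))

    after-L : ∀ {x} → x ≢ R → L ≺ x → R ≺ x
    after-L {north x} x≢R (north≺north l<x) = north≺north
      (ℕ.≤∧≢⇒< (subst (_≤ toℕ x) (sym adjacent) l<x) (x≢R ∘ sym ∘ cong north ∘ Fin.toℕ-injective))
    after-L {south x} _ _ = north≺south

    flip : ∀ {x y} → p x ≡ y → p y ≡ x
    flip refl = involutive D _

    pa≡L : p a ≡ L
    pa≡L = involutive D L

    pb≡R : p b ≡ R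
    pb≡R = involutive D R

    b≢L : b ≢ L
    b≢L = no-loop ∘ flip

    b≢a : b ≢ a
    b≢a = ≺⇒≢ L≺R ∘ sym ∘ partner-injective D

  prepend-L : prepend-partner (north l) ≡ north r
  prepend-L = trans (cong (transpose ∘ p) (transpose-other (no-fixed D L ∘ sym) (≺⇒≢ L≺R)))
    transpose-first

  prepend-R : prepend-partner (north r) ≡ north l
  prepend-R = trans (cong (transpose ∘ p) transpose-second)
    (trans (cong transpose pa≡L) (transpose-other (no-fixed D L ∘ sym) (≺⇒≢ L≺R)))

  prepend-a : prepend-partner a ≡ b
  prepend-a = trans (cong (transpose ∘ p) transpose-first) (transpose-other b≢a (no-fixed D R))

  prepend-b : prepend-partner b ≡ a
  prepend-b = trans (cong (transpose ∘ p) (transpose-other b≢a (no-fixed D R)))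
    (trans (cong transpose pb≡R) transpose-second)

  prepend-other : ∀ {v} → v ≢ north l → v ≢ north r → v ≢ a → v ≢ b → prepend-partner v ≡ p v
  prepend-other {v} v≢L v≢R v≢a v≢b = trans (cong (transpose ∘ p) (transpose-other v≢a v≢R))
    (transpose-other (v≢L ∘ partner-injective D) (v≢b ∘ sym ∘ flip))

  data Place (v : Vertex n) : Set where
    at-L  : v ≡ north l → Place v
    at-R  : v ≡ north r → Place v
    at-a  : v ≡ a → Place v
    at-b  : v ≡ b → Place v
    other : v ≢ north l → v ≢ north r → v ≢ a → v ≢ b → Place v

  place : ∀ v → Place v
  place v with v ≟ⱽ L | v ≟ⱽ R | v ≟ⱽ a | v ≟ⱽ b
  ... | yes eq | _      | _      | _      = at-L eq
  ... | no _   | yes eq | _      | _      = at-R eq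
  ... | no _   | no _   | yes eq | _      = at-a eq
  ... | no _   | no _   | no _   | yes eq = at-b eq
  ... | no ≢L  | no ≢R  | no ≢a  | no ≢b  = other ≢L ≢R ≢a ≢b

  private
    -- An edge that encloses `a` encloses its partner `L`, hence the neighbour `R` of `L`, hence
    -- `b`. So no other edge separates `a` from `b`.
    inside-a⇒inside-b : ∀ {x} → x ≢ L → x ≢ R → x ≢ a → x ≢ b →
                        x ≺ a → a ≺ p x → x ≺ b × b ≺ p x
    inside-a⇒inside-b {x} x≢L x≢R x≢a x≢b x≺a a≺px
      with x≺L , L≺px ← subst (λ v → x ≺ v × v ≺ p x) pa≡L (inside D x≺a a≺px) =
      inside D (≺-trans x≺L L≺R) (after-L (x≢b ∘ sym ∘ flip) L≺px)

    inside-b⇒inside-a : ∀ {x} → x ≢ L → x ≢ R → x ≢ a → x ≢ b →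
                        x ≺ b → b ≺ p x → x ≺ a × a ≺ p x
    inside-b⇒inside-a {x} x≢L x≢R x≢a x≢b x≺b b≺px
      with x≺R , R≺px ← subst (λ v → x ≺ v × v ≺ p x) pb≡R (inside D x≺b b≺px) =
      inside D (before-R x≢L x≺R) (≺-trans L≺R R≺px)

    L-R-adjacent : ∀ {x} → x ≢ L → L ≺ x → ¬ (x ≺ R)
    L-R-adjacent x≢L L≺x x≺R = ≺-asym L≺x (before-R x≢L x≺R)

    noncrossing : ∀ {u v qu qv} → Place u → Place v → qu ≡ q u → qv ≡ q v →
                  u ≺ v → v ≺ qu → ¬ (qu ≺ qv)
    noncrossing {v = v} (at-L refl) _ refl refl u≺v v≺qu _ =
      L-R-adjacent (≺⇒≢ u≺v ∘ sym) u≺v (subst (v ≺_) prepend-L v≺qu)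
    noncrossing {v = v} (at-R refl) _ refl refl u≺v v≺qu _ =
      ≺-asym L≺R (≺-trans u≺v (subst (v ≺_) prepend-R v≺qu))
    noncrossing (at-a refl) pv equ eqv u≺v v≺qu qu≺qv with refl ← trans equ prepend-a | pv
    ... | at-L refl with refl ← trans eqv prepend-L = L-R-adjacent b≢L v≺qu qu≺qv
    ... | at-R refl with refl ← trans eqv prepend-R = ≺-asym L≺R (≺-trans v≺qu qu≺qv)
    ... | at-a refl = ≺-irrefl u≺v
    ... | at-b refl = ≺-irrefl v≺qu
    ... | other ≢L ≢R ≢a ≢b with refl ← trans eqv (prepend-other ≢L ≢R ≢a ≢b) =
      ≺-asym u≺v (proj₁ (inside-b⇒inside-a ≢L ≢R ≢a ≢b v≺qu qu≺qv))
    noncrossing (at-b refl) pv equ eqv u≺v v≺qu qu≺qv with refl ← trans equ prepend-b | pv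
    ... | at-L refl with refl ← trans eqv prepend-L = L-R-adjacent (no-fixed D L) v≺qu qu≺qv
    ... | at-R refl with refl ← trans eqv prepend-R = ≺-asym L≺R (≺-trans v≺qu qu≺qv)
    ... | at-a refl = ≺-irrefl v≺qu
    ... | at-b refl = ≺-irrefl u≺v
    ... | other ≢L ≢R ≢a ≢b with refl ← trans eqv (prepend-other ≢L ≢R ≢a ≢b) =
      ≺-asym u≺v (proj₁ (inside-a⇒inside-b ≢L ≢R ≢a ≢b v≺qu qu≺qv))
    noncrossing (other u≢L u≢R u≢a u≢b) pv equ eqv u≺v v≺qu qu≺qv
      with refl ← trans equ (prepend-other u≢L u≢R u≢a u≢b) | pv
    ... | at-L refl with refl ← trans eqv prepend-L = L-R-adjacent (u≢a ∘ sym ∘ flip) v≺qu qu≺qv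
    ... | at-R refl with refl ← trans eqv prepend-R = ≺-asym L≺R (≺-trans v≺qu qu≺qv)
    ... | at-a refl with refl ← trans eqv prepend-a =
      ≺-asym qu≺qv (proj₂ (inside-a⇒inside-b u≢L u≢R u≢a u≢b u≺v v≺qu))
    ... | at-b refl with refl ← trans eqv prepend-b =
      ≺-asym qu≺qv (proj₂ (inside-b⇒inside-a u≢L u≢R u≢a u≢b u≺v v≺qu))
    ... | other ≢L ≢R ≢a ≢b with refl ← trans eqv (prepend-other ≢L ≢R ≢a ≢b) =
      planar D u≺v v≺qu qu≺qv

  prepend : Diagram n
  prepend = record
    { partner    = prepend-partner
    ; involutive = λ v → trans (cong (transpose ∘ p) (transpose-involutive _))
        (trans (cong transpose (involutive D _)) (transpose-involutive v))
    ; no-fixed   = λ v eq → no-fixed D (transpose v)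
      (trans (sym (transpose-involutive _)) (cong transpose eq))
    ; planar     = λ {u} {v} → noncrossing (place u) (place v) refl refl
    }

  open Hook l r adjacent using (Role; left; right; through; role; hook)

  private
    l≢r : l ≢ r
    l≢r l≡r = ℕ.<-irrefl (cong toℕ l≡r) l<r

    hook-north-l : partner hook (north l) ≡ north r
    hook-north-l with role l
    ... | left          = refl
    ... | right         = refl
    ... | through l≢l _ = contradiction refl l≢l

    hook-south-l : partner hook (south l) ≡ south r
    hook-south-l with role l
    ... | left          = refl
    ... | right         = refl
    ... | through l≢l _ = contradiction refl l≢l

    hook-south-other : ∀ {j} → j ≢ l → j ≢ r → partner hook (south j) ≡ north j
    hook-south-other {j} j≢l j≢r with role j
    ... | left        = contradiction refl j≢l
    ... | right       = contradiction refl j≢r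
    ... | through _ _ = refl

    infix 4 _~_
    _~_ : StackVertex n → StackVertex n → Set
    _~_ = Joined hook D

    upper~ : ∀ {v w} → partner hook v ≡ w → upper v ~ upper w
    upper~ refl = EqClosure.return (upper-edge _)

    lower~ : ∀ v → lower v ~ lower (p v)
    lower~ v = EqClosure.return (lower-edge v)

    ~-sym : ∀ {x y} → x ~ y → y ~ x
    ~-sym = EqClosure.symmetric _

    infixr 5 _∙_
    _∙_ : ∀ {x y z} → x ~ y → y ~ z → x ~ z
    _∙_ = EqClosure.transitive _

    -- Outside its two columns the hook consists of vertical edges, which carry a middle vertex
    -- straight to the top; the southern vertices of `D` are outer already.
    lower~outer : ∀ v → v ≢ L → v ≢ R → lower v ~ outer v
    lower~outer (north j) v≢L v≢R = upper~ (hook-south-other (v≢L ∘ cong north) (v≢R ∘ cong north))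
    lower~outer (south j) _   _   = EqClosure.reflexive _

    L~a : lower L ~ outer a
    L~a = lower~ L ∙ lower~outer a (no-fixed D L) no-loop

    R~b : lower R ~ outer b
    R~b = lower~ R ∙ lower~outer b b≢L (no-fixed D R)

    -- The new edge runs from `a` to the middle vertex at `l`, along the southern arc of the hook,
    -- and from the middle vertex at `r` to `b`.
    a~b : outer a ~ outer b
    a~b = ~-sym L~a ∙ upper~ hook-south-l ∙ R~b

    -- This excludes closed loops, each of which would have to pass through the middle line.
    middle~outer : ∀ v → Place v → ∃[ w ] lower v ~ outer w
    middle~outer _ (at-L refl)         = a , L~a
    middle~outer _ (at-R refl)         = b , R~b
    middle~outer _ (at-a refl)         = a , lower~outer a (no-fixed D L) no-loop
    middle~outer _ (at-b refl)         = b , lower~outer b b≢L (no-fixed D R)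
    middle~outer v (other ≢L ≢R ≢a ≢b) = v , lower~outer v ≢L ≢R

    outer-path : ∀ v → Place v → outer v ~ outer (prepend-partner v)
    outer-path _ (at-L refl) rewrite prepend-L = upper~ hook-north-l
    outer-path _ (at-R refl) rewrite prepend-R = ~-sym (upper~ hook-north-l)
    outer-path _ (at-a refl) rewrite prepend-a = a~b
    outer-path _ (at-b refl) rewrite prepend-b = ~-sym a~b
    outer-path v (other ≢L ≢R ≢a ≢b) rewrite prepend-other ≢L ≢R ≢a ≢b =
      ~-sym (lower~outer v ≢L ≢R) ∙ lower~ v ∙
      lower~outer (p v) (≢a ∘ sym ∘ flip) (≢b ∘ sym ∘ flip)

  prepend-product : StackedProduct hook D 0 prepend
  prepend-product = record
    { loops = record
      { representative = λ ()
      ; on-loop        = λ ()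
      ; distinct       = λ { {()} }
      ; exhaustive     = λ {m} loop → let w , m~w = middle~outer (north m) (place (north m))
                                      in contradiction m~w (loop w)
      }
    ; paths = λ v → outer-path v (place v)
    }

-- Diagrams and pairs of lattice paths

-- d has the compass directions of the two lattice paths whose points with
-- x − y = k lie in rows U k and V k, except that where the paths coincide
-- both of them count as going south.

record Traces (d : Diagram n) (U V : ℕ → ℕ) : Set where
  field
    north-opens  : ∀ j → (¬ Closing d (north j)) ⇔
                   (U (suc (toℕ j)) ≡ U (toℕ j) × U (toℕ j) < V (suc (toℕ j)))
    south-closes : ∀ j → Closing d (south j) ⇔
                   (V (suc (toℕ j)) ≡ V (toℕ j) × U (toℕ j) < V (toℕ j))
    through      : ∀ j → U (toℕ j) ≡ V (toℕ j) → U (suc (toℕ j)) ≡ V (suc (toℕ j)) →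
                   partner d (north j) ≡ south j

open Traces

north-opens⇔⇒≈ : {d d′ : Diagram n} →
                 (∀ j → (¬ Closing d (north j)) ⇔ (¬ Closing d′ (north j))) →
                 (∀ j → Closing d (south j) ⇔ Closing d′ (south j)) → d ≈ d′
north-opens⇔⇒≈ {d = d} {d′} opens closes = closing-determines d d′ agree
  where
  agree : ∀ v → Closing d v ⇔ Closing d′ v
  agree (north j) = mk⇔
    (λ c → decidable-stable (closing? d′ (north j)) λ ¬c → from (opens j) ¬c c)
    (λ c → decidable-stable (closing? d (north j)) λ ¬c → to (opens j) ¬c c)
  agree (south j) = closes j

traces-unique : ∀ {d d′ : Diagram n} {U V} → Traces d U V → Traces d′ U V → d ≈ d′
traces-unique {d = d} {d′} t t′ = north-opens⇔⇒≈ {d = d} {d′}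
  (λ j → ⇔-trans (north-opens t j) (⇔-sym (north-opens t′ j)))
  (λ j → ⇔-trans (south-closes t j) (⇔-sym (south-closes t′ j)))

-- The upper path after removal of the box at its corner on the diagonal `k`.
raise : ℕ → (ℕ → ℕ) → ℕ → ℕ
raise k U j with j ℕ.≟ k
... | yes _ = suc (U j)
... | no _  = U j

raise-at : ∀ k U → raise k U k ≡ suc (U k)
raise-at k U with k ℕ.≟ k
... | yes _  = refl
... | no k≢k = contradiction refl k≢k

raise-off : ∀ {j k} U → j ≢ k → raise k U j ≡ U j
raise-off {j} {k} U j≢k with j ℕ.≟ k
... | yes j≡k = contradiction j≡k j≢k
... | no _    = refl

column<⇒arrives : {w v : Vertex n} → toℕ (column w) < toℕ (column v) → ArrivesFrom w v
column<⇒arrives {v = north _} = ℕ.<⇒≤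
column<⇒arrives {v = south _} p = p

-- Traces of the product with a hook

module _ {U V : ℕ → ℕ} {D : Diagram n} {l r : Fin n} (adjacent : toℕ r ≡ suc (toℕ l))
         (flat  : U (toℕ r) ≡ U (toℕ l))
         (rises : U (suc (toℕ r)) ≡ suc (U (toℕ r)))
         (grows : V (toℕ r) ≤ V (suc (toℕ r)))
         (room  : U (toℕ r) < V (toℕ r))
         (traces : Traces D (raise (toℕ r) U) V) where

  private
    U′ : ℕ → ℕ
    U′ = raise (toℕ r) U

    U′r : U′ (toℕ r) ≡ suc (U (toℕ r))
    U′r = raise-at (toℕ r) U

    U′r+1 : U′ (suc (toℕ r)) ≡ suc (U (toℕ r))
    U′r+1 = trans (raise-off U ℕ.1+n≢n) rises

    U′j : ∀ {j : Fin n} → j ≢ r → U′ (toℕ j) ≡ U (toℕ j)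
    U′j j≢r = raise-off U (j≢r ∘ Fin.toℕ-injective)

    U′j+1 : ∀ {j : Fin n} → j ≢ l → U′ (suc (toℕ j)) ≡ U (suc (toℕ j))
    U′j+1 j≢l = raise-off U (j≢l ∘ Fin.toℕ-injective ∘ ℕ.suc-injective ∘ (λ eq → trans eq adjacent))

    l<r : toℕ l < toℕ r
    l<r = ℕ.≤-reflexive (sym adjacent)

    l≢r : l ≢ r
    l≢r l≡r = ℕ.<-irrefl (cong toℕ l≡r) l<r

    -- By `flat` and `rises` the path turns from west to south at `r`. Without the box in this
    -- corner it turns from south to west, so the path of `D` goes south at `l`.
    L-closes : Closing D (north l)
    L-closes = decidable-stable (closing? D (north l)) λ ¬c →
      let eq , _ = to (north-opens traces l) ¬c
      in ℕ.1+n≢n (begin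
        suc (U (toℕ r))     ≡⟨ U′r ⟨
        U′ (toℕ r)          ≡⟨ cong U′ adjacent ⟩
        U′ (suc (toℕ l))    ≡⟨ eq ⟩
        U′ (toℕ l)          ≡⟨ U′j l≢r ⟩
        U (toℕ l)           ≡⟨ flat ⟨
        U (toℕ r)           ∎)
      where
      open ≡-Reasoning

  -- The edge of `D` at `north l` arrives there from the left, whereas `north r` lies to the right.
  prepend-no-loop : partner D (north l) ≢ north r
  prepend-no-loop eq = ℕ.<⇒≱ l<r (subst (λ v → ArrivesFrom v (north l)) eq L-closes)

  open Prepend D adjacent prepend-no-loop using
    (prepend; a; b; Place; at-L; at-R; at-a; at-b; other; place;
    prepend-L; prepend-R; prepend-a; prepend-b; prepend-other)

  private
    -- The raised path goes west from the diagonal r to r + 1, which makes `north r` open in `D` if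
    -- there is still a box below this step. If there is none, both paths coincide on the two
    -- diagonals, and `through` provides a vertical edge.
    R-case : (¬ Closing D (north r) × suc (U (toℕ r)) < V (suc (toℕ r))) ⊎
             (b ≡ south r × V (suc (toℕ r)) ≡ V (toℕ r))
    R-case with closing? D (north r)
    ... | no ¬c = inj₁ (¬c , subst (_< V (suc (toℕ r))) U′r (proj₂ (to (north-opens traces r) ¬c)))
    ... | yes c = inj₂
      ( through traces r (trans U′r (ℕ.≤-antisym room (ℕ.≤-trans grows short)))
          (trans U′r+1 (ℕ.≤-antisym (ℕ.≤-trans room grows) short))
      , ℕ.≤-antisym (ℕ.≤-trans short room) grows )
      where
      short : V (suc (toℕ r)) ≤ suc (U (toℕ r))
      short = ℕ.≮⇒≥ λ long → from (north-opens traces r)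
        (trans U′r+1 (sym U′r) , subst (_< V (suc (toℕ r))) (sym U′r) long) c

    a≤l : toℕ (column a) ≤ toℕ l
    a≤l = L-closes

    r≤b : toℕ r ≤ toℕ (column b)
    r≤b with R-case
    ... | inj₁ (¬c , _) = ℕ.<⇒≤ (ℕ.≰⇒> ¬c)
    ... | inj₂ (eq , _) = ℕ.≤-reflexive (cong (toℕ ∘ column) (sym eq))

    a<b : toℕ (column a) < toℕ (column b)
    a<b = ℕ.≤-<-trans a≤l (ℕ.<-≤-trans l<r r≤b)

    eD = prepend

    flip : ∀ {x y} → partner D x ≡ y → partner D y ≡ x
    flip refl = involutive D _

    -- The new edge leads from `a`, in a column at most l, to `b`, in a column at least r; so `a`
    -- stays opening and `b` stays closing. The exception is `b` = `south r`, an opening vertex of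
    -- `D` because a vertical edge arrives at its north end.
    same-closing : ∀ v → v ≢ north l → v ≢ north r → v ≢ south r → Closing D v ⇔ Closing eD v
    same-closing v v≢L v≢R v≢r′ with place v
    ... | at-L eq = contradiction eq v≢L
    ... | at-R eq = contradiction eq v≢R
    ... | at-a refl rewrite prepend-a | involutive D (north l) = mk⇔
      (λ c → contradiction c (arrives-asym a (north l) (no-fixed D _) L-closes))
      (λ c → contradiction (arrives⇒column≤ b a c) (ℕ.<⇒≱ a<b))
    ... | at-b refl with R-case
    ...   | inj₂ (eq , _) = contradiction eq v≢r′
    ...   | inj₁ (¬c , _) rewrite prepend-b | involutive D (north r) = mk⇔
      (λ _ → column<⇒arrives a<b)
      (λ _ → arrives-connex b (north r) (no-fixed D _) ¬c)
    same-closing v v≢L v≢R v≢r′ | other ≢L ≢R ≢a ≢b rewrite prepend-other ≢L ≢R ≢a ≢b =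
      mk⇔ (λ c → c) (λ c → c)

    ¬-cong : ∀ {A B : Set} → A ⇔ B → (¬ A) ⇔ (¬ B)
    ¬-cong A⇔B = mk⇔ (_∘ from A⇔B) (_∘ to A⇔B)

    north-opens′ : ∀ j → Dec (j ≡ l) → Dec (j ≡ r) → (¬ Closing eD (north j)) ⇔
                   (U (suc (toℕ j)) ≡ U (toℕ j) × U (toℕ j) < V (suc (toℕ j)))
    north-opens′ j (yes refl) _ rewrite prepend-L = mk⇔
      (λ _ → trans (cong U (sym adjacent)) flat , subst₂ _<_ flat (cong V adjacent) room)
      (λ _ → ℕ.<⇒≱ l<r)
    north-opens′ j (no _) (yes refl) rewrite prepend-R = mk⇔
      (λ ¬c → contradiction (ℕ.<⇒≤ l<r) ¬c)
      (λ (eq , _) → contradiction (trans (sym rises) eq) ℕ.1+n≢n)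
    north-opens′ j (no j≢l) (no j≢r) =
      subst₂ (λ x y → (¬ Closing eD (north j)) ⇔ (x ≡ y × y < V (suc (toℕ j))))
        (U′j+1 j≢l) (U′j j≢r)
        (⇔-trans (⇔-sym (¬-cong (same-closing (north j) (λ { refl → j≢l refl })
          (λ { refl → j≢r refl }) λ ())))
          (north-opens traces j))

    south-closes′ : ∀ j → Dec (j ≡ r) → Closing eD (south j) ⇔
                    (V (suc (toℕ j)) ≡ V (toℕ j) × U (toℕ j) < V (toℕ j))
    south-closes′ j (no j≢r) = subst (λ y →
      Closing eD (south j) ⇔ (V (suc (toℕ j)) ≡ V (toℕ j) × y < V (toℕ j)))
      (U′j j≢r)
      (⇔-trans (⇔-sym (same-closing (south j) (λ ()) (λ ()) (λ { refl → j≢r refl })))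
        (south-closes traces j))
    south-closes′ j (yes refl) with R-case
    -- The vertical edge has given way to the edge from `a`, which arrives at `south r`; accordingly
    -- the added box makes the heights differ on this diagonal.
    ... | inj₂ (b≡r′ , eq) = mk⇔ (λ _ → eq , room)
      (λ _ → subst (λ v → toℕ (column v) < toℕ r)
          (sym (trans (cong (partner eD) (sym b≡r′)) prepend-b))
        (ℕ.≤-<-trans a≤l l<r))
    ... | inj₁ (¬c , long) with place (south r)
    ...   | at-a r′≡a = contradiction a≤l (ℕ.<⇒≱ (subst (λ v → toℕ l < toℕ (column v)) r′≡a l<r))
    ...   | at-b r′≡b = contradiction (ℕ.≤-reflexive (cong (toℕ ∘ column) (sym r′≡b))) ¬c
    ...   | other ≢L ≢R ≢a ≢b rewrite prepend-other ≢L ≢R ≢a ≢b = mk⇔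
      (λ c → proj₁ (to (south-closes traces r) c) , room)
      (λ (eq , _) → from (south-closes traces r) (eq , subst₂ _<_ (sym U′r) eq long))

  prepend-traces : Traces prepend U V
  prepend-traces .north-opens j = north-opens′ j (j Fin.≟ l) (j Fin.≟ r)
  prepend-traces .south-closes j = south-closes′ j (j Fin.≟ r)
  prepend-traces .through j U≡V U≡V′ = trans (prepend-other
      (λ { refl → j≢l refl }) (λ { refl → j≢r refl })
      (λ eq → contradiction (trans (sym straight) (trans (cong (partner D) eq) (involutive D _)))
          λ ())
      (λ eq → contradiction (trans (sym straight) (trans (cong (partner D) eq) (involutive D _)))
          λ ()))
      straight
    where
    j≢r : j ≢ r
    j≢r refl = ℕ.<-irrefl U≡V room
    j≢l : j ≢ l
    j≢l refl = ℕ.<-irrefl (subst (λ k → U k ≡ V k) (sym adjacent) U≡V′) room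
    straight : partner D (north j) ≡ south j
    straight = through traces j (trans (U′j j≢r) U≡V) (trans (U′j+1 j≢l) U≡V′)

-- Pairs of paths and the regions between them

record Profile (n : ℕ) (U V : ℕ → ℕ) : Set where
  field
    U-step : ∀ k → U (suc k) ≡ U k ⊎ U (suc k) ≡ suc (U k)
    V-step : ∀ k → V (suc k) ≡ V k ⊎ V (suc k) ≡ suc (V k)
    U≤V    : ∀ k → U k ≤ V k
    start  : U 0 ≡ V 0
    end    : ∀ {k} → n ≤ k → U k ≡ V k

  U-grows : ∀ k → U k ≤ U (suc k)
  U-grows k = Sum.[ ℕ.≤-reflexive ∘ sym , (λ eq → ℕ.<⇒≤ (ℕ.≤-reflexive (sym eq))) ] (U-step k)

  V-grows : ∀ k → V k ≤ V (suc k)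
  V-grows k = Sum.[ ℕ.≤-reflexive ∘ sym , (λ eq → ℕ.<⇒≤ (ℕ.≤-reflexive (sym eq))) ] (V-step k)

  U-grows≤1 : ∀ k → U (suc k) ≤ suc (U k)
  U-grows≤1 k = Sum.[ (λ eq → ℕ.≤-trans (ℕ.≤-reflexive eq) (ℕ.n≤1+n _)) , ℕ.≤-reflexive ] (U-step k)

  V-grows≤1 : ∀ k → V (suc k) ≤ suc (V k)
  V-grows≤1 k = Sum.[ (λ eq → ℕ.≤-trans (ℕ.≤-reflexive eq) (ℕ.n≤1+n _)) , ℕ.≤-reflexive ] (V-step k)

open Profile

-- The pair (k , r) stands for the box labelled k in row r, whose corner is
-- (r + 1 , r + 1 - k) up to translation along the diagonal.

Region : (U V : ℕ → ℕ) → ℕ × ℕ → Set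
Region U V (k , r) = U k ≤ r × r < V k

infix 4 _⊑_

-- This is the product order on the corners; the second condition compares the columns r + 1 - k and
-- r′ + 1 - k′ without subtraction.
_⊑_ : ℕ × ℕ → ℕ × ℕ → Set
(k , r) ⊑ (k′ , r′) = r ≤ r′ × r + k′ ≤ r′ + k

⊑-refl : ∀ {b} → b ⊑ b
⊑-refl = ℕ.≤-refl , ℕ.≤-refl

region-label>0 : ∀ {U V k r} → Profile n U V → Region U V (k , r) → 0 < k
region-label>0 {k = zero}  p (U≤r , r<V) =
  contradiction (ℕ.≤-<-trans U≤r r<V) (ℕ.<-irrefl (start p))
region-label>0 {k = suc _} _ _           = s≤s z≤n

region-label< : ∀ {U V k r} → Profile n U V → Region U V (k , r) → k < n
region-label< p (U≤r , r<V) = ℕ.≰⇒> λ n≤k → ℕ.<-irrefl (end p n≤k) (ℕ.≤-<-trans U≤r r<V)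

-- The `0` is the number of closed loops: every partial product of the word is a diagram with
-- coefficient 1, whatever δ is.
data Reads {n : ℕ} : List ℕ → Diagram n → Set where
  []     : Reads [] identity
  prefix : ∀ {i w D D′} (0<i : 0 < i) (i<n : i < n) →
           StackedProduct (e i 0<i i<n) D 0 D′ → Reads w D → Reads (i ∷ w) D′

identity-traces : ∀ {U V} → (∀ b → ¬ Region U V b) → Traces (identity {n}) U V
identity-traces ∅ = record
  { north-opens  = λ j → mk⇔ (contradiction ℕ.≤-refl)
      (λ (eq , U<V) → contradiction (ℕ.≤-reflexive eq , U<V) (∅ _))
  ; south-closes = λ j → mk⇔ (λ j<j → contradiction j<j (ℕ.<-irrefl refl))
      (λ (_ , U<V) → contradiction (ℕ.≤-refl , U<V) (∅ _))
  ; through      = λ _ _ _ → refl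
  }

module _ {U V : ℕ → ℕ} (p : Profile n U V) {k r : ℕ} (k<n : suc k < n)
    (corner-box : Region U V (suc k , r))
         (minimal : ∀ {b} → Region U V b → b ⊑ (suc k , r) → b ≡ (suc k , r)) where

  minimal-at : U (suc k) ≡ r
  minimal-at = cong proj₂ (minimal {suc k , U (suc k)}
    (ℕ.≤-refl , ℕ.≤-<-trans (proj₁ corner-box) (proj₂ corner-box))
    (proj₁ corner-box , ℕ.+-monoˡ-≤ (suc k) (proj₁ corner-box)))

  -- If the upper path went south here, the box directly north of the minimal one, which has label
  -- k, would lie in the region.
  minimal-flat : U (suc k) ≡ U k
  minimal-flat = Sum.[ (λ eq → eq) , (λ eq → contradiction (cong proj₁ (left eq)) (ℕ.1+n≢n ∘ sym)) ]
    (U-step p k)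
    where
    left : U (suc k) ≡ suc (U k) → (k , U k) ≡ (suc k , r)
    left eq = minimal
      (ℕ.≤-refl , ℕ.s≤s⁻¹ (ℕ.≤-trans (ℕ.≤-reflexive (cong suc (sym eq)))
        (ℕ.≤-trans (subst (_< V (suc k)) (sym minimal-at) (proj₂ corner-box)) (V-grows≤1 p k))))
      (subst (U k ≤_) minimal-at (U-grows p k) ,
       ℕ.≤-reflexive (trans (ℕ.+-suc (U k) k) (cong (_+ k) (trans (sym eq) minimal-at))))

  -- If the upper path went west here, the box directly west of the minimal one, which has label k +
  -- 2, would lie in the region.
  minimal-rises : U (suc (suc k)) ≡ suc (U (suc k))
  minimal-rises = Sum.[ (λ eq → contradiction (cong proj₁ (above eq)) ℕ.1+n≢n) , (λ eq → eq) ]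
    (U-step p (suc k))
    where
    above : U (suc (suc k)) ≡ U (suc k) → (suc (suc k) , r) ≡ (suc k , r)
    above eq = minimal
      (ℕ.≤-reflexive (trans eq minimal-at) , ℕ.<-≤-trans (proj₂ corner-box) (V-grows p (suc k)))
      (ℕ.≤-refl , ℕ.+-monoʳ-≤ r (ℕ.n≤1+n (suc k)))

  private
    U′ = raise (suc k) U

    U′-step : ∀ j → Dec (j ≡ k) → Dec (j ≡ suc k) → U′ (suc j) ≡ U′ j ⊎ U′ (suc j) ≡ suc (U′ j)
    U′-step j (yes refl) _ = inj₂ (trans (raise-at (suc k) U)
      (cong suc (trans minimal-flat (sym (raise-off U (ℕ.1+n≢n ∘ sym))))))
    U′-step j (no _) (yes refl) = inj₁ (trans (raise-off U ℕ.1+n≢n)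
      (trans minimal-rises (sym (raise-at (suc k) U))))
    U′-step j (no j≢k) (no j≢1+k) = subst₂ (λ x y → x ≡ y ⊎ x ≡ suc y)
      (sym (raise-off U (j≢k ∘ ℕ.suc-injective))) (sym (raise-off U j≢1+k)) (U-step p j)

    U′≤V : ∀ j → U′ j ≤ V j
    U′≤V j with j ℕ.≟ suc k
    ... | yes refl = subst (_≤ V (suc k)) (cong suc (sym minimal-at)) (proj₂ corner-box)
    ... | no _     = U≤V p j

  raise-profile : Profile n U′ V
  raise-profile = record
    { U-step = λ j → U′-step j (j ℕ.≟ k) (j ℕ.≟ suc k)
    ; V-step = V-step p
    ; U≤V    = U′≤V
    ; start  = start p
    ; end    = λ n≤j → trans (raise-off U λ { refl → ℕ.<⇒≱ k<n n≤j }) (end p n≤j)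
    }

  raise-region : ∀ {b} → Region U′ V b ⇔ (Region U V b × b ≢ (suc k , r))
  raise-region {j , r′} with j ℕ.≟ suc k
  ... | no j≢1+k = mk⇔ (λ region → region , j≢1+k ∘ cong proj₁) proj₁
  ... | yes refl = mk⇔
    (λ (U<r′ , r′<V) → (ℕ.<⇒≤ U<r′ , r′<V) ,
      λ { refl → ℕ.<-irrefl minimal-at U<r′ })
    (λ ((U≤r′ , r′<V) , ≢) → ℕ.≤∧≢⇒< U≤r′ (λ eq → ≢ (cong (suc k ,_) (trans (sym eq) minimal-at))) ,
        r′<V)

-- A linear extension of the boxes reads off the diagram of the region: its
-- first box is a corner of the upper path, and crossing it multiplies by a hook.

private
  module First {U V} {k r : ℕ} {boxes : List (ℕ × ℕ)} (p : Profile n U V)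
               (first : All (λ b → ¬ (b ⊑ (suc k , r))) boxes)
               (boxes⇔region : ∀ {b} → b ∈ (suc k , r) ∷ boxes ⇔ Region U V b) where

    corner-box : Region U V (suc k , r)
    corner-box = to boxes⇔region (here refl)

    1+k<n : suc k < n
    1+k<n = region-label< p corner-box

    k<n : k < n
    k<n = ℕ.<-trans (ℕ.n<1+n k) 1+k<n

    minimal : ∀ {b} → Region U V b → b ⊑ (suc k , r) → b ≡ (suc k , r)
    minimal region b⊑ with from boxes⇔region region
    ... | here eq  = eq
    ... | there b∈ = contradiction b⊑ (All.lookup first b∈)

    rest⇔region : ∀ {b} → b ∈ boxes ⇔ Region (raise (suc k) U) V b
    rest⇔region {b} = mk⇔
      (λ b∈ → from (raise-region p 1+k<n corner-box minimal)
        (to boxes⇔region (there b∈) , λ { refl → All.lookup first b∈ ⊑-refl }))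
      λ region → tail (to (raise-region p 1+k<n corner-box minimal) region)
      where
      tail : Region U V b × b ≢ (suc k , r) → b ∈ boxes
      tail (region , b≢) with from boxes⇔region region
      ... | here eq  = contradiction eq b≢
      ... | there b∈ = b∈

    extend : ∀ {w} → ∃[ D ] Reads {n} w D × Traces D (raise (suc k) U) V →
             ∃[ D ] Reads {n} (suc k ∷ w) D × Traces D U V
    extend (D , reads , traces) =
      prepend , prefix (s≤s z≤n) 1+k<n prepend-product reads ,
      prepend-traces adjacent flat rises grows room traces′
      where
      toℕ-r = Fin.toℕ-fromℕ< 1+k<n
      toℕ-l = Fin.toℕ-fromℕ< k<n

      adjacent : toℕ (fromℕ< 1+k<n) ≡ suc (toℕ (fromℕ< k<n))
      adjacent = trans toℕ-r (cong suc (sym toℕ-l))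

      flat : U (toℕ (fromℕ< 1+k<n)) ≡ U (toℕ (fromℕ< k<n))
      flat = trans (cong U toℕ-r) (trans (minimal-flat p 1+k<n corner-box minimal)
        (cong U (sym toℕ-l)))

      rises : U (suc (toℕ (fromℕ< 1+k<n))) ≡ suc (U (toℕ (fromℕ< 1+k<n)))
      rises = subst (λ j → U (suc j) ≡ suc (U j)) (sym toℕ-r)
        (minimal-rises p 1+k<n corner-box minimal)

      grows : V (toℕ (fromℕ< 1+k<n)) ≤ V (suc (toℕ (fromℕ< 1+k<n)))
      grows = V-grows p _

      room : U (toℕ (fromℕ< 1+k<n)) < V (toℕ (fromℕ< 1+k<n))
      room = subst (λ j → U j < V j) (sym toℕ-r) (ℕ.≤-<-trans (proj₁ corner-box) (proj₂ corner-box))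

      traces′ : Traces D (raise (toℕ (fromℕ< 1+k<n)) U) V
      traces′ = subst (λ j → Traces D (raise j U) V) (sym toℕ-r) traces

      open Prepend D adjacent (prepend-no-loop adjacent flat rises grows room traces′)

reading : ∀ {U V} (boxes : List (ℕ × ℕ)) → Profile n U V →
          AllPairs (λ b b′ → ¬ (b′ ⊑ b)) boxes → (∀ {b} → b ∈ boxes ⇔ Region U V b) →
          ∃[ D ] Reads {n} (map proj₁ boxes) D × Traces D U V
reading [] p _ boxes⇔region =
  identity , [] , identity-traces λ b region → case from boxes⇔region region of λ ()
reading ((zero , r) ∷ boxes) p _ boxes⇔region =
  contradiction (region-label>0 p (to boxes⇔region (here refl))) λ ()
reading ((suc k , r) ∷ boxes) p (first ∷ ordered) boxes⇔region =
  extend (reading boxes (raise-profile p 1+k<n corner-box minimal) ordered rest⇔region)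
  where open First p first boxes⇔region

-- The pair of paths of a diagram

lookup-injective : ∀ {A : Set} {xs : List A} → Unique xs → ∀ i j → lookup xs i ≡ lookup xs j → i ≡ j
lookup-injective (_ ∷ _)    Fin.zero    Fin.zero    _  = refl
lookup-injective (x∉ ∷ _)   Fin.zero    (Fin.suc j) eq =
  contradiction eq (All.lookup x∉ (∈-lookup j))
lookup-injective (x∉ ∷ _)   (Fin.suc i) Fin.zero    eq =
  contradiction (sym eq) (All.lookup x∉ (∈-lookup i))
lookup-injective (_ ∷ uniq) (Fin.suc i) (Fin.suc j) eq = cong Fin.suc (lookup-injective uniq i j eq)

unique-⊆⇒length≤ : ∀ {A : Set} {xs ys : List A} → Unique xs → (∀ {x} → x ∈ xs → x ∈ ys) →
                   length xs ≤ length ys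
unique-⊆⇒length≤ {xs = xs} {ys} unique xs⊆ys =
  Fin.injective⇒≤ {f = λ i → Any.index (position i)} λ {i} {j} eq →
  lookup-injective unique i j (trans (Any.lookup-index (position i))
    (trans (cong (lookup ys) eq) (sym (Any.lookup-index (position j)))))
  where
  position : ∀ i → lookup xs i ∈ ys
  position i = xs⊆ys (∈-lookup {xs = xs} i)

-- A lattice path from the northeast to the southwest is the list of its
-- steps, where true stands for S and false for W.

southSteps : List Bool → ℕ → ℕ
southSteps []          _       = 0
southSteps (_ ∷ _)     zero    = 0
southSteps (true ∷ l)  (suc k) = suc (southSteps l k)
southSteps (false ∷ l) (suc k) = southSteps l k

southSteps-zero : ∀ l → southSteps l 0 ≡ 0
southSteps-zero []      = refl
southSteps-zero (_ ∷ _) = refl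

southSteps-step : ∀ l k → southSteps l (suc k) ≡ southSteps l k ⊎ southSteps l (suc k) ≡ suc
    (southSteps l k)
southSteps-step []          k       = inj₁ refl
southSteps-step (true ∷ l)  zero    = inj₂ (cong suc (southSteps-zero l))
southSteps-step (false ∷ l) zero    = inj₁ (southSteps-zero l)
southSteps-step (true ∷ l)  (suc k) = Sum.map (cong suc) (cong suc) (southSteps-step l k)
southSteps-step (false ∷ l) (suc k) = southSteps-step l k

southSteps-S : ∀ (f : Fin n → Bool) j → f j ≡ true →
               southSteps (tabulate f) (suc (toℕ j)) ≡ suc (southSteps (tabulate f) (toℕ j))
southSteps-S f Fin.zero eq with true ← f Fin.zero =
  cong suc (southSteps-zero (tabulate (f ∘ Fin.suc)))
southSteps-S f (Fin.suc j) eq with f Fin.zero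
... | true  = cong suc (southSteps-S (f ∘ Fin.suc) j eq)
... | false = southSteps-S (f ∘ Fin.suc) j eq

southSteps-W : ∀ (f : Fin n → Bool) j → f j ≡ false →
               southSteps (tabulate f) (suc (toℕ j)) ≡ southSteps (tabulate f) (toℕ j)
southSteps-W f Fin.zero eq with false ← f Fin.zero = southSteps-zero (tabulate (f ∘ Fin.suc))
southSteps-W f (Fin.suc j) eq with f Fin.zero
... | true  = cong suc (southSteps-W (f ∘ Fin.suc) j eq)
... | false = southSteps-W (f ∘ Fin.suc) j eq

southSteps-end : ∀ {l k} → length l ≤ k → southSteps l k ≡ southSteps l (length l)
southSteps-end {[]}        {k}     _       = refl
southSteps-end {true ∷ l}  {suc k} (s≤s p) = cong suc (southSteps-end {l} p)
southSteps-end {false ∷ l} {suc k} (s≤s p) = southSteps-end {l} p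

module _ (d : Diagram n) where

  -- The southern half of `ξ` leads back to the origin; `lowerPath` is its reversal, so that N is
  -- read as S and E as W.
  upperPath lowerPath : List Bool
  upperPath = tabulate λ j → does (closing? d (north j))
  lowerPath = tabulate λ j → not (does (closing? d (south j)))

  upperSouth lowerSouth : ℕ → ℕ
  upperSouth = southSteps upperPath
  lowerSouth = southSteps lowerPath

  private
    U V : ℕ → ℕ
    U = upperSouth
    V = lowerSouth

    U-closing : ∀ {j} → Closing d (north j) → U (suc (toℕ j)) ≡ suc (U (toℕ j))
    U-closing {j} c = southSteps-S _ j (dec-true (closing? d (north j)) c)

    U-opening : ∀ {j} → ¬ Closing d (north j) → U (suc (toℕ j)) ≡ U (toℕ j)
    U-opening {j} ¬c = southSteps-W _ j (dec-false (closing? d (north j)) ¬c)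

    V-closing : ∀ {j} → Closing d (south j) → V (suc (toℕ j)) ≡ V (toℕ j)
    V-closing {j} c = southSteps-W _ j (cong not (dec-true (closing? d (south j)) c))

    V-opening : ∀ {j} → ¬ Closing d (south j) → V (suc (toℕ j)) ≡ suc (V (toℕ j))
    V-opening {j} ¬c = southSteps-S _ j (cong not (dec-false (closing? d (south j)) ¬c))

    vertices : ∀ {k} → k ≤ n → List (Vertex n)
    vertices {zero}  _   = []
    vertices {suc k} k<n = north (fromℕ< k<n) ∷ south (fromℕ< k<n) ∷ vertices (ℕ.<⇒≤ k<n)

    ∈-vertices⁻ : ∀ {k} (k≤n : k ≤ n) {v} → v ∈ vertices k≤n → toℕ (column v) < k
    ∈-vertices⁻ {suc k} k<n (here refl)         = ℕ.≤-reflexive (cong suc (Fin.toℕ-fromℕ< k<n))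
    ∈-vertices⁻ {suc k} k<n (there (here refl)) = ℕ.≤-reflexive (cong suc (Fin.toℕ-fromℕ< k<n))
    ∈-vertices⁻ {suc k} k<n (there (there v∈))  = ℕ.m<n⇒m<1+n (∈-vertices⁻ (ℕ.<⇒≤ k<n) v∈)

    ∈-vertices⁺ : ∀ {k} (k≤n : k ≤ n) v → toℕ (column v) < k → v ∈ vertices k≤n
    ∈-vertices⁺ {suc k} k<n v v< with toℕ (column v) ℕ.≟ k
    ... | no ≢ = there (there (∈-vertices⁺ _ v (ℕ.≤∧≢⇒< (ℕ.s≤s⁻¹ v<) ≢)))
    ∈-vertices⁺ {suc k} k<n (north j) v< | yes refl = here (cong north (sym (Fin.fromℕ<-toℕ j k<n)))
    ∈-vertices⁺ {suc k} k<n (south j) v< | yes refl =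
      there (here (cong south (sym (Fin.fromℕ<-toℕ j k<n))))

    vertices-unique : ∀ {k} (k≤n : k ≤ n) → Unique (vertices k≤n)
    vertices-unique {zero}  _   = []
    vertices-unique {suc k} k<n =
      ((λ ()) ∷ All.tabulate λ v∈ eq → new (north (fromℕ< k<n)) refl (subst (_∈ _) (sym eq) v∈)) ∷
      All.tabulate (λ v∈ eq → new (south (fromℕ< k<n)) refl (subst (_∈ _) (sym eq) v∈)) ∷
      vertices-unique (ℕ.<⇒≤ k<n)
      where
      new : ∀ v → column v ≡ fromℕ< k<n → ¬ (v ∈ vertices (ℕ.<⇒≤ k<n))
      new v eq v∈ = ℕ.<-irrefl (trans (cong toℕ eq) (Fin.toℕ-fromℕ< k<n)) (∈-vertices⁻ _ v∈)

    closings openings : ∀ {k} → k ≤ n → List (Vertex n)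
    closings k≤n = filter (closing? d) (vertices k≤n)
    openings k≤n = filter (¬? ∘ closing? d) (vertices k≤n)

    module Step {k} (k<n : k < n) where

      j : Fin n
      j = fromℕ< k<n

      j≡k : toℕ j ≡ k
      j≡k = Fin.toℕ-fromℕ< k<n

      U↑ : Closing d (north j) → U (suc k) ≡ suc (U k)
      U↑ = subst (λ k → U (suc k) ≡ suc (U k)) j≡k ∘ U-closing

      U→ : ¬ Closing d (north j) → U (suc k) ≡ U k
      U→ = subst (λ k → U (suc k) ≡ U k) j≡k ∘ U-opening

      V→ : Closing d (south j) → V (suc k) ≡ V k
      V→ = subst (λ k → V (suc k) ≡ V k) j≡k ∘ V-closing

      V↑ : ¬ Closing d (south j) → V (suc k) ≡ suc (V k)
      V↑ = subst (λ k → V (suc k) ≡ suc (V k)) j≡k ∘ V-opening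

    module Shift (a b c d : ℕ) (eq : a + b ≡ c + d) where

      +₁ : suc a + b ≡ c + suc d
      +₁ = trans (cong suc eq) (sym (ℕ.+-suc c d))

      +₂ : a + suc b ≡ c + suc d
      +₂ = trans (ℕ.+-suc a b) +₁

    -- Among the first k columns the northern closings are counted by U k and the southern ones by k
    -- - V k, as V rises exactly at the opening southern vertices.
    length-closings : ∀ {k} (k≤n : k ≤ n) → length (closings k≤n) + V k ≡ U k + k
    length-closings {zero}  _ = trans (southSteps-zero lowerPath)
      (sym (trans (ℕ.+-identityʳ (U 0)) (southSteps-zero upperPath)))
    length-closings {suc k} k<n = lemma (closing? d (north (fromℕ< k<n)))
      (closing? d (south (fromℕ< k<n)))
      where
      open Step k<n
      vs = vertices (ℕ.<⇒≤ k<n)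
      open Shift (length (filter (closing? d) vs)) (V k) (U k) k (length-closings (ℕ.<⇒≤ k<n))
      lemma : Dec (Closing d (north j)) → Dec (Closing d (south j)) →
          length (closings k<n) + V (suc k) ≡ U (suc k) + suc k
      lemma (yes cN) (yes cS)
        rewrite filter-accept (closing? d) {x = north j} {xs = south j ∷ vs} cN
          | filter-accept (closing? d) {x = south j} {xs = vs} cS
              | U↑ cN | V→ cS = cong suc +₁
      lemma (yes cN) (no ¬cS)
        rewrite filter-accept (closing? d) {x = north j} {xs = south j ∷ vs} cN
          | filter-reject (closing? d) {x = south j} {xs = vs} ¬cS
              | U↑ cN | V↑ ¬cS = cong suc +₂
      lemma (no ¬cN) (yes cS)
        rewrite filter-reject (closing? d) {x = north j} {xs = south j ∷ vs} ¬cN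
          | filter-accept (closing? d) {x = south j} {xs = vs} cS
              | U→ ¬cN | V→ cS = +₁
      lemma (no ¬cN) (no ¬cS)
        rewrite filter-reject (closing? d) {x = north j} {xs = south j ∷ vs} ¬cN
          | filter-reject (closing? d) {x = south j} {xs = vs} ¬cS
              | U→ ¬cN | V↑ ¬cS = +₂

    length-openings : ∀ {k} (k≤n : k ≤ n) → length (openings k≤n) + U k ≡ V k + k
    length-openings {zero}  _ = trans (southSteps-zero upperPath)
      (sym (trans (ℕ.+-identityʳ (V 0)) (southSteps-zero lowerPath)))
    length-openings {suc k} k<n = lemma (closing? d (north (fromℕ< k<n)))
      (closing? d (south (fromℕ< k<n)))
      where
      open Step k<n
      vs = vertices (ℕ.<⇒≤ k<n)
      open Shift (length (filter (¬? ∘ closing? d) vs)) (U k) (V k) k (length-openings (ℕ.<⇒≤ k<n))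
      lemma : Dec (Closing d (north j)) → Dec (Closing d (south j)) →
          length (openings k<n) + U (suc k) ≡ V (suc k) + suc k
      lemma (yes cN) (yes cS)
        rewrite filter-reject (¬? ∘ closing? d) {x = north j} {xs = south j ∷ vs} (λ ¬c → ¬c cN)
          | filter-reject (¬? ∘ closing? d) {x = south j} {xs = vs} (λ ¬c → ¬c cS)
              | U↑ cN | V→ cS = +₂
      lemma (yes cN) (no ¬cS)
        rewrite filter-reject (¬? ∘ closing? d) {x = north j} {xs = south j ∷ vs} (λ ¬c → ¬c cN)
          | filter-accept (¬? ∘ closing? d) {x = south j} {xs = vs} ¬cS
              | U↑ cN | V↑ ¬cS = cong suc +₂
      lemma (no ¬cN) (yes cS)
        rewrite filter-accept (¬? ∘ closing? d) {x = north j} {xs = south j ∷ vs} ¬cN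
          | filter-reject (¬? ∘ closing? d) {x = south j} {xs = vs} (λ ¬c → ¬c cS)
              | U→ ¬cN | V→ cS = +₁
      lemma (no ¬cN) (no ¬cS)
        rewrite filter-accept (¬? ∘ closing? d) {x = north j} {xs = south j ∷ vs} ¬cN
          | filter-accept (¬? ∘ closing? d) {x = south j} {xs = vs} ¬cS
              | U→ ¬cN | V↑ ¬cS = cong suc +₁

    ∈-closings⁻ : ∀ {k} (k≤n : k ≤ n) {v} → v ∈ closings k≤n → Closing d v × toℕ (column v) < k
    ∈-closings⁻ k≤n v∈ = Product.swap
      (Product.map₁ (∈-vertices⁻ k≤n) (∈-filter⁻ (closing? d) {xs = vertices k≤n} v∈))

    ∈-openings⁺ : ∀ {k} (k≤n : k ≤ n) {v} → ¬ Closing d v → toℕ (column v) < k → v ∈ openings k≤n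
    ∈-openings⁺ k≤n ¬c v<k = ∈-filter⁺ (¬? ∘ closing? d) (∈-vertices⁺ k≤n _ v<k) ¬c

    partner-opening : ∀ {k} (k≤n : k ≤ n) {v} → Closing d v → toℕ (column (partner d v)) < k →
        partner d v ∈ openings k≤n
    partner-opening k≤n c = ∈-openings⁺ k≤n (closing⇒partner-¬closing d c)

    partners-openings : ∀ {k} (k≤n : k ≤ n) {w} → w ∈ map (partner d) (closings k≤n) →
        w ∈ openings k≤n
    partners-openings k≤n w∈ with v , v∈ , refl ← ∈-map⁻ (partner d) w∈ =
      let c , v<k = ∈-closings⁻ k≤n v∈
      in partner-opening k≤n c (ℕ.≤-<-trans (arrives⇒column≤ _ v c) v<k)

    partners-unique : ∀ {k} (k≤n : k ≤ n) → Unique (map (partner d) (closings k≤n))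
    partners-unique k≤n = Unique.map⁺ (partner-injective d)
      (Unique.filter⁺ (closing? d) (vertices-unique k≤n))

    -- An edge arriving in the first k columns also started there, so `partner d` injects the
    -- closings into the openings.
    closings≤openings : ∀ {k} (k≤n : k ≤ n) → length (closings k≤n) ≤ length (openings k≤n)
    closings≤openings k≤n = subst (_≤ length (openings k≤n)) (length-map (partner d) (closings k≤n))
      (unique-⊆⇒length≤ (partners-unique k≤n) (partners-openings k≤n))

    -- An edge from the first k columns arriving in the next one is an opening
    -- left unmatched by the first k columns.
    closings<openings : ∀ {k} (k≤n : k ≤ n) {v} → Closing d v → toℕ (column v) ≡ k →
                        toℕ (column (partner d v)) < k →
                          length (closings k≤n) < length (openings k≤n)
    closings<openings k≤n {v} c v≡k pv<k =
      subst (_≤ length (openings k≤n)) (cong suc (length-map (partner d) (closings k≤n)))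
      (unique-⊆⇒length≤ (All.tabulate new ∷ partners-unique k≤n)
        λ { (here refl) → partner-opening k≤n c pv<k ; (there w∈) → partners-openings k≤n w∈ })
      where
      new : ∀ {w} → w ∈ map (partner d) (closings k≤n) → partner d v ≢ w
      new w∈ eq with v′ , v′∈ , refl ← ∈-map⁻ (partner d) w∈ with refl ← partner-injective d eq =
        ℕ.<-irrefl v≡k (proj₂ (∈-closings⁻ k≤n v′∈))

    openings≤closings : length (openings ℕ.≤-refl) ≤ length (closings ℕ.≤-refl)
    openings≤closings = subst (_≤ length (closings ℕ.≤-refl))
      (length-map (partner d) (openings ℕ.≤-refl))
      (unique-⊆⇒length≤ (Unique.map⁺ (partner-injective d)
        (Unique.filter⁺ (¬? ∘ closing? d) (vertices-unique ℕ.≤-refl)))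
        λ w∈ → case ∈-map⁻ (partner d) w∈ of λ { (v , v∈ , refl) →
          ∈-filter⁺ (closing? d) (∈-vertices⁺ ℕ.≤-refl _ (Fin.toℕ<n _))
            (¬closing⇒partner-closing d (proj₂
              (∈-filter⁻ (¬? ∘ closing? d) {xs = vertices ℕ.≤-refl} v∈))) })

    -- The two equations give o - c = 2 (v - u), so comparing openings with closings compares the
    -- two paths.
    module Halve {c o u v k : ℕ} (c+v : c + v ≡ u + k) (o+u : o + u ≡ v + k) where

      halve< : c < o → u < v
      halve< c<o = ℕ.≰⇒> λ v≤u → ℕ.<⇒≱ c<o (ℕ.≤-trans
        (ℕ.+-cancelʳ-≤ u o k (subst₂ _≤_ (sym o+u) (ℕ.+-comm u k) (ℕ.+-monoˡ-≤ k v≤u)))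
        (ℕ.+-cancelʳ-≤ v k c (subst₂ _≤_ (ℕ.+-comm v k) (sym c+v) (ℕ.+-monoˡ-≤ k v≤u))))

      halve≤ : c ≤ o → u ≤ v
      halve≤ c≤o = ℕ.≮⇒≥ λ v<u → ℕ.<⇒≱ (ℕ.<-trans
        (ℕ.+-cancelʳ-< u o k (subst₂ _<_ (sym o+u) (ℕ.+-comm u k) (ℕ.+-monoˡ-< k v<u)))
        (ℕ.+-cancelʳ-< v k c (subst₂ _<_ (ℕ.+-comm v k) (sym c+v) (ℕ.+-monoˡ-< k v<u)))) c≤o

    open Halve

    U-end : ∀ {k} → n ≤ k → U k ≡ U n
    U-end n≤k = subst (λ m → U _ ≡ U m) (length-tabulate _)
      (southSteps-end {upperPath} (subst (_≤ _) (sym (length-tabulate _)) n≤k))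

    V-end : ∀ {k} → n ≤ k → V k ≡ V n
    V-end n≤k = subst (λ m → V _ ≡ V m) (length-tabulate _)
      (southSteps-end {lowerPath} (subst (_≤ _) (sym (length-tabulate _)) n≤k))

  upper≤lower : ∀ k → upperSouth k ≤ lowerSouth k
  upper≤lower k with ℕ.≤-total k n
  ... | inj₁ k≤n = halve≤ (length-closings k≤n) (length-openings k≤n) (closings≤openings k≤n)
  ... | inj₂ n≤k = subst₂ _≤_ (sym (U-end n≤k)) (sym (V-end n≤k))
    (halve≤ (length-closings ℕ.≤-refl) (length-openings ℕ.≤-refl) (closings≤openings ℕ.≤-refl))

  -- The edge arriving at `v` crosses the vertical line just before the column of `v`, so the height
  -- on the corresponding diagonal is not zero.
  upper<lower : ∀ v → Closing d v → toℕ (column (partner d v)) < toℕ (column v) →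
                upperSouth (toℕ (column v)) < lowerSouth (toℕ (column v))
  upper<lower v c pv<v = halve< (length-closings v≤n) (length-openings v≤n)
    (closings<openings v≤n c refl pv<v)
    where
    v≤n = ℕ.<⇒≤ (Fin.toℕ<n (column v))

  profile : Profile n upperSouth lowerSouth
  profile = record
    { U-step = southSteps-step upperPath
    ; V-step = southSteps-step lowerPath
    ; U≤V    = upper≤lower
    ; start  = trans (southSteps-zero upperPath) (sym (southSteps-zero lowerPath))
    ; end    = λ n≤k → trans (U-end n≤k) (trans
        (ℕ.≤-antisym (upper≤lower n)
          (halve≤ (length-openings ℕ.≤-refl) (length-closings ℕ.≤-refl) openings≤closings))
        (sym (V-end n≤k)))
    }

  traces : Traces d upperSouth lowerSouth
  traces .Traces.north-opens j = mk⇔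
    (λ ¬c → U-opening ¬c , Sum.[_,_]′
        (λ c → subst (U (toℕ j) <_) (sym (V-closing c)) (upper<lower (south j) c c))
        (λ ¬c′ → subst (U (toℕ j) <_) (sym (V-opening ¬c′)) (s≤s (upper≤lower (toℕ j))))
        (toSum (closing? d (south j))))
    (λ (eq , _) c → ℕ.1+n≢n (trans (sym (U-closing c)) eq))
  traces .Traces.south-closes j = mk⇔
    (λ c → V-closing c , upper<lower (south j) c c)
    (λ (eq , _) → decidable-stable (closing? d (south j)) λ ¬c →
        ℕ.1+n≢n (trans (sym (V-opening ¬c)) eq))
  -- Since no edge crosses the vertical lines before and after the column j, the edge at `north j`
  -- stays inside this column.
  traces .Traces.through j U≡V U≡V′ = vertical (partner d (north j)) refl
    where
    ¬c-south : ¬ Closing d (south j)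
    ¬c-south c = ℕ.<-irrefl U≡V (upper<lower (south j) c c)

    c-north : Closing d (north j)
    c-north = decidable-stable (closing? d (north j)) λ ¬c → ℕ.1+n≢n (begin
      suc (V (toℕ j))   ≡⟨ V-opening ¬c-south ⟨
      V (suc (toℕ j))   ≡⟨ U≡V′ ⟨
      U (suc (toℕ j))   ≡⟨ U-opening ¬c ⟩
      U (toℕ j)         ≡⟨ U≡V ⟩
      V (toℕ j)         ∎)
      where open ≡-Reasoning

    same-column : column (partner d (north j)) ≡ j
    same-column = Fin.toℕ-injective (ℕ.≤-antisym c-north
      (ℕ.≮⇒≥ λ p<j → ℕ.<-irrefl U≡V (upper<lower (north j) c-north p<j)))

    vertical : ∀ w → w ≡ partner d (north j) → partner d (north j) ≡ south j
    vertical (north k) eq = contradiction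
      (trans (sym eq) (cong north (trans (cong column eq) same-column)))
      (no-fixed d (north j))
    vertical (south k) eq = trans (sym eq) (cong south (trans (cong column eq) same-column))

-- The skew shape of a diagram

westSteps : List Bool → ℕ
westSteps []          = 0
westSteps (true ∷ l)  = westSteps l
westSteps (false ∷ l) = suc (westSteps l)

westSteps+southSteps : ∀ l → westSteps l + southSteps l (length l) ≡ length l
westSteps+southSteps []          = refl
westSteps+southSteps (true ∷ l)  = trans (ℕ.+-suc _ _) (cong suc (westSteps+southSteps l))
westSteps+southSteps (false ∷ l) = cong suc (westSteps+southSteps l)

-- Of the first k steps, those that do not go south are among the west steps of the whole path.
≤west+south : ∀ l {k} → k ≤ length l → k ≤ westSteps l + southSteps l k
≤west+south []          {zero}  _         = z≤n
≤west+south (_ ∷ _)     {zero}  _         = z≤n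
≤west+south (true ∷ l)  {suc k} (s≤s k≤l) =
  ℕ.≤-trans (s≤s (≤west+south l k≤l)) (ℕ.≤-reflexive (sym (ℕ.+-suc (westSteps l) _)))
≤west+south (false ∷ l) {suc k} (s≤s k≤l) = s≤s (≤west+south l k≤l)

-- The rows of the Young diagram bounded by the path and, to the northwest,
-- by the corner of the bounding box of the path.

rows : List Bool → List ℕ
rows []          = []
rows (true ∷ l) with westSteps l
-- A south step closes a row as long as the number of west steps still to come. Once none remain,
-- the later rows are empty, and parts must be positive.
... | zero  = []
... | suc w = suc w ∷ rows l
rows (false ∷ l) = rows l

rows-decreasing : ∀ l → Linked _≥_ (westSteps l ∷ rows l)
rows-decreasing [] = [-]
rows-decreasing (true ∷ l) with westSteps l | rows-decreasing l
... | zero  | _  = [-]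
... | suc w | ih = ℕ.≤-refl ∷ ih
rows-decreasing (false ∷ l) with rows l | rows-decreasing l
... | []    | _        = [-]
... | _ ∷ _ | ge ∷ rest = ℕ.m≤n⇒m≤1+n ge ∷ rest

rows-positive : ∀ l → All (0 <_) (rows l)
rows-positive [] = []
rows-positive (true ∷ l) with westSteps l
... | zero  = []
... | suc w = s≤s z≤n ∷ rows-positive l
rows-positive (false ∷ l) = rows-positive l

row≤westSteps : ∀ l r → row (rows l) r ≤ westSteps l
row≤westSteps [] r = z≤n
row≤westSteps (true ∷ l) r with westSteps l in eq
row≤westSteps (true ∷ l) r       | zero  = z≤n
row≤westSteps (true ∷ l) zero    | suc w = ℕ.≤-refl
row≤westSteps (true ∷ l) (suc r) | suc w = subst (row (rows l) r ≤_) eq (row≤westSteps l r)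
row≤westSteps (false ∷ l) r = ℕ.m≤n⇒m≤1+n (row≤westSteps l r)

row-S-zero : ∀ l → row (rows (true ∷ l)) 0 ≡ westSteps l
row-S-zero l with westSteps l
... | zero  = refl
... | suc _ = refl

row-S-suc : ∀ l r → row (rows (true ∷ l)) (suc r) ≡ row (rows l) r
row-S-suc l r with westSteps l in eq
... | zero  = sym (ℕ.n≤0⇒n≡0 (subst (row (rows l) r ≤_) eq (row≤westSteps l r)))
... | suc _ = refl

-- The path starts `westSteps l` columns east of the corner of the diagram, so the equation puts the
-- box (r , c) on the diagonal k. Such a box is northwest of the path exactly when the path meets
-- this diagonal in a lower row.
row⇔southSteps : ∀ l {r c k} → c + k ≡ westSteps l + r → (c < row (rows l) r) ⇔ (r < southSteps l k)
row⇔southSteps [] {k = k} _ = mk⇔ (λ ()) (λ ())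
row⇔southSteps (s ∷ l) {r} {c} {zero} eq = mk⇔
  (λ c<row → contradiction
    (ℕ.≤-trans c<row (ℕ.≤-trans (row≤westSteps (s ∷ l) r) (ℕ.≤-trans (ℕ.m≤m+n _ r)
      (ℕ.≤-reflexive (trans (sym eq) (ℕ.+-identityʳ c))))))
    (ℕ.<-irrefl refl))
  (λ ())
row⇔southSteps (true ∷ l) {zero} {c} {suc k} eq = mk⇔ (λ _ → s≤s z≤n)
  (λ _ → subst (c <_) (sym (row-S-zero l))
    (ℕ.≤-trans (s≤s (ℕ.m≤m+n c k))
      (ℕ.≤-reflexive (trans (sym (ℕ.+-suc c k)) (trans eq (ℕ.+-identityʳ _))))))
row⇔southSteps (true ∷ l) {suc r} {c} {suc k} eq = mk⇔
  (λ c<row → s≤s (to ih (subst (c <_) (row-S-suc l r) c<row)))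
  (λ r< → subst (c <_) (sym (row-S-suc l r)) (from ih (ℕ.s≤s⁻¹ r<)))
  where
  ih = row⇔southSteps l {r} {c} {k}
    (ℕ.suc-injective (trans (sym (ℕ.+-suc c k)) (trans eq (ℕ.+-suc (westSteps l) r))))
row⇔southSteps (false ∷ l) {r} {c} {suc k} eq =
  row⇔southSteps l {r} {c} {k} (ℕ.suc-injective (trans (sym (ℕ.+-suc c k)) eq))

youngDiagram : List Bool → Partition
youngDiagram l = record
  { parts      = rows l
  ; decreasing = Linked.tail (rows-decreasing l)
  ; positive   = rows-positive l
  }

module _ (d : Diagram n) where

  width : ℕ
  width = westSteps (lowerPath d)

  width-upper : westSteps (upperPath d) ≡ width
  width-upper = ℕ.+-cancelʳ-≡ (lowerSouth d n) _ _ (begin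
    westSteps (upperPath d) + lowerSouth d n            ≡⟨ cong (λ m → westSteps (upperPath d) + m)
      (end (profile d) ℕ.≤-refl) ⟨
    westSteps (upperPath d) + upperSouth d n            ≡⟨ total (upperPath d) (length-tabulate _) ⟩
    n                                                   ≡⟨ total (lowerPath d) (length-tabulate _) ⟨
    width + lowerSouth d n                              ∎)
    where
    open ≡-Reasoning
    total : ∀ l → length l ≡ n → westSteps l + southSteps l n ≡ n
    total l refl = westSteps+southSteps l

  private
    upper-row : ∀ {r c k} → c + k ≡ width + r →
        (c < row (rows (upperPath d)) r) ⇔ (r < upperSouth d k)
    upper-row {r} eq = row⇔southSteps (upperPath d)
      (trans eq (cong (λ m → m + r) (sym width-upper)))

  label≤width+upperSouth : ∀ {k} → k ≤ n → k ≤ width + upperSouth d k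
  label≤width+upperSouth {k} k≤n = subst (λ w → k ≤ w + upperSouth d k) width-upper
    (≤west+south (upperPath d) (ℕ.≤-trans k≤n (ℕ.≤-reflexive (sym (length-tabulate _)))))

  Θ : SkewShape
  Θ = record
    { λ′     = youngDiagram (lowerPath d)
    ; μ      = youngDiagram (upperPath d)
    -- Otherwise the first place beyond row r of λ would be a box of μ, hence above the upper path
    -- and so above the lower one.
    ; μ⊆λ    = λ r → ℕ.≮⇒≥ λ λ<μ →
      ℕ.<-irrefl refl (from (row⇔southSteps (lowerPath d) (complement r))
        (ℕ.<-≤-trans (to (upper-row (complement r)) λ<μ) (upper≤lower d _)))
    -- The walk starts at the northeastern corner of the bounding box, `width` columns east of the
    -- northwestern one.
    ; origin = 0ℤ , ℤ.- + width
    }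
    where
    complement : ∀ r → row (rows (lowerPath d)) r + (width + r ∸ row (rows (lowerPath d)) r) ≡ width
        + r
    complement r = ℕ.m+[n∸m]≡n (ℕ.≤-trans (row≤westSteps (lowerPath d) r) (ℕ.m≤m+n width r))

  cell⇔region : ∀ {r c k} → c + k ≡ width + r →
      Cell Θ (r , c) ⇔ Region (upperSouth d) (lowerSouth d) (k , r)
  cell⇔region eq = mk⇔
    (λ (μ≤c , c<λ) → ℕ.≮⇒≥ (λ r<U → ℕ.<⇒≱ (from (upper-row eq) r<U) μ≤c) , to
        (row⇔southSteps (lowerPath d) eq) c<λ)
    (λ (U≤r , r<V) → ℕ.≮⇒≥ (λ c<μ → ℕ.<⇒≱ (to (upper-row eq) c<μ) U≤r) , from
        (row⇔southSteps (lowerPath d) eq) r<V)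

point : ℤ → ℕ × ℕ → Point
point o (k , r) = o ℤ.+ + suc r , o ℤ.+ + suc r ℤ.- + k

-- A single integer `o` places the region, because a translation that keeps the labels is diagonal.
record Presents (T : SkewShape) (o : ℤ) (U V : ℕ → ℕ) : Set where
  constructor presentation
  field
    member : ∀ q → q ∈ˢ T ⇔ (∃[ b ] Region U V b × q ≡ point o b)

open Presents

corner≡point : ∀ {r c k b} → c + k ≡ b + r →
               (0ℤ ℤ.+ + suc r , ℤ.- + b ℤ.+ + suc c) ≡ point 0ℤ (k , r)
corner≡point {r} {c} {k} {b} eq = cong (0ℤ ℤ.+ + suc r ,_) (begin
  ℤ.- + b ℤ.+ + suc c                                    ≡⟨ add-subtract (+ b) (+ c) (+ k) ⟩
  ℤ.- + b ℤ.+ (+ c ℤ.+ + k) ℤ.+ 1ℤ ℤ.- + k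
    ≡⟨ cong (λ m → ℤ.- + b ℤ.+ m ℤ.+ 1ℤ ℤ.- + k) (cong +_ eq) ⟩
  ℤ.- + b ℤ.+ (+ b ℤ.+ + r) ℤ.+ 1ℤ ℤ.- + k               ≡⟨ cancel (+ b) (+ r) (+ k) ⟩
  0ℤ ℤ.+ + suc r ℤ.- + k                                 ∎)
  where
  open ≡-Reasoning
  add-subtract : ∀ b c k → ℤ.- b ℤ.+ (1ℤ ℤ.+ c) ≡ ℤ.- b ℤ.+ (c ℤ.+ k) ℤ.+ 1ℤ ℤ.- k
  add-subtract = ℤ-Solver.solve-∀
  cancel : ∀ b r k → ℤ.- b ℤ.+ (b ℤ.+ r) ℤ.+ 1ℤ ℤ.- k ≡ 0ℤ ℤ.+ (1ℤ ℤ.+ r) ℤ.- k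
  cancel = ℤ-Solver.solve-∀

Θ-presents : (d : Diagram n) → Presents (Θ d) 0ℤ (upperSouth d) (lowerSouth d)
Θ-presents d = presentation λ q → mk⇔ to′ from′
  where
  to′ : ∀ {q} → q ∈ˢ Θ d → ∃[ b ] Region (upperSouth d) (lowerSouth d) b × q ≡ point 0ℤ b
  to′ ((r , c) , cell , refl) = (width d + r ∸ c , r) , to (cell⇔region d eq) cell , corner≡point eq
    where
    eq : c + (width d + r ∸ c) ≡ width d + r
    eq = ℕ.m+[n∸m]≡n (ℕ.≤-trans (ℕ.<⇒≤ (proj₂ cell))
      (ℕ.≤-trans (row≤westSteps (lowerPath d) r) (ℕ.m≤m+n (width d) r)))

  from′ : ∀ {q} → ∃[ b ] Region (upperSouth d) (lowerSouth d) b × q ≡ point 0ℤ b → q ∈ˢ Θ d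
  from′ ((k , r) , region , refl) =
    (r , width d + r ∸ k) , from (cell⇔region d eq) region , sym (corner≡point eq)
    where
    eq : width d + r ∸ k + k ≡ width d + r
    eq = ℕ.m∸n+n≡m (ℕ.≤-trans (label≤width+upperSouth d (ℕ.<⇒≤ (region-label< (profile d) region)))
      (ℕ.+-monoʳ-≤ (width d) (proj₁ region)))

-- The boundary of the shape and the compass directions

forward backward : Bool → Direction
forward true   = S
forward false  = W
backward true  = N
backward false = E

originWalk : List Bool → List Segment
originWalk l = walk (0ℤ , 0ℤ) (map forward l)

endpoint : Point → List Direction → Point
endpoint p []       = p
endpoint p (θ ∷ θs) = endpoint (step θ p) θs

walk-++ : ∀ p θs φs → walk p (θs ++ φs) ≡ walk p θs ++ walk (endpoint p θs) φs
walk-++ p []       φs = refl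
walk-++ p (θ ∷ θs) φs = cong (traversed θ p ∷_) (walk-++ (step θ p) θs φs)

endpoint-++ : ∀ p θs φs → endpoint p (θs ++ φs) ≡ endpoint (endpoint p θs) φs
endpoint-++ p []       φs = refl
endpoint-++ p (θ ∷ θs) φs = endpoint-++ (step θ p) θs φs

module _ (p : Point) where

  step-back : ∀ b → step (backward b) (step (forward b) p) ≡ p
  step-back true  = cong (_, proj₂ p) (cancel (proj₁ p))
    where
    cancel : ∀ x → x ℤ.+ 1ℤ ℤ.- 1ℤ ≡ x
    cancel = ℤ-Solver.solve-∀
  step-back false = cong (proj₁ p ,_) (cancel (proj₂ p))
    where
    cancel : ∀ x → x ℤ.- 1ℤ ℤ.+ 1ℤ ≡ x
    cancel = ℤ-Solver.solve-∀

  traversed-back : ∀ b → traversed (backward b) (step (forward b) p) ≡ traversed (forward b) p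
  traversed-back true  = cong southward (step-back true)
  traversed-back false = refl

endpoint-back : ∀ p l → endpoint (endpoint p (map forward l)) (reverse (map backward l)) ≡ p
endpoint-back p []      = refl
endpoint-back p (b ∷ l) = begin
  endpoint q (reverse (backward b ∷ map backward l))
    ≡⟨ cong (endpoint q) (unfold-reverse (backward b) (map backward l)) ⟩
  endpoint q (reverse (map backward l) ∷ʳ backward b)
    ≡⟨ endpoint-++ q (reverse (map backward l)) [ backward b ] ⟩
  step (backward b) (endpoint q (reverse (map backward l)))
    ≡⟨ cong (step (backward b)) (endpoint-back (step (forward b) p) l) ⟩
  step (backward b) (step (forward b) p)                      ≡⟨ step-back p b ⟩
  p                                                           ∎
  where
  open ≡-Reasoning
  q = endpoint (step (forward b) p) (map forward l)

walk-back : ∀ p l → walk (endpoint p (map forward l)) (reverse (map backward l)) ≡ reverse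
    (walk p (map forward l))
walk-back p []      = refl
walk-back p (b ∷ l) = begin
  walk q (reverse (backward b ∷ map backward l))
    ≡⟨ cong (walk q) (unfold-reverse (backward b) (map backward l)) ⟩
  walk q (reverse (map backward l) ∷ʳ backward b)
    ≡⟨ walk-++ q (reverse (map backward l)) [ backward b ] ⟩
  walk q (reverse (map backward l)) ∷ʳ traversed (backward b)
    (endpoint q (reverse (map backward l)))
    ≡⟨ cong₂ _∷ʳ_ (walk-back (step (forward b) p) l)
         (trans (cong (traversed (backward b)) (endpoint-back (step (forward b) p) l))
           (traversed-back p b)) ⟩
  reverse (walk (step (forward b) p) (map forward l)) ∷ʳ traversed (forward b) p
    ≡⟨ unfold-reverse (traversed (forward b) p) (walk (step (forward b) p) (map forward l)) ⟨
  reverse (walk p (map forward (b ∷ l)))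
    ∎
  where
  open ≡-Reasoning
  q = endpoint (step (forward b) p) (map forward l)

-- After k steps, s of them south, the path is s units further south and k - s units further west.
pathPoint : Point → List Bool → ℕ → Point
pathPoint (x , y) l k = x ℤ.+ + southSteps l k , y ℤ.+ + southSteps l k ℤ.- + k

pathPoint-zero : ∀ p l → pathPoint p l 0 ≡ p
pathPoint-zero (x , y) l rewrite southSteps-zero l = cong₂ _,_ (ℤ.+-identityʳ x) (cancel y)
  where
  cancel : ∀ y → y ℤ.+ 0ℤ ℤ.- 0ℤ ≡ y
  cancel = ℤ-Solver.solve-∀

pathPoint-suc : ∀ p b l k → pathPoint p (b ∷ l) (suc k) ≡ pathPoint (step (forward b) p) l k
pathPoint-suc (x , y) true  l k =
  cong₂ _,_ (assoc x (+ southSteps l k)) (cancel y (+ southSteps l k) (+ k))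
  where
  assoc : ∀ x u → x ℤ.+ (1ℤ ℤ.+ u) ≡ x ℤ.+ 1ℤ ℤ.+ u
  assoc = ℤ-Solver.solve-∀
  cancel : ∀ y u k → y ℤ.+ (1ℤ ℤ.+ u) ℤ.- (1ℤ ℤ.+ k) ≡ y ℤ.+ u ℤ.- k
  cancel = ℤ-Solver.solve-∀
pathPoint-suc (x , y) false l k =
  cong (x ℤ.+ + southSteps l k ,_) (shift y (+ southSteps l k) (+ k))
  where
  shift : ∀ y u k → y ℤ.+ u ℤ.- (1ℤ ℤ.+ k) ≡ y ℤ.- 1ℤ ℤ.+ u ℤ.- k
  shift = ℤ-Solver.solve-∀

-- A segment is recorded by its northern or western endpoint: a south step departs from that point,
-- but a west step ends in it, hence `suc k`.
PassesAt : List Bool → ℕ → Segment → Point → Set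
PassesAt l k (southward q) p = southSteps l (suc k) ≡ suc (southSteps l k) × q ≡ pathPoint p l k
PassesAt l k (eastward q)  p = southSteps l (suc k) ≡ southSteps l k × q ≡ pathPoint p l (suc k)

passes-zero : ∀ b l p → PassesAt (b ∷ l) 0 (traversed (forward b) p) p
passes-zero true  l p = cong suc (southSteps-zero l) , sym (pathPoint-zero p (true ∷ l))
passes-zero false l p = southSteps-zero l , sym (trans (pathPoint-suc p false l 0)
  (pathPoint-zero _ l))

passes-zero⇒≡ : ∀ b l p s → PassesAt (b ∷ l) 0 s p → s ≡ traversed (forward b) p
passes-zero⇒≡ true  l p (southward q) (_ , eq) =
  cong southward (trans eq (pathPoint-zero p (true ∷ l)))
passes-zero⇒≡ true  l p (eastward q)  (() , _)
passes-zero⇒≡ false l p (southward q) (eq , _) =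
  contradiction (trans (sym eq) (southSteps-zero l)) λ ()
passes-zero⇒≡ false l p (eastward q)  (_ , eq) =
  cong eastward (trans eq (trans (pathPoint-suc p false l 0) (pathPoint-zero _ l)))

passes-suc : ∀ b l k p s → PassesAt l k s (step (forward b) p) ⇔ PassesAt (b ∷ l) (suc k) s p
passes-suc b l k p (southward q) = mk⇔
  (λ (eq , eq′) → up b eq , trans eq′ (sym (pathPoint-suc p b l k)))
  (λ (eq , eq′) → down b eq , trans eq′ (pathPoint-suc p b l k))
  where
  up : ∀ b → southSteps l (suc k) ≡ suc (southSteps l k) →
      southSteps (b ∷ l) (suc (suc k)) ≡ suc (southSteps (b ∷ l) (suc k))
  up true = cong suc
  up false eq = eq
  down : ∀ b → southSteps (b ∷ l) (suc (suc k)) ≡ suc (southSteps (b ∷ l) (suc k)) →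
      southSteps l (suc k) ≡ suc (southSteps l k)
  down true = ℕ.suc-injective
  down false eq = eq
passes-suc b l k p (eastward q) = mk⇔
  (λ (eq , eq′) → up b eq , trans eq′ (sym (pathPoint-suc p b l (suc k))))
  (λ (eq , eq′) → down b eq , trans eq′ (pathPoint-suc p b l (suc k)))
  where
  up : ∀ b → southSteps l (suc k) ≡ southSteps l k →
      southSteps (b ∷ l) (suc (suc k)) ≡ southSteps (b ∷ l) (suc k)
  up true = cong suc
  up false eq = eq
  down : ∀ b → southSteps (b ∷ l) (suc (suc k)) ≡ southSteps (b ∷ l) (suc k) →
      southSteps l (suc k) ≡ southSteps l k
  down true = ℕ.suc-injective
  down false eq = eq

∈-walk : ∀ p l s → s ∈ walk p (map forward l) ⇔ (∃[ k ] k < length l × PassesAt l k s p)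
∈-walk p l s = mk⇔ (to′ p l) (λ (k , k<l , pass) → from′ p l k k<l pass)
  where
  to′ : ∀ p l → s ∈ walk p (map forward l) → ∃[ k ] k < length l × PassesAt l k s p
  to′ p (b ∷ l) (here refl) = 0 , s≤s z≤n , passes-zero b l p
  to′ p (b ∷ l) (there s∈)  = let k , k<l , pass = to′ (step (forward b) p) l s∈
                              in suc k , s≤s k<l , to (passes-suc b l k p s) pass

  from′ : ∀ p l k → k < length l → PassesAt l k s p → s ∈ walk p (map forward l)
  from′ p (b ∷ l) zero    _         pass = here (passes-zero⇒≡ b l p s pass)
  from′ p (b ∷ l) (suc k) (s≤s k<l) pass =
    there (from′ _ l k k<l (from (passes-suc b l k p s) pass))

endpoint-pathPoint : ∀ p l → endpoint p (map forward l) ≡ pathPoint p l (length l)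
endpoint-pathPoint p []      = sym (pathPoint-zero p [])
endpoint-pathPoint p (b ∷ l) = trans (endpoint-pathPoint (step (forward b) p) l)
  (sym (pathPoint-suc p b l (length l)))

-- This is the diagonal x - y from which a forward step along the segment departs. It grows by one
-- with every step, so a path never repeats a segment.
segmentContent : Segment → ℤ
segmentContent (southward q) = ω q
segmentContent (eastward q)  = ω q ℤ.- 1ℤ

segmentContent-traversed : ∀ b p → segmentContent (traversed (forward b) p) ≡ ω p
segmentContent-traversed true  p = refl
segmentContent-traversed false (x , y) = cancel x y
  where
  cancel : ∀ x y → x ℤ.- (y ℤ.- 1ℤ) ℤ.- 1ℤ ≡ x ℤ.- y
  cancel = ℤ-Solver.solve-∀

ω-step : ∀ b p → ω (step (forward b) p) ≡ 1ℤ ℤ.+ ω p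
ω-step true (x , y) = shift x y
  where
  shift : ∀ x y → x ℤ.+ 1ℤ ℤ.- y ≡ 1ℤ ℤ.+ (x ℤ.- y)
  shift = ℤ-Solver.solve-∀
ω-step false (x , y) = shift x y
  where
  shift : ∀ x y → x ℤ.- (y ℤ.- 1ℤ) ≡ 1ℤ ℤ.+ (x ℤ.- y)
  shift = ℤ-Solver.solve-∀

walk-content : ∀ p l → All (λ s → ω p ℤ.≤ segmentContent s) (walk p (map forward l))
walk-content p []      = []
walk-content p (b ∷ l) = ℤ.≤-reflexive (sym (segmentContent-traversed b p)) ∷
  All.map (ℤ.≤-trans (ℤ.≤-trans (ℤ.i≤suc[i] (ω p)) (ℤ.≤-reflexive (sym (ω-step b p)))))
    (walk-content (step (forward b) p) l)

walk-unique : ∀ p l → Unique (walk p (map forward l))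
walk-unique p []      = []
walk-unique p (b ∷ l) = All.map new (walk-content (step (forward b) p) l) ∷ walk-unique
  (step (forward b) p) l
  where
  new : ∀ {s} → ω (step (forward b) p) ℤ.≤ segmentContent s → traversed (forward b) p ≢ s
  new le refl = ℤ.<-irrefl refl (ℤ.suc[i]≤j⇒i<j
    (subst₂ ℤ._≤_ (ω-step b p) (segmentContent-traversed b p) le))

count : Segment → List Segment → ℕ
count s xs = length (filter (s ≟ˢ_) xs)

count-∉ : ∀ {s xs} → s ∉ xs → count s xs ≡ 0
count-∉ {s} s∉ = cong length (filter-none (s ≟ˢ_) (All.tabulate λ { x∈ refl → s∉ x∈ }))

count-∈ : ∀ {s xs} → Unique xs → s ∈ xs → count s xs ≡ 1
count-∈ {s} (x∉ ∷ _) (here {xs = xs} refl) =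
  trans (cong length (filter-accept (s ≟ˢ_) {xs = xs} refl))
  (cong suc (count-∉ λ s∈ → All.lookup x∉ s∈ refl))
count-∈ {s} (x∉ ∷ unique) (there {xs = xs} s∈) =
  trans (cong length (filter-reject (s ≟ˢ_) {xs = xs} λ { refl → All.lookup x∉ s∈ refl }))
    (count-∈ unique s∈)

count-0or1 : ∀ {s xs} → Unique xs → Dec (s ∈ xs) →
    (s ∈ xs × count s xs ≡ 1) ⊎ (s ∉ xs × count s xs ≡ 0)
count-0or1 unique (yes s∈) = inj₁ (s∈ , count-∈ unique s∈)
count-0or1 unique (no s∉)  = inj₂ (s∉ , count-∉ s∉)

infix 3 _Xor_

_Xor_ : Set → Set → Set
A Xor B = (A × ¬ B) ⊎ (¬ A × B)

xor-cong : ∀ {A A′ B B′} → A ⇔ A′ → B ⇔ B′ → (A Xor B) ⇔ (A′ Xor B′)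
xor-cong A⇔ B⇔ = mk⇔
  (Sum.map (Product.map (to A⇔) (_∘ from B⇔)) (Product.map (_∘ from A⇔) (to B⇔)))
  (Sum.map (Product.map (from A⇔) (_∘ to B⇔)) (Product.map (_∘ to A⇔) (from B⇔)))

count-xor : ∀ {s xs ys} → Unique xs → Unique ys →
    (count s xs + count s ys ≡ 1) ⇔ (s ∈ xs Xor s ∈ ys)
count-xor {s} {xs} {ys} unique unique′ with count-0or1 unique (s ∈? xs) | count-0or1 unique′
  (s ∈? ys)
... | inj₁ (∈₁ , eq) | inj₁ (∈₂ , eq′) rewrite eq | eq′ = mk⇔ (λ ())
  Sum.[ (λ (_ , ∉₂) → contradiction ∈₂ ∉₂) , (λ (∉₁ , _) → contradiction ∈₁ ∉₁) ]
... | inj₁ (∈₁ , eq) | inj₂ (∉₂ , eq′) rewrite eq | eq′ = mk⇔ (λ _ → inj₁ (∈₁ , ∉₂)) (λ _ → refl)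
... | inj₂ (∉₁ , eq) | inj₁ (∈₂ , eq′) rewrite eq | eq′ = mk⇔ (λ _ → inj₂ (∉₁ , ∈₂)) (λ _ → refl)
... | inj₂ (∉₁ , eq) | inj₂ (∉₂ , eq′) rewrite eq | eq′ = mk⇔ (λ ())
  Sum.[ (λ (∈₁ , _) → contradiction ∈₁ ∉₁) , (λ (_ , ∈₂) → contradiction ∈₂ ∉₂) ]

-- As ¬ A implies B, the parity of A × B is that of 1 + A + B; likewise for A′ and B′.

xor-corner : ∀ {A A′ B B′} → Dec A → Dec A′ → Dec B → Dec B′ →
             (A′ → A) → (B → B′) → (¬ A → B) → (¬ A′ → B′) →
             ((A × ¬ A′) Xor (B′ × ¬ B)) ⇔ ((A′ × B′) Xor (A × B))
xor-corner (yes a) (yes a′) (yes b) _ _ B→B′ _ _ = mk⇔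
  Sum.[ (λ ((_ , ¬a′) , _) → contradiction a′ ¬a′) , (λ (_ , _ , ¬b) → contradiction b ¬b) ]
  Sum.[ (λ (_ , ¬ab) → contradiction (a , b) ¬ab) ,
    (λ (¬ab′ , _) → contradiction (a′ , B→B′ b) ¬ab′) ]
xor-corner (yes a) (yes a′) (no ¬b) (yes b′) _ _ _ _ = mk⇔
  (λ _ → inj₁ ((a′ , b′) , ¬b ∘ proj₂)) (λ _ → inj₂ ((λ (_ , ¬a′) → ¬a′ a′) , b′ , ¬b))
xor-corner (yes a) (yes a′) (no ¬b) (no ¬b′) _ _ _ _ = mk⇔
  Sum.[ (λ ((_ , ¬a′) , _) → contradiction a′ ¬a′) , (λ (_ , b′ , _) → contradiction b′ ¬b′) ]
  Sum.[ (λ ((_ , b′) , _) → contradiction b′ ¬b′) , (λ (_ , _ , b) → contradiction b ¬b) ]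
xor-corner (yes a) (no ¬a′) (yes b) _ _ _ _ _ = mk⇔
  (λ _ → inj₂ (¬a′ ∘ proj₁ , a , b)) (λ _ → inj₁ ((a , ¬a′) , λ (_ , ¬b) → ¬b b))
xor-corner (yes a) (no ¬a′) (no ¬b) _ _ _ _ ¬A′→B′ = mk⇔
  Sum.[ (λ (_ , ¬bb) → contradiction (¬A′→B′ ¬a′ , ¬b) ¬bb) ,
    (λ (¬aa , _) → contradiction (a , ¬a′) ¬aa) ]
  Sum.[ (λ ((a′ , _) , _) → contradiction a′ ¬a′) , (λ (_ , _ , b) → contradiction b ¬b) ]
xor-corner (no ¬a) (yes a′) _ _ A′→A _ _ _ = contradiction (A′→A a′) ¬a
xor-corner (no ¬a) (no ¬a′) _ _ _ _ ¬A→B _ = mk⇔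
  Sum.[ (λ ((a , _) , _) → contradiction a ¬a) , (λ (_ , _ , ¬b) → contradiction (¬A→B ¬a) ¬b) ]
  Sum.[ (λ ((a′ , _) , _) → contradiction a′ ¬a′) , (λ (_ , a , _) → contradiction a ¬a) ]

module _ (d : Diagram n) where

  upperWalk lowerWalk : List Segment
  upperWalk = originWalk (upperPath d)
  lowerWalk = originWalk (lowerPath d)

  private
    ξ-north : ∀ k → ξ d (north k) ≡ forward (does (closing? d (north k)))
    ξ-north k = lemma (closing? d (north k))
      where
      choose : Bool → Direction
      choose b = if b then W else S
      lemma : Dec (Closing d (north k)) → ξ d (north k) ≡ forward (does (closing? d (north k)))
      lemma (yes c) = trans (cong choose (dec-false (k Fin.<? _) (ℕ.≤⇒≯ c)))
        (cong forward (sym (dec-true (closing? d (north k)) c)))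
      lemma (no ¬c) = trans (cong choose (dec-true (k Fin.<? _) (ℕ.≰⇒> ¬c)))
        (cong forward (sym (dec-false (closing? d (north k)) ¬c)))

    ξ-south : ∀ k → ξ d (south k) ≡ backward (not (does (closing? d (south k))))
    ξ-south k = lemma (closing? d (south k))
      where
      choose : Bool → Direction
      choose b = if b then N else E
      lemma : Dec (Closing d (south k)) →
          ξ d (south k) ≡ backward (not (does (closing? d (south k))))
      lemma (yes c) = trans (cong choose (dec-false (k Fin.≤? _) (ℕ.<⇒≱ c)))
        (cong (backward ∘ not) (sym (dec-true (closing? d (south k)) c)))
      lemma (no ¬c) = trans (cong choose (dec-true (k Fin.≤? _) (ℕ.≮⇒≥ ¬c)))
        (cong (backward ∘ not) (sym (dec-false (closing? d (south k)) ¬c)))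

    ξ-norths : map (ξ d ∘ north) (allFin n) ≡ map forward (upperPath d)
    ξ-norths = trans (map-cong ξ-north (allFin n))
      (trans (map-tabulate _ _) (sym (map-tabulate _ forward)))

    ξ-souths : map (ξ d ∘ south) (reverse (allFin n)) ≡ reverse (map backward (lowerPath d))
    ξ-souths = trans (reverse-map (ξ d ∘ south) (allFin n)) (cong reverse
      (trans (map-cong ξ-south (allFin n))
        (trans (map-tabulate _ _) (sym (map-tabulate _ backward)))))

    length-upper : length (upperPath d) ≡ n
    length-upper = length-tabulate _

    length-lower : length (lowerPath d) ≡ n
    length-lower = length-tabulate _

    same-endpoint : endpoint (0ℤ , 0ℤ) (map forward (upperPath d)) ≡ endpoint (0ℤ , 0ℤ)
        (map forward (lowerPath d))
    same-endpoint = begin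
      endpoint (0ℤ , 0ℤ) (map forward (upperPath d))
        ≡⟨ endpoint-pathPoint _ (upperPath d) ⟩
      pathPoint (0ℤ , 0ℤ) (upperPath d) (length (upperPath d))
        ≡⟨ cong (pathPoint (0ℤ , 0ℤ) (upperPath d)) length-upper ⟩
      pathPoint (0ℤ , 0ℤ) (upperPath d) n
        ≡⟨ cong (λ m → 0ℤ ℤ.+ + m , 0ℤ ℤ.+ + m ℤ.- + n) (end (profile d) ℕ.≤-refl) ⟩
      pathPoint (0ℤ , 0ℤ) (lowerPath d) n
        ≡⟨ cong (pathPoint (0ℤ , 0ℤ) (lowerPath d)) length-lower ⟨
      pathPoint (0ℤ , 0ℤ) (lowerPath d) (length (lowerPath d))
        ≡⟨ endpoint-pathPoint _ (lowerPath d) ⟨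
      endpoint (0ℤ , 0ℤ) (map forward (lowerPath d))             ∎
      where open ≡-Reasoning

  walk-ξ-sequence : walk (0ℤ , 0ℤ) (ξ-sequence d) ≡ upperWalk ++ reverse lowerWalk
  walk-ξ-sequence = begin
    walk (0ℤ , 0ℤ) (ξ-sequence d)
      ≡⟨ cong (walk _) (cong₂ _++_ ξ-norths ξ-souths) ⟩
    walk (0ℤ , 0ℤ) (map forward (upperPath d) ++ reverse (map backward (lowerPath d)))
      ≡⟨ walk-++ _ (map forward (upperPath d)) _ ⟩
    upperWalk ++ walk (endpoint (0ℤ , 0ℤ) (map forward (upperPath d)))
      (reverse (map backward (lowerPath d)))
      ≡⟨ cong (λ p → upperWalk ++ walk p (reverse (map backward (lowerPath d)))) same-endpoint ⟩
    upperWalk ++ walk (endpoint (0ℤ , 0ℤ) (map forward (lowerPath d)))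
      (reverse (map backward (lowerPath d)))
      ≡⟨ cong (upperWalk ++_) (walk-back _ (lowerPath d)) ⟩
    upperWalk ++ reverse lowerWalk
      ∎
    where open ≡-Reasoning

  count-walk : ∀ s → count s (walk (0ℤ , 0ℤ) (ξ-sequence d)) ≡ count s upperWalk + count s lowerWalk
  count-walk s = begin
    count s (walk (0ℤ , 0ℤ) (ξ-sequence d))           ≡⟨ cong (count s) walk-ξ-sequence ⟩
    count s (upperWalk ++ reverse lowerWalk)
      ≡⟨ cong length (filter-++ (s ≟ˢ_) upperWalk _) ⟩
    length (filter (s ≟ˢ_) upperWalk ++ filter (s ≟ˢ_) (reverse lowerWalk))
      ≡⟨ length-++ (filter (s ≟ˢ_) upperWalk) ⟩
    count s upperWalk + count s (reverse lowerWalk)   ≡⟨ cong (λ m → count s upperWalk + m)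
      (↭-length (filter-↭ (s ≟ˢ_) (↭-reverse lowerWalk))) ⟩
    count s upperWalk + count s lowerWalk             ∎
    where open ≡-Reasoning

  -- Each half of the closed walk passes a segment at most once, so a segment is traversed exactly
  -- once when precisely one half contains it.
  remains⇔xor : ∀ s → Remains d s ⇔ (s ∈ upperWalk Xor s ∈ lowerWalk)
  remains⇔xor s = subst (λ m → (m ≡ 1) ⇔ (s ∈ upperWalk Xor s ∈ lowerWalk)) (sym (count-walk s))
    (count-xor (walk-unique _ (upperPath d)) (walk-unique _ (lowerPath d)))

-- Unit segments and the boxes beside them

ω-diagonal : ∀ x k → x ℤ.- (x ℤ.- k) ≡ k
ω-diagonal = ℤ-Solver.solve-∀

-- These are the segments between the diagonals j and j + 1 whose recorded endpoint lies in row r.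
southAt eastAt : ℕ → ℕ → Segment
southAt r j = southward (+ r , + r ℤ.- + j)
eastAt  r j = eastward (+ r , + r ℤ.- + suc j)

diagonal-injective : ∀ r j r′ j′ → _≡_ {A = Point} (+ r , + r ℤ.- + j) (+ r′ , + r′ ℤ.- + j′) →
    r ≡ r′ × j ≡ j′
diagonal-injective r j r′ j′ eq =
  ℤ.+-injective (cong proj₁ eq) ,
  ℤ.+-injective (trans (sym (ω-diagonal (+ r) (+ j)))
    (trans (cong ω eq) (ω-diagonal (+ r′) (+ j′))))

-- Beside the vertical segment lie the boxes labelled k + 1 and k in row x; beside the horizontal
-- one, the box labelled k in row x - 1 and the box labelled k + 1 in row x.
module Sides (x k : ℤ) where

  private
    next : x ℤ.+ 1ℤ ≡ 0ℤ ℤ.+ (1ℤ ℤ.+ x)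
    next = lemma x
      where
      lemma : ∀ x → x ℤ.+ 1ℤ ≡ 0ℤ ℤ.+ (1ℤ ℤ.+ x)
      lemma = ℤ-Solver.solve-∀

  west-side : _≡_ {A = Point} (x ℤ.+ 1ℤ , x ℤ.- k)
      (0ℤ ℤ.+ (1ℤ ℤ.+ x) , 0ℤ ℤ.+ (1ℤ ℤ.+ x) ℤ.- (1ℤ ℤ.+ k))
  west-side = cong₂ _,_ next (lemma x k)
    where
    lemma : ∀ x k → x ℤ.- k ≡ 0ℤ ℤ.+ (1ℤ ℤ.+ x) ℤ.- (1ℤ ℤ.+ k)
    lemma = ℤ-Solver.solve-∀

  east-side : _≡_ {A = Point} (x ℤ.+ 1ℤ , x ℤ.- k ℤ.+ 1ℤ)
      (0ℤ ℤ.+ (1ℤ ℤ.+ x) , 0ℤ ℤ.+ (1ℤ ℤ.+ x) ℤ.- k)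
  east-side = cong₂ _,_ next (lemma x k)
    where
    lemma : ∀ x k → x ℤ.- k ℤ.+ 1ℤ ≡ 0ℤ ℤ.+ (1ℤ ℤ.+ x) ℤ.- k
    lemma = ℤ-Solver.solve-∀

  north-side : _≡_ {A = Point} (x , x ℤ.- (1ℤ ℤ.+ k) ℤ.+ 1ℤ) (0ℤ ℤ.+ x , 0ℤ ℤ.+ x ℤ.- k)
  north-side = cong₂ _,_ (sym (ℤ.+-identityˡ x)) (lemma x k)
    where
    lemma : ∀ x k → x ℤ.- (1ℤ ℤ.+ k) ℤ.+ 1ℤ ≡ 0ℤ ℤ.+ x ℤ.- k
    lemma = ℤ-Solver.solve-∀

  south-side : _≡_ {A = Point} (x ℤ.+ 1ℤ , x ℤ.- (1ℤ ℤ.+ k) ℤ.+ 1ℤ)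
      (0ℤ ℤ.+ (1ℤ ℤ.+ x) , 0ℤ ℤ.+ (1ℤ ℤ.+ x) ℤ.- (1ℤ ℤ.+ k))
  south-side = cong₂ _,_ next (lemma x k)
    where
    lemma : ∀ x k → x ℤ.- (1ℤ ℤ.+ k) ℤ.+ 1ℤ ≡ 0ℤ ℤ.+ (1ℤ ℤ.+ x) ℤ.- (1ℤ ℤ.+ k)
    lemma = ℤ-Solver.solve-∀

+1-cancel : ∀ {x z} → x ℤ.+ 1ℤ ≡ z ℤ.+ 1ℤ → x ≡ z
+1-cancel {x} {z} eq = trans (sym (lemma x)) (trans (cong (ℤ._- 1ℤ) eq) (lemma z))
  where
  lemma : ∀ x → x ℤ.+ 1ℤ ℤ.- 1ℤ ≡ x
  lemma = ℤ-Solver.solve-∀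

-- A step changes the row by at most one, so the two inequalities pin down r. In this form they
-- involve the same comparisons as membership of the two adjacent boxes in the region, as
-- `xor-corner` requires.
southAt∈walk : ∀ l {r j} → j < length l →
               southAt r j ∈ originWalk l ⇔ (southSteps l j ≤ r × r < southSteps l (suc j))
southAt∈walk l {r} {j} j<l = mk⇔ to′ from′
  where
  to′ : southAt r j ∈ originWalk l → southSteps l j ≤ r × r < southSteps l (suc j)
  to′ s∈ with k , _ , eq , q≡ ← to (∈-walk _ l _) s∈ with refl , refl ← diagonal-injective r j
    (southSteps l k) k q≡ =
    ℕ.≤-refl , ℕ.≤-reflexive (sym eq)
  from′ : southSteps l j ≤ r × r < southSteps l (suc j) → southAt r j ∈ originWalk l
  from′ (≤r , r<) with southSteps-step l j
  ... | inj₁ eq = contradiction ≤r (ℕ.<⇒≱ (subst (r <_) eq r<))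
  ... | inj₂ eq with refl ← ℕ.≤-antisym ≤r (ℕ.s≤s⁻¹ (subst (r <_) eq r<)) =
        from (∈-walk _ l _) (j , j<l , eq , refl)

eastAt∈walk : ∀ l {r j} → j < length l →
              eastAt r j ∈ originWalk l ⇔ (southSteps l (suc j) ≤ r × r ≤ southSteps l j)
eastAt∈walk l {r} {j} j<l = mk⇔ to′ from′
  where
  to′ : eastAt r j ∈ originWalk l → southSteps l (suc j) ≤ r × r ≤ southSteps l j
  to′ s∈ with k , _ , eq , q≡ ← to (∈-walk _ l _) s∈ with refl , refl ← diagonal-injective r (suc j)
    (southSteps l (suc k)) (suc k) q≡ =
    ℕ.≤-refl , ℕ.≤-reflexive eq
  from′ : southSteps l (suc j) ≤ r × r ≤ southSteps l j → eastAt r j ∈ originWalk l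
  from′ (≤r , r≤) with southSteps-step l j
  ... | inj₂ eq = contradiction (ℕ.≤-trans ≤r r≤) (ℕ.<⇒≱ (ℕ.≤-reflexive (sym eq)))
  ... | inj₁ eq with refl ← ℕ.≤-antisym ≤r (subst (r ≤_) (sym eq) r≤) =
        from (∈-walk _ l _) (j , j<l , eq , refl)

Located : ℕ → Segment → Set
Located n s = ∃[ r ] ∃[ j ] j < n × (s ≡ southAt r j ⊎ s ≡ eastAt r j)

walk-located : ∀ l {s} → s ∈ originWalk l → Located (length l) s
walk-located l {southward q} s∈ with k , k<l , _ , refl ← to (∈-walk _ l _) s∈ =
  southSteps l k , k , k<l , inj₁ refl
walk-located l {eastward q}  s∈ with k , k<l , _ , refl ← to (∈-walk _ l _) s∈ =
  southSteps l (suc k) , k , k<l , inj₂ refl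

module _ (d : Diagram n) where

  private
    U = upperSouth d
    V = lowerSouth d
    T = Θ d
    p = profile d

    box⇔region : ∀ {k r q} → q ≡ point 0ℤ (k , r) → q ∈ˢ T ⇔ Region U V (k , r)
    box⇔region {k} {r} refl = mk⇔ to′
      (λ region → from (member (Θ-presents d) _) (_ , region , refl))
      where
      to′ : point 0ℤ (k , r) ∈ˢ T → Region U V (k , r)
      to′ q∈ with (k′ , r′) , region , eq ← to (member (Θ-presents d) _) q∈ with refl , refl ←
        diagonal-injective (suc r) k (suc r′) k′ eq = region

    length-upper : n ≡ length (upperPath d)
    length-upper = sym (length-tabulate _)

    length-lower : n ≡ length (lowerPath d)
    length-lower = sym (length-tabulate _)

    south-boundary : ∀ {r j} → j < n →
        (southAt r j ∈ upperWalk d Xor southAt r j ∈ lowerWalk d) ⇔ OnBoundary T (southAt r j)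
    south-boundary {r} {j} j<n = ⇔-trans (xor-cong
        (⇔-trans (southAt∈walk (upperPath d) (subst (j <_) length-upper j<n))
          (mk⇔ (λ (U≤r , r<U) → U≤r , ℕ.<⇒≱ r<U) (λ (U≤r , U≰r) → U≤r , ℕ.≰⇒> U≰r)))
        (⇔-trans (southAt∈walk (lowerPath d) (subst (j <_) length-lower j<n))
          (mk⇔ (λ (V≤r , r<V) → r<V , ℕ.≤⇒≯ V≤r) (λ (r<V , r≮V) → ℕ.≮⇒≥ r≮V , r<V))))
      (⇔-trans (xor-corner (U j ℕ.≤? r) (U (suc j) ℕ.≤? r) (r ℕ.<? V j) (r ℕ.<? V (suc j))
          (ℕ.≤-trans (U-grows p j)) (λ r<V → ℕ.<-≤-trans r<V (V-grows p j))
          (λ U≰r → ℕ.<-≤-trans (ℕ.≰⇒> U≰r) (U≤V p j))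
              (λ U≰r → ℕ.<-≤-trans (ℕ.≰⇒> U≰r) (U≤V p (suc j))))
        (xor-cong (⇔-sym (box⇔region {suc j} {r} (Sides.west-side (+ r) (+ j))))
          (⇔-sym (box⇔region {j} {r} (Sides.east-side (+ r) (+ j))))))

    east-boundary : ∀ {r j} → j < n →
        (eastAt r j ∈ upperWalk d Xor eastAt r j ∈ lowerWalk d) ⇔ OnBoundary T (eastAt r j)
    east-boundary {r} {j} j<n = ⇔-trans (xor-cong
        (⇔-trans (eastAt∈walk (upperPath d) (subst (j <_) length-upper j<n))
          (mk⇔ (Product.map₂ ℕ.≤⇒≯) (Product.map₂ ℕ.≮⇒≥)))
        (⇔-trans (eastAt∈walk (lowerPath d) (subst (j <_) length-lower j<n))
          (mk⇔ (λ (V≤r , r≤V) → r≤V , ℕ.≤⇒≯ V≤r) (λ (r≤V , r≮V) → ℕ.≮⇒≥ r≮V , r≤V))))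
      (⇔-trans (xor-corner (U (suc j) ℕ.≤? r) (U j ℕ.<? r) (r ℕ.<? V (suc j)) (r ℕ.≤? V j)
          (ℕ.≤-trans (U-grows≤1 p j)) (λ r<V → ℕ.s≤s⁻¹ (ℕ.≤-trans r<V (V-grows≤1 p j)))
          (λ U≰r → ℕ.<-≤-trans (ℕ.≰⇒> U≰r) (U≤V p (suc j)))
              (λ U≮r → ℕ.≤-trans (ℕ.≮⇒≥ U≮r) (U≤V p j)))
        (xor-cong (⇔-sym (above r)) (⇔-sym
          (box⇔region {suc j} {r} (Sides.south-side (+ r) (+ j))))))
      where
      above : ∀ r → proj₁ (sides (eastAt r j)) ∈ˢ T ⇔ (U j < r × r ≤ V j)
      -- Rows are counted from 0, so no box lies above this segment, and U j < 0 fails as well.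
      above zero    = mk⇔ (λ q∈ → contradiction
        (cong proj₁ (proj₂ (proj₂ (to (member (Θ-presents d) _) q∈)))) λ ()) (λ ())
      above (suc r) = ⇔-trans (box⇔region {j} {r} (Sides.north-side (+ suc r) (+ j)))
        (mk⇔ (Product.map₁ s≤s) (Product.map₁ ℕ.s≤s⁻¹))

    -- A boundary segment is a side of some box, and the row and the label of that box tell which
    -- segment it is; the label also bounds j by n.
    boundary-located : ∀ {s} → OnBoundary T s → Located n s
    boundary-located {southward (x , y)} (inj₁ (q∈ , _)) with to (member (Θ-presents d) _) q∈
    ... | (zero  , r) , region , eq = contradiction (region-label>0 p region) λ ()
    ... | (suc j , r) , region , eq = r , j , ℕ.<-trans (ℕ.n<1+n j) (region-label< p region) , inj₁
          (cong southward
      (cong₂ _,_ (+1-cancel (trans (cong proj₁ eq) (sym (cong proj₁ side))))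
        (trans (cong proj₂ eq) (sym (cong proj₂ side)))))
      where side = Sides.west-side (+ r) (+ j)
    boundary-located {southward (x , y)} (inj₂ (_ , q∈)) with to (member (Θ-presents d) _) q∈
    ... | (j , r) , region , eq = r , j , region-label< p region , inj₁ (cong southward
      (cong₂ _,_ (+1-cancel (trans (cong proj₁ eq) (sym (cong proj₁ side))))
        (+1-cancel (trans (cong proj₂ eq) (sym (cong proj₂ side))))))
      where side = Sides.east-side (+ r) (+ j)
    boundary-located {eastward (x , y)} (inj₁ (q∈ , _)) with to (member (Θ-presents d) _) q∈
    ... | (j , r) , region , eq = suc r , j , region-label< p region , inj₂ (cong eastward
      (cong₂ _,_ (trans (cong proj₁ eq) (sym (cong proj₁ side)))
        (+1-cancel (trans (cong proj₂ eq) (sym (cong proj₂ side))))))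
      where side = Sides.north-side (+ suc r) (+ j)
    boundary-located {eastward (x , y)} (inj₂ (_ , q∈)) with to (member (Θ-presents d) _) q∈
    ... | (zero  , r) , region , eq = contradiction (region-label>0 p region) λ ()
    ... | (suc j , r) , region , eq = r , j , ℕ.<-trans (ℕ.n<1+n j) (region-label< p region) , inj₂
          (cong eastward
      (cong₂ _,_ (+1-cancel (trans (cong proj₁ eq) (sym (cong proj₁ side))))
        (+1-cancel (trans (cong proj₂ eq) (sym (cong proj₂ side))))))
      where side = Sides.south-side (+ r) (+ j)

  Θ-isΘ : IsΘ d (Θ d)
  Θ-isΘ s = mk⇔
    (λ remains → to (at (remains-located (to (remains⇔xor d s) remains)))
        (to (remains⇔xor d s) remains))
    (λ boundary → from (remains⇔xor d s) (from (at (boundary-located {s} boundary)) boundary))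
    where
    remains-located : s ∈ upperWalk d Xor s ∈ lowerWalk d → Located n s
    remains-located (inj₁ (s∈ , _)) = subst (λ m → Located m s) (sym length-upper)
      (walk-located (upperPath d) s∈)
    remains-located (inj₂ (_ , s∈)) = subst (λ m → Located m s) (sym length-lower)
      (walk-located (lowerPath d) s∈)

    at : Located n s → (s ∈ upperWalk d Xor s ∈ lowerWalk d) ⇔ OnBoundary T s
    at (r , j , j<n , inj₁ refl) = south-boundary j<n
    at (r , j , j<n , inj₂ refl) = east-boundary j<n

-- Skew shapes as regions between paths

ω-point : ∀ o b → ω (point o b) ≡ + proj₁ b
ω-point o (k , r) = ω-diagonal (o ℤ.+ + suc r) (+ k)

+-cancelˡ-≤ : ∀ i {j k} → i ℤ.+ j ℤ.≤ i ℤ.+ k → j ℤ.≤ k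
+-cancelˡ-≤ i {j} {k} le = subst₂ ℤ._≤_ (lemma i j) (lemma i k) (ℤ.+-monoʳ-≤ (ℤ.- i) le)
  where
  lemma : ∀ i j → ℤ.- i ℤ.+ (i ℤ.+ j) ≡ j
  lemma = ℤ-Solver.solve-∀

point-injective : ∀ o b b′ → point o b ≡ point o b′ → b ≡ b′
point-injective o b@(k , r) b′@(k′ , r′) eq = cong₂ _,_
  (ℤ.+-injective (trans (sym (ω-point o b)) (trans (cong ω eq) (ω-point o b′))))
  (ℕ.suc-injective (ℤ.+-injective (∙-cancelˡ o _ _ (cong proj₁ eq))))

module Threshold {P : ℕ → Set} (P? : Unary.Decidable P) where

  -- For `P` closed downwards this is the number of r < m satisfying `P`, found as one more than the
  -- largest of them.
  threshold : ℕ → ℕ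
  threshold zero = 0
  threshold (suc m) with P? m
  ... | yes _ = suc m
  ... | no _  = threshold m

  threshold≤ : ∀ m → threshold m ≤ m
  threshold≤ zero = z≤n
  threshold≤ (suc m) with P? m
  ... | yes _ = ℕ.≤-refl
  ... | no _  = ℕ.m≤n⇒m≤1+n (threshold≤ m)

  module _ (down : ∀ {r} → P (suc r) → P r) where

    <threshold⇒P : ∀ m {r} → r < threshold m → P r
    <threshold⇒P (suc m) r< with P? m
    ... | yes pm = below pm (ℕ.≤⇒≤′ (ℕ.s≤s⁻¹ r<))
      where
      below : ∀ {i r} → P i → r ℕ.≤′ i → P r
      below p ℕ.≤′-refl     = p
      below p (ℕ.≤′-step q) = below (down p) q
    ... | no _ = <threshold⇒P m r<

    P⇒<threshold : ∀ m {r} → r < m → P r → r < threshold m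
    P⇒<threshold (suc m) {r} r<m pr with P? m
    ... | yes _  = r<m
    ... | no ¬pm = P⇒<threshold m (ℕ.≤∧≢⇒< (ℕ.s≤s⁻¹ r<m) λ { refl → ¬pm pr }) pr

row-grows : ∀ l → Linked _≥_ l → ∀ r → row l (suc r) ≤ row l r
row-grows []          _          r       = z≤n
row-grows (_ ∷ [])    _          r       = z≤n
row-grows (_ ∷ _ ∷ _) (ge ∷ _)   zero    = ge
row-grows (_ ∷ l@(_ ∷ _)) (_ ∷ rest) (suc r) = row-grows l rest r

row≤row₀ : ∀ l → Linked _≥_ l → ∀ r → row l r ≤ row l 0
row≤row₀ l dec zero    = ℕ.≤-refl
row≤row₀ l dec (suc r) = ℕ.≤-trans (row-grows l dec r) (row≤row₀ l dec r)

-- boundary k is the row, counted from x, in which the southeastern boundary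
-- of the diagram with northwestern corner o meets the diagonal x − y = k.

module Boundary (o : Point) (p : Partition) where

  private
    x y : ℤ
    x = proj₁ o
    y = proj₂ o

    ρ : ℕ → ℕ
    ρ = row (parts p)

  -- In row r the box labelled k has column x + r + 1 - k, and it must not exceed the eastern end y
  -- + ρ r of the row. Places west of the diagram qualify too; they are counted alike for λ and μ
  -- and drop out of the region.
  Above : ℕ → ℕ → Set
  Above k r = x ℤ.+ + suc r ℤ.≤ y ℤ.+ + (k + ρ r)

  above? : ∀ k → Unary.Decidable (Above k)
  above? k r = _ ℤ.≤? _

  above-down : ∀ {k r} → Above k (suc r) → Above k r
  above-down {k} {r} above = begin
    x ℤ.+ + suc r           ≤⟨ ℤ.+-monoʳ-≤ x (ℤ.+≤+ (ℕ.n≤1+n (suc r))) ⟩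
    x ℤ.+ + suc (suc r)     ≤⟨ above ⟩
    y ℤ.+ + (k + ρ (suc r)) ≤⟨ ℤ.+-monoʳ-≤ y (ℤ.+≤+ (ℕ.+-monoʳ-≤ k (row-grows _ (decreasing p) r)))
      ⟩
    y ℤ.+ + (k + ρ r)       ∎
    where open ℤ.≤-Reasoning

  above-east : ∀ {k r} → Above k r → Above (suc k) r
  above-east {k} {r} above = ℤ.≤-trans above (ℤ.+-monoʳ-≤ y (ℤ.+≤+ (ℕ.n≤1+n _)))

  above-diagonal : ∀ {k r} → Above (suc k) (suc r) → Above k r
  above-diagonal {k} {r} above = begin
    x ℤ.+ + suc r           ≤⟨ +-cancelˡ-≤ 1ℤ
      (subst₂ ℤ._≤_ (out x (+ suc r)) (out y (+ (k + ρ (suc r)))) above) ⟩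
    y ℤ.+ + (k + ρ (suc r)) ≤⟨ ℤ.+-monoʳ-≤ y (ℤ.+≤+ (ℕ.+-monoʳ-≤ k (row-grows _ (decreasing p) r)))
      ⟩
    y ℤ.+ + (k + ρ r)       ∎
    where
    open ℤ.≤-Reasoning
    out : ∀ i j → i ℤ.+ (1ℤ ℤ.+ j) ≡ 1ℤ ℤ.+ (i ℤ.+ j)
    out = ℤ-Solver.solve-∀

  private
    -- No row is longer than row 0, so `Above k r` gives r + 1 ≤ y + k + ρ 0 - x. If the right-hand
    -- side is negative there is no such r, and the absolute value does no harm.
    bound : ℕ → ℕ
    bound k = ℤ.∣ y ℤ.+ + (k + ρ 0) ℤ.- x ∣

    above⇒<bound : ∀ {k r} → Above k r → r < bound k
    above⇒<bound {k} {r} above = ℤ.drop‿+≤+ (ℤ.≤-trans r<z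
      (ℤ.≤-reflexive (sym (ℤ.0≤i⇒+∣i∣≡i (ℤ.≤-trans (ℤ.+≤+ z≤n) r<z)))))
      where
      out : ∀ i j → ℤ.- i ℤ.+ (i ℤ.+ j) ≡ j
      out = ℤ-Solver.solve-∀
      swap-sides : ∀ i j → ℤ.- i ℤ.+ j ≡ j ℤ.- i
      swap-sides = ℤ-Solver.solve-∀
      r<z : + suc r ℤ.≤ y ℤ.+ + (k + ρ 0) ℤ.- x
      r<z = subst₂ ℤ._≤_ (out x (+ suc r)) (swap-sides x _) (ℤ.+-monoʳ-≤ (ℤ.- x)
        (ℤ.≤-trans above (ℤ.+-monoʳ-≤ y (ℤ.+≤+ (ℕ.+-monoʳ-≤ k (row≤row₀ _ (decreasing p) r))))))

    module _ (k : ℕ) where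
      open Threshold (above? k) public

  boundary : ℕ → ℕ
  boundary k = threshold k (bound k)

  <boundary⇔above : ∀ {k r} → r < boundary k ⇔ Above k r
  <boundary⇔above {k} = mk⇔ (<threshold⇒P k above-down (bound k))
    (λ above → P⇒<threshold k above-down (bound k) (above⇒<bound above) above)

  -- `above-east` moves a box one place west in its row and `above-diagonal` one place north in its
  -- column; so the boundary neither retreats nor advances by two rows.
  boundary-step : ∀ k → boundary (suc k) ≡ boundary k ⊎ boundary (suc k) ≡ suc (boundary k)
  boundary-step k with ℕ.m≤n⇒m<n∨m≡n (ℕ.≮⇒≥ shrinks)
    where
    shrinks : ¬ (boundary (suc k) < boundary k)
    shrinks lt = ℕ.<-irrefl refl (from <boundary⇔above (above-east (to (<boundary⇔above {k}) lt)))
  ... | inj₂ eq = inj₁ (sym eq)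
  ... | inj₁ lt = inj₂ (ℕ.≤-antisym (ℕ.≮⇒≥ jumps) lt)
    where
    jumps : ¬ (suc (boundary k) < boundary (suc k))
    jumps lt = ℕ.<-irrefl refl (from (<boundary⇔above {k})
      (above-diagonal (to (<boundary⇔above {suc k}) lt)))

  cell⇔<boundary : ∀ {k r c} → y ℤ.+ + suc c ≡ x ℤ.+ + suc r ℤ.- + k → (c < ρ r) ⇔ (r < boundary k)
  cell⇔<boundary {k} {r} {c} eq = ⇔-trans (mk⇔
      (λ c<ρ → ℤ.≤-trans (ℤ.≤-reflexive eq′) (ℤ.+-monoʳ-≤ y (ℤ.+≤+ (ℕ.+-monoʳ-≤ k c<ρ))))
      (λ above → ℕ.+-cancelˡ-≤ k _ _
          (ℤ.drop‿+≤+ (+-cancelˡ-≤ y (ℤ.≤-trans (ℤ.≤-reflexive (sym eq′)) above)))))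
    (⇔-sym <boundary⇔above)
    where
    restore : ∀ i k → i ≡ i ℤ.- k ℤ.+ k
    restore = ℤ-Solver.solve-∀
    reorder : ∀ y c k → y ℤ.+ c ℤ.+ k ≡ y ℤ.+ (k ℤ.+ c)
    reorder = ℤ-Solver.solve-∀
    eq′ : x ℤ.+ + suc r ≡ y ℤ.+ + (k + suc c)
    eq′ = trans (restore _ (+ k)) (trans (cong (ℤ._+ + k) (sym eq)) (reorder y (+ suc c) (+ k)))

module _ (T : SkewShape) where

  private
    x = proj₁ (origin T)
    y = proj₂ (origin T)
    module Λ = Boundary (origin T) (λ′ T)
    module M = Boundary (origin T) (μ T)

    U = M.boundary
    V = Λ.boundary

    U≤V′ : ∀ k → U k ≤ V k
    U≤V′ k = ℕ.≮⇒≥ λ V<U → ℕ.<-irrefl refl (from Λ.<boundary⇔above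
      (ℤ.≤-trans (to M.<boundary⇔above V<U) (ℤ.+-monoʳ-≤ y (ℤ.+≤+ (ℕ.+-monoʳ-≤ k (μ⊆λ T _))))))

    cell⇔ : ∀ {r c k} → corner T (r , c) ≡ point x (k , r) → Cell T (r , c) ⇔ Region U V (k , r)
    cell⇔ eq = mk⇔
      (λ (μ≤c , c<λ) → ℕ.≮⇒≥ (λ r<U → ℕ.<⇒≱ (from (M.cell⇔<boundary (cong proj₂ eq)) r<U) μ≤c) ,
                       to (Λ.cell⇔<boundary (cong proj₂ eq)) c<λ)
      (λ (U≤r , r<V) → ℕ.≮⇒≥ (λ c<μ → ℕ.<⇒≱ (to (M.cell⇔<boundary (cong proj₂ eq)) c<μ) U≤r) ,
                       from (Λ.cell⇔<boundary (cong proj₂ eq)) r<V)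

    -- As the place is not above the boundary of μ, its column lies beyond the end of the row of μ.
    -- Hence the column index is not negative.
    region-corner : ∀ {k r} → Region U V (k , r) → ∃[ c ] corner T (r , c) ≡ point x (k , r)
    region-corner {k} {r} (U≤r , _) = ℤ.∣ z ∣ ,
      cong (x ℤ.+ + suc r ,_) (trans (cong (λ c → y ℤ.+ (1ℤ ℤ.+ c)) (ℤ.0≤i⇒+∣i∣≡i 0≤z))
        (solved y (x ℤ.+ + suc r) (+ k)))
      where
      m = row (parts (μ T)) r
      z = x ℤ.+ + suc r ℤ.- + k ℤ.- y ℤ.- 1ℤ
      solved : ∀ y i k → y ℤ.+ (1ℤ ℤ.+ (i ℤ.- k ℤ.- y ℤ.- 1ℤ)) ≡ i ℤ.- k
      solved = ℤ-Solver.solve-∀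
      rearrange : ∀ y i k m → i ℤ.- (1ℤ ℤ.+ (y ℤ.+ (k ℤ.+ m))) ℤ.+ m ≡ i ℤ.- k ℤ.- y ℤ.- 1ℤ
      rearrange = ℤ-Solver.solve-∀
      0≤z : 0ℤ ℤ.≤ z
      0≤z = subst (0ℤ ℤ.≤_) (rearrange y (x ℤ.+ + suc r) (+ k) (+ m)) (ℤ.+-mono-≤
        (ℤ.i≤j⇒0≤j-i (ℤ.i<j⇒suc[i]≤j (ℤ.≰⇒> λ above → ℕ.<⇒≱ (from M.<boundary⇔above above) U≤r)))
        (ℤ.+≤+ z≤n))

    region⇒∈ : ∀ {b} → Region U V b → point x b ∈ˢ T
    region⇒∈ region = let c , eq = region-corner region in (_ , c) , from (cell⇔ eq) region , sym eq

  upperBoundary lowerBoundary : ℕ → ℕ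
  upperBoundary = U
  lowerBoundary = V

  module _ (below : LabelsBelow n T) where

    private
      label : ∀ {b} → Region U V b → 0ℤ ℤ.< + proj₁ b × + proj₁ b ℤ.< + n
      label {b} region = subst (λ z → 0ℤ ℤ.< z × z ℤ.< + n) (ω-point x b)
        (below _ (region⇒∈ region))

      -- If U k < V k, then (k , U k) would be a box of the shape with a label out of range. This
      -- makes the paths meet on the diagonals 0 and n.
      closed : ∀ {k} → ¬ (0 < k × k < n) → U k ≡ V k
      closed {k} outside = ℕ.≤-antisym (U≤V′ k) (ℕ.≮⇒≥ λ U<V →
        outside (Product.map ℤ.drop‿+<+ ℤ.drop‿+<+ (label {k , U k} (ℕ.≤-refl , U<V))))

    boundary-profile : Profile n U V
    boundary-profile = record
      { U-step = M.boundary-step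
      ; V-step = Λ.boundary-step
      ; U≤V    = U≤V′
      ; start  = closed λ ()
      ; end    = λ n≤k → closed λ (_ , k<n) → ℕ.<⇒≱ k<n n≤k
      }

    boundary-presents : Presents T x U V
    boundary-presents = presentation λ q → mk⇔ to′ (λ { (_ , region , refl) → region⇒∈ region })
      where
      to′ : ∀ {q} → q ∈ˢ T → ∃[ b ] Region U V b × q ≡ point x b
      to′ ((r , c) , cell , refl) = (k , r) , to (cell⇔ eq) cell , eq
        where
        k = ℤ.∣ ω (corner T (r , c)) ∣
        label≡ : + k ≡ ω (corner T (r , c))
        label≡ = ℤ.0≤i⇒+∣i∣≡i (ℤ.<⇒≤ (proj₁ (below _ ((r , c) , cell , refl))))
        solved : ∀ i j → j ≡ i ℤ.- (i ℤ.- j)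
        solved = ℤ-Solver.solve-∀
        eq : corner T (r , c) ≡ point x (k , r)
        eq = cong (x ℤ.+ + suc r ,_) (trans (solved (x ℤ.+ + suc r) _)
          (cong (λ z → x ℤ.+ + suc r ℤ.- z) (sym label≡)))

-- BJS-equivalence

⊑⇔≤ᴾ : ∀ o b b′ → b ⊑ b′ ⇔ (point o b ≤ᴾ point o b′)
⊑⇔≤ᴾ o (k , r) (k′ , r′) = mk⇔
  (λ (r≤r′ , le) → ℤ.+-monoʳ-≤ o (ℤ.+≤+ (s≤s r≤r′)) ,
    subst₂ ℤ._≤_ (out o (+ r) (+ k) (+ k′)) (out′ o (+ r′) (+ k) (+ k′))
      (ℤ.+-monoʳ-≤ (o ℤ.+ 1ℤ ℤ.- + k ℤ.- + k′) (ℤ.+≤+ le)))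
  (λ (x≤x′ , y≤y′) → ℕ.s≤s⁻¹ (ℤ.drop‿+≤+ (+-cancelˡ-≤ o x≤x′)) ,
    ℤ.drop‿+≤+ (+-cancelˡ-≤ (o ℤ.+ 1ℤ ℤ.- + k ℤ.- + k′)
      (subst₂ ℤ._≤_ (sym (out o (+ r) (+ k) (+ k′))) (sym (out′ o (+ r′) (+ k) (+ k′))) y≤y′)))
  where
  out : ∀ o r k k′ → o ℤ.+ 1ℤ ℤ.- k ℤ.- k′ ℤ.+ (r ℤ.+ k′) ≡ o ℤ.+ (1ℤ ℤ.+ r) ℤ.- k
  out = ℤ-Solver.solve-∀
  out′ : ∀ o r k k′ → o ℤ.+ 1ℤ ℤ.- k ℤ.- k′ ℤ.+ (r ℤ.+ k) ≡ o ℤ.+ (1ℤ ℤ.+ r) ℤ.- k′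
  out′ = ℤ-Solver.solve-∀

translate : ℤ → Point → Point
translate t (x , y) = x ℤ.+ t , y ℤ.+ t

ω-translate : ∀ t q → ω (translate t q) ≡ ω q
ω-translate t (x , y) = lemma t x y
  where
  lemma : ∀ t x y → x ℤ.+ t ℤ.- (y ℤ.+ t) ≡ x ℤ.- y
  lemma = ℤ-Solver.solve-∀

translate-mono : ∀ t {q q′} → q ≤ᴾ q′ → translate t q ≤ᴾ translate t q′
translate-mono t (x≤ , y≤) = ℤ.+-monoˡ-≤ t x≤ , ℤ.+-monoˡ-≤ t y≤

translate-injective : ∀ t {q q′} → translate t q ≡ translate t q′ → q ≡ q′
translate-injective t eq = cong₂ _,_ (∙-cancelʳ t _ _ (cong proj₁ eq))
  (∙-cancelʳ t _ _ (cong proj₂ eq))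

module Move (o : ℤ) (U V : ℕ → ℕ) (o′ : ℤ) (U′ V′ : ℕ → ℕ) where

  -- The translation of the diagonal k that takes the least box of one region on it to the least box
  -- of the other.
  shift : ℕ → ℤ
  shift k = o′ ℤ.+ + U′ k ℤ.- (o ℤ.+ + U k)

  move : Point → Point
  move q = translate (shift ℤ.∣ ω q ∣) q

  ω-move : ∀ q → ω (move q) ≡ ω q
  ω-move q = ω-translate (shift ℤ.∣ ω q ∣) q

  move-point : ∀ b → move (point o b) ≡ translate (shift (proj₁ b)) (point o b)
  move-point b = cong (λ z → translate (shift ℤ.∣ z ∣) (point o b)) (ω-point o b)

  move-injective : ∀ {q q′} → move q ≡ move q′ → q ≡ q′
  move-injective {q} {q′} eq = translate-injective (shift ℤ.∣ ω q ∣)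
    (trans eq (cong (λ z → translate (shift ℤ.∣ z ∣) q′)
      (trans (sym (ω-move q′)) (trans (cong ω (sym eq)) (ω-move q)))))

  module _ (heights : ∀ k → V k + U′ k ≡ V′ k + U k) where

    move-region : ∀ {k r} → Region U V (k , r) →
        ∃[ r′ ] Region U′ V′ (k , r′) × move (point o (k , r)) ≡ point o′ (k , r′)
    move-region {k} {r} (U≤r , r<V) = r ∸ U k + U′ k , (ℕ.m≤n+m _ _ , bounded) ,
      trans (move-point (k , r)) (cong₂ _,_ x-moved y-moved)
      where
      bounded : r ∸ U k + U′ k < V′ k
      bounded = ℕ.+-cancelʳ-< (U k) _ _ (begin-strict
        r ∸ U k + U′ k + U k     ≡⟨ ℕ.+-assoc (r ∸ U k) _ _ ⟩
        r ∸ U k + (U′ k + U k)   ≡⟨ cong (λ m → r ∸ U k + m) (ℕ.+-comm (U′ k) (U k)) ⟩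
        r ∸ U k + (U k + U′ k)   ≡⟨ ℕ.+-assoc (r ∸ U k) _ _ ⟨
        r ∸ U k + U k + U′ k     ≡⟨ cong (λ m → m + U′ k) (ℕ.m∸n+n≡m U≤r) ⟩
        r + U′ k                 <⟨ ℕ.+-monoˡ-< (U′ k) r<V ⟩
        V k + U′ k               ≡⟨ heights k ⟩
        V′ k + U k               ∎)
        where open ℕ.≤-Reasoning

      i = + (r ∸ U k)
      u = + U k
      u′ = + U′ k
      r≡ : + r ≡ i ℤ.+ u
      r≡ = cong +_ (sym (ℕ.m∸n+n≡m U≤r))
      x-moved : o ℤ.+ + suc r ℤ.+ shift k ≡ o′ ℤ.+ (1ℤ ℤ.+ (i ℤ.+ u′))
      x-moved = trans (cong (λ z → o ℤ.+ (1ℤ ℤ.+ z) ℤ.+ shift k) r≡) (lemma o o′ i u u′)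
        where
        lemma : ∀ o o′ i u u′ → o ℤ.+ (1ℤ ℤ.+ (i ℤ.+ u)) ℤ.+ (o′ ℤ.+ u′ ℤ.- (o ℤ.+ u)) ≡ o′ ℤ.+
            (1ℤ ℤ.+ (i ℤ.+ u′))
        lemma = ℤ-Solver.solve-∀
      y-moved : o ℤ.+ + suc r ℤ.- + k ℤ.+ shift k ≡ o′ ℤ.+ (1ℤ ℤ.+ (i ℤ.+ u′)) ℤ.- + k
      y-moved = trans (lemma (o ℤ.+ + suc r) (+ k) (shift k)) (cong (ℤ._- + k) x-moved)
        where
        lemma : ∀ x k t → x ℤ.- k ℤ.+ t ≡ x ℤ.+ t ℤ.- k
        lemma = ℤ-Solver.solve-∀

grows : ∀ {F : ℕ → ℕ} → (∀ k → F k ≤ F (suc k)) → ∀ i k → F k ≤ F (i + k)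
grows step zero    k = ℕ.≤-refl
grows step (suc i) k = ℕ.≤-trans (grows step i k) (step (i + k))

grows-at-most : ∀ {F : ℕ → ℕ} → (∀ k → F (suc k) ≤ suc (F k)) → ∀ i k → F (i + k) ≤ i + F k
grows-at-most step zero    k = ℕ.≤-refl
grows-at-most step (suc i) k = ℕ.≤-trans (step (i + k)) (s≤s (grows-at-most step i k))

module _ {T T′ : SkewShape} {o o′ : ℤ} {U V U′ V′ : ℕ → ℕ} (p : Profile n U V)
         (presents : Presents T o U V) (presents′ : Presents T′ o′ U′ V′)
         (heights : ∀ k → V k + U′ k ≡ V′ k + U k)
         (parallel : ∀ k → U k < V k → U (suc k) + U′ k ≡ U k + U′ (suc k)) where
  private
    module Forth = Move o U V o′ U′ V′
    module Back = Move o′ U′ V′ o U V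

    move-∈ : ∀ {q} → q ∈ˢ T → Forth.move q ∈ˢ T′
    move-∈ q∈ with _ , region , refl ← to (member presents _) q∈ =
      from (member presents′ _) (_ , proj₂ (Forth.move-region heights region))

    move-∈′ : ∀ {q} → q ∈ˢ T′ → Back.move q ∈ˢ T
    move-∈′ q∈ with _ , region , refl ← to (member presents′ _) q∈ =
      from (member presents _) (_ , proj₂ (Back.move-region (sym ∘ heights) region))

    move-back : ∀ q → Forth.move (Back.move q) ≡ q
    move-back q@(x , y) = begin
      Forth.move (Back.move q)
        ≡⟨ cong (λ z → translate (Forth.shift ℤ.∣ z ∣) (Back.move q)) (Back.ω-move q) ⟩
      translate (Forth.shift k) (translate (Back.shift k) q)
        ≡⟨ cong₂ _,_ (cancel x (o′ ℤ.+ + U′ k) (o ℤ.+ + U k))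
          (cancel y (o′ ℤ.+ + U′ k) (o ℤ.+ + U k)) ⟩
      q
        ∎
      where
      open ≡-Reasoning
      k = ℤ.∣ ω q ∣
      cancel : ∀ x a b → x ℤ.+ (b ℤ.- a) ℤ.+ (a ℤ.- b) ≡ x
      cancel = ℤ-Solver.solve-∀

    shift-suc : ∀ {k} → U k < V k → Forth.shift (suc k) ≡ Forth.shift k
    shift-suc {k} U<V = begin
      o′ ℤ.+ b′ ℤ.- (o ℤ.+ b)                                            ≡⟨ split o o′ a a′ b b′ ⟩
      o′ ℤ.+ a′ ℤ.- (o ℤ.+ a) ℤ.+ (a ℤ.+ b′) ℤ.- (b ℤ.+ a′)
        ≡⟨ cong (λ z → o′ ℤ.+ a′ ℤ.- (o ℤ.+ a) ℤ.+ (a ℤ.+ b′) ℤ.- z) (cong +_ (parallel k U<V)) ⟩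
      o′ ℤ.+ a′ ℤ.- (o ℤ.+ a) ℤ.+ (a ℤ.+ b′) ℤ.- (a ℤ.+ b′)
        ≡⟨ cancel (o′ ℤ.+ a′ ℤ.- (o ℤ.+ a)) (a ℤ.+ b′) ⟩
      o′ ℤ.+ a′ ℤ.- (o ℤ.+ a)                                            ∎
      where
      open ≡-Reasoning
      a = + U k
      a′ = + U′ k
      b = + U (suc k)
      b′ = + U′ (suc k)
      split : ∀ o o′ a a′ b b′ → o′ ℤ.+ b′ ℤ.- (o ℤ.+ b) ≡ o′ ℤ.+ a′ ℤ.- (o ℤ.+ a) ℤ.+
          (a ℤ.+ b′) ℤ.- (b ℤ.+ a′)
      split = ℤ-Solver.solve-∀
      cancel : ∀ x y → x ℤ.+ y ℤ.- y ≡ x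
      cancel = ℤ-Solver.solve-∀

    shift-between : ∀ k m → (∀ i → i < m → U (i + k) < V (i + k)) →
        Forth.shift (m + k) ≡ Forth.shift k
    shift-between k zero    _      = refl
    shift-between k (suc m) nonempty =
      trans (shift-suc (nonempty m ℕ.≤-refl)) (shift-between k m λ i i<m →
        nonempty i (ℕ.m<n⇒m<1+n i<m))

    -- Every diagonal between the labels of two comparable boxes meets the region, because U and V
    -- are monotone with steps of at most one. Across such diagonals `shift` is constant, so
    -- comparable boxes move together.
    shift-⊑ : ∀ {b b′} → Region U V b → Region U V b′ → b ⊑ b′ →
        Forth.shift (proj₁ b) ≡ Forth.shift (proj₁ b′)
    shift-⊑ {k , r} {k′ , r′} (U≤r , r<V) (U≤r′ , r′<V) (r≤r′ , le) with ℕ.≤-total k k′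
    ... | inj₁ k≤k′ = trans (sym (shift-between k (k′ ∸ k) nonempty)) (cong Forth.shift m+k≡k′)
      where
      m = k′ ∸ k
      m+k≡k′ = ℕ.m∸n+n≡m k≤k′
      r+m≤r′ : r + m ≤ r′
      r+m≤r′ = ℕ.+-cancelʳ-≤ k _ _ (subst (_≤ r′ + k)
        (trans (cong (λ z → r + z) (sym m+k≡k′)) (sym (ℕ.+-assoc r m k))) le)
      nonempty : ∀ i → i < m → U (i + k) < V (i + k)
      nonempty i i<m = ℕ.+-cancelˡ-< (m ∸ i) _ _ (begin-strict
        m ∸ i + U (i + k)       ≤⟨ ℕ.+-monoʳ-≤ (m ∸ i) (grows-at-most (U-grows≤1 p) i k) ⟩
        m ∸ i + (i + U k)       ≡⟨ ℕ.+-assoc (m ∸ i) i (U k) ⟨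
        m ∸ i + i + U k         ≡⟨ cong (λ z → z + U k) (ℕ.m∸n+n≡m (ℕ.<⇒≤ i<m)) ⟩
        m + U k                 ≤⟨ ℕ.+-monoʳ-≤ m U≤r ⟩
        m + r                   ≡⟨ ℕ.+-comm m r ⟩
        r + m                   ≤⟨ r+m≤r′ ⟩
        r′                      <⟨ r′<V ⟩
        V k′                    ≡⟨ cong V
          (trans (cong (λ z → z + k) (ℕ.m∸n+n≡m (ℕ.<⇒≤ i<m))) m+k≡k′) ⟨
        V (m ∸ i + i + k)       ≡⟨ cong V (ℕ.+-assoc (m ∸ i) i k) ⟩
        V (m ∸ i + (i + k))     ≤⟨ grows-at-most (V-grows≤1 p) (m ∸ i) (i + k) ⟩
        m ∸ i + V (i + k)       ∎)
        where open ℕ.≤-Reasoning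
    ... | inj₂ k′≤k = trans (cong Forth.shift (sym m+k′≡k)) (shift-between k′ (k ∸ k′) nonempty)
      where
      m = k ∸ k′
      m+k′≡k = ℕ.m∸n+n≡m k′≤k
      nonempty : ∀ i → i < m → U (i + k′) < V (i + k′)
      nonempty i i<m = begin-strict
        U (i + k′)              ≤⟨ grows (U-grows p) (m ∸ i) (i + k′) ⟩
        U (m ∸ i + (i + k′))    ≡⟨ cong U
          (trans (sym (ℕ.+-assoc (m ∸ i) i k′))
            (trans (cong (λ z → z + k′) (ℕ.m∸n+n≡m (ℕ.<⇒≤ i<m))) m+k′≡k)) ⟩
        U k                     ≤⟨ U≤r ⟩
        r                       ≤⟨ r≤r′ ⟩
        r′                      <⟨ r′<V ⟩
        V k′                    ≤⟨ grows (V-grows p) i k′ ⟩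
        V (i + k′)              ∎
        where open ℕ.≤-Reasoning

    move-mono : ∀ {q q′} → q ∈ˢ T → q′ ∈ˢ T → q ≤ᴾ q′ → Forth.move q ≤ᴾ Forth.move q′
    move-mono q∈ q′∈ q≤q′ with b , region , refl ← to (member presents _) q∈ | b′ , region′ , refl ←
      to (member presents _) q′∈ =
      subst₂ _≤ᴾ_ (sym (Forth.move-point b))
        (trans (cong (λ t → translate t (point o b′))
          (shift-⊑ region region′ (from (⊑⇔≤ᴾ o b b′) q≤q′))) (sym (Forth.move-point b′)))
        (translate-mono (Forth.shift (proj₁ b)) q≤q′)

  presented⇒BJS : BJSEquivalent T T′
  presented⇒BJS = record
    { f                = λ (q , q∈) → Forth.move q , move-∈ q∈
    ; congruent        = cong Forth.move
    ; bijective        = Forth.move-injective , λ (q , q∈) → (Back.move q , move-∈′ q∈) ,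
        λ eq → trans (cong Forth.move eq) (move-back q)
    ; order-preserving = λ (_ , q∈) (_ , q′∈) → move-mono q∈ q′∈
    ; label-preserving = λ (q , _) → Forth.ω-move q
    }

-- Two pairs of paths traced by one diagram

NorthOpens SouthCloses : (U V : ℕ → ℕ) → ℕ → Set
NorthOpens  U V k = U (suc k) ≡ U k × U k < V (suc k)
SouthCloses U V k = V (suc k) ≡ V k × U k < V k

module Steps {U V : ℕ → ℕ} (p : Profile n U V) (k : ℕ) where

  widening : NorthOpens U V k → ¬ SouthCloses U V k → U (suc k) ≡ U k × V (suc k) ≡ suc (V k)
  widening (U→ , U<V) ¬closes with V-step p k
  ... | inj₁ V→ = contradiction (V→ , subst (U k <_) V→ U<V) ¬closes
  ... | inj₂ V↓ = U→ , V↓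

  narrowing : ¬ NorthOpens U V k → SouthCloses U V k → U (suc k) ≡ suc (U k) × V (suc k) ≡ V k
  narrowing ¬opens (V→ , U<V) with U-step p k
  ... | inj₁ U→ = contradiction (U→ , subst (U k <_) (sym V→) U<V) ¬opens
  ... | inj₂ U↓ = U↓ , V→

  -- Two west steps at positive height are recorded as opening and closing at once. Without either
  -- record they occur only at height zero, where the traces do not tell them from two south steps.
  level : ¬ NorthOpens U V k → ¬ SouthCloses U V k →
          (U (suc k) ≡ suc (U k) × V (suc k) ≡ suc (V k)) ⊎
            (U (suc k) ≡ U k × V (suc k) ≡ V k × U k ≡ V k)
  level ¬opens ¬closes with U-step p k | V-step p k
  ... | inj₂ U↓ | inj₂ V↓ = inj₁ (U↓ , V↓)
  ... | inj₁ U→ | inj₁ V→ = inj₂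
        (U→ , V→ , ℕ.≤-antisym (U≤V p k) (ℕ.≮⇒≥ λ U<V → ¬closes (V→ , U<V)))
  ... | inj₁ U→ | inj₂ V↓ = contradiction (U→ , ℕ.≤-trans (s≤s (U≤V p k)) (ℕ.≤-reflexive (sym V↓)))
        ¬opens
  ... | inj₂ U↓ | inj₁ V→ = contradiction (V→ , subst₂ _≤_ U↓ V→ (U≤V p (suc k))) ¬closes

module Compare {U V U′ V′ : ℕ → ℕ} (p : Profile n U V) (p′ : Profile n U′ V′) where

  private
    SameHeight : ℕ → Set
    SameHeight k = V k + U′ k ≡ V′ k + U k

    level-pos : ∀ {k} → SameHeight k → U k < V k → U′ k ≢ V′ k
    level-pos {k} h U<V eq = ℕ.<-irrefl
      (ℕ.+-cancelʳ-≡ (U′ k) _ _ (trans (ℕ.+-comm (U k) (U′ k))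
        (trans (cong (λ z → z + U k) eq) (sym h)))) U<V

  module _ {k : ℕ} (opens : NorthOpens U V k ⇔ NorthOpens U′ V′ k)
           (closes : SouthCloses U V k ⇔ SouthCloses U′ V′ k)
           (h : V k + U′ k ≡ V′ k + U k) where

    private
      module P = Steps p k
      module P′ = Steps p′ k

    private
      combine : ∀ {v u′ v′ u} → V (suc k) ≡ v → U′ (suc k) ≡ u′ → V′ (suc k) ≡ v′ → U (suc k) ≡ u →
              v + u′ ≡ v′ + u → V (suc k) + U′ (suc k) ≡ V′ (suc k) + U (suc k)
      combine refl refl refl refl eq = eq

      h⁺ : V k + suc (U′ k) ≡ suc (V′ k + U k)
      h⁺ = trans (ℕ.+-suc (V k) (U′ k)) (cong suc h)

      ⁺h : suc (V k + U′ k) ≡ V′ k + suc (U k)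
      ⁺h = trans (cong suc h) (sym (ℕ.+-suc (V′ k) (U k)))

      ⁺h⁺ : V k + suc (U′ k) ≡ V′ k + suc (U k)
      ⁺h⁺ = trans h⁺ (sym (ℕ.+-suc (V′ k) (U k)))

      down : U (suc k) ≡ suc (U k) → U′ (suc k) ≡ suc (U′ k) →
             U (suc k) + U′ k ≡ U k + U′ (suc k)
      down U↓ U↓′ = trans (cong (λ z → z + U′ k) U↓)
        (trans (sym (ℕ.+-suc (U k) (U′ k))) (cong (λ z → U k + z) (sym U↓′)))

      along : U (suc k) ≡ U k → U′ (suc k) ≡ U′ k → U (suc k) + U′ k ≡ U k + U′ (suc k)
      along U→ U→′ = cong₂ _+_ U→ (sym U→′)

    step-heights : Dec (NorthOpens U V k) → Dec (SouthCloses U V k) →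
                   V (suc k) + U′ (suc k) ≡ V′ (suc k) + U (suc k)
    step-heights (yes o) (yes c) =
      combine (proj₁ c) (proj₁ (to opens o)) (proj₁ (to closes c)) (proj₁ o) h
    step-heights (yes o) (no ¬c)
      with U→ , V↓ ← P.widening o ¬c | U→′ , V↓′ ← P′.widening (to opens o) (¬c ∘ from closes) =
      combine V↓ U→′ V↓′ U→ (cong suc h)
    step-heights (no ¬o) (yes c)
      with U↓ , V→ ← P.narrowing ¬o c | U↓′ , V→′ ← P′.narrowing (¬o ∘ from opens) (to closes c) =
      combine V→ U↓′ V→′ U↓ ⁺h⁺
    step-heights (no ¬o) (no ¬c) with P.level ¬o ¬c | P′.level (¬o ∘ from opens) (¬c ∘ from closes)
    ... | inj₁ (U↓ , V↓)     | inj₁ (U↓′ , V↓′)     = combine V↓ U↓′ V↓′ U↓ (cong suc ⁺h⁺)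
    ... | inj₁ (U↓ , V↓)     | inj₂ (U→′ , V→′ , _) = combine V↓ U→′ V→′ U↓ ⁺h
    ... | inj₂ (U→ , V→ , _) | inj₁ (U↓′ , V↓′)     = combine V→ U↓′ V↓′ U→ h⁺
    ... | inj₂ (U→ , V→ , _) | inj₂ (U→′ , V→′ , _) = combine V→ U→′ V→′ U→ h

    step-parallel : Dec (NorthOpens U V k) → Dec (SouthCloses U V k) →
                    U k < V k → U (suc k) + U′ k ≡ U k + U′ (suc k)
    step-parallel (yes o) _ _ = along (proj₁ o) (proj₁ (to opens o))
    step-parallel (no ¬o) (yes c) _ =
      down (proj₁ (P.narrowing ¬o c)) (proj₁ (P′.narrowing (¬o ∘ from opens) (to closes c)))
    step-parallel (no ¬o) (no ¬c) U<V with P.level ¬o ¬c | P′.level (¬o ∘ from opens)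
      (¬c ∘ from closes)
    ... | inj₁ (U↓ , _)     | inj₁ (U↓′ , _)     = down U↓ U↓′
    ... | inj₁ _            | inj₂ (_ , _ , eq)  = contradiction eq (level-pos h U<V)
    ... | inj₂ (_ , _ , eq) | _                  = contradiction U<V (ℕ.<-irrefl eq)

module _ {d : Diagram n} {U V U′ V′ : ℕ → ℕ} (p : Profile n U V) (t : Traces d U V)
         (p′ : Profile n U′ V′) (t′ : Traces d U′ V′) where

  private
    module _ (j : Fin n) where

      opens? : Dec (NorthOpens U V (toℕ j))
      opens? = map-dec (north-opens t j) (¬? (closing? d (north j)))

      closes? : Dec (SouthCloses U V (toℕ j))
      closes? = map-dec (south-closes t j) (closing? d (south j))

      opens⇔ : NorthOpens U V (toℕ j) ⇔ NorthOpens U′ V′ (toℕ j)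
      opens⇔ = ⇔-trans (⇔-sym (north-opens t j)) (north-opens t′ j)

      closes⇔ : SouthCloses U V (toℕ j) ⇔ SouthCloses U′ V′ (toℕ j)
      closes⇔ = ⇔-trans (⇔-sym (south-closes t j)) (south-closes t′ j)

    at-end : ∀ {k} → n ≤ k → V k + U′ k ≡ V′ k + U k
    at-end {k} n≤k = trans (cong₂ _+_ (sym (end p n≤k)) (end p′ n≤k)) (ℕ.+-comm (U k) (V′ k))

  same-heights : ∀ k → V k + U′ k ≡ V′ k + U k
  same-heights zero = trans (cong₂ _+_ (sym (start p)) (start p′)) (ℕ.+-comm (U 0) (V′ 0))
  same-heights (suc k) with k ℕ.<? n
  ... | no k≮n = at-end (ℕ.m≤n⇒m≤1+n (ℕ.≮⇒≥ k≮n))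
  ... | yes k<n = subst (λ k → V k + U′ k ≡ V′ k + U k) (cong suc (Fin.toℕ-fromℕ< k<n))
    (Compare.step-heights p p′ (opens⇔ j) (closes⇔ j)
      (subst (λ k → V k + U′ k ≡ V′ k + U k) (sym (Fin.toℕ-fromℕ< k<n)) (same-heights k)) (opens? j)
        (closes? j))
    where j = fromℕ< k<n

  same-steps : ∀ k → U k < V k → U (suc k) + U′ k ≡ U k + U′ (suc k)
  same-steps k U<V with k ℕ.<? n
  ... | no k≮n = contradiction U<V (ℕ.<-irrefl (end p (ℕ.≮⇒≥ k≮n)))
  ... | yes k<n = subst (λ k → U k < V k → U (suc k) + U′ k ≡ U k + U′ (suc k)) (Fin.toℕ-fromℕ< k<n)
    (Compare.step-parallel p p′ (opens⇔ j) (closes⇔ j) (same-heights (toℕ j)) (opens? j)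
      (closes? j)) U<V
    where j = fromℕ< k<n

-- The diagram traces its own paths as well as the given ones, and two pairs traced by the same
-- diagram satisfy the hypotheses of `presented⇒BJS`.
traces⇒BJS : ∀ {d : Diagram n} {U V T o} → Profile n U V → Traces d U V → Presents T o U V →
    BJSEquivalent (Θ d) T
traces⇒BJS {d = d} p t presents = presented⇒BJS (profile d) (Θ-presents d) presents
  (same-heights (profile d) (traces d) p t) (same-steps (profile d) (traces d) p t)

-- Otherwise f q would lie both above and below q′.

module _ {T T′ : SkewShape} (equivalent : BJSEquivalent T T′) where

  open BJSEquivalent equivalent

  no-reversal : ∀ {q q′ l l′} → l ≢ l′ →
                q ∈ˢ T → ω q ≡ l → (∀ {x} → x ∈ˢ T → ω x ≡ l′ → q ≤ᴾ x) →
                q′ ∈ˢ T′ → ω q′ ≡ l′ → ¬ (∀ {x} → x ∈ˢ T′ → ω x ≡ l → q′ ≤ᴾ x)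
  no-reversal {q} {q′} {l} {l′} l≢l′ q∈ ωq q-min q′∈ ωq′ q′-min = l≢l′ (begin
      l               ≡⟨ ωfq ⟨
      ω (proj₁ fq)    ≡⟨ cong ω (≤ᴾ-antisym
        (subst (proj₁ fq ≤ᴾ_) f≡q′ (order-preserving _ (x , x∈) (q-min x∈ ωx)))
          (q′-min (proj₂ fq) ωfq)) ⟩
      ω q′            ≡⟨ ωq′ ⟩
      l′              ∎)
    where
    open ≡-Reasoning
    ≤ᴾ-antisym : ∀ {p q} → p ≤ᴾ q → q ≤ᴾ p → p ≡ q
    ≤ᴾ-antisym (≤₁ , ≤₂) (≥₁ , ≥₂) = cong₂ _,_ (ℤ.≤-antisym ≤₁ ≥₁) (ℤ.≤-antisym ≤₂ ≥₂)
    fq = f (q , q∈)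
    ωfq : ω (proj₁ fq) ≡ l
    ωfq = trans (label-preserving (q , q∈)) ωq
    preimage = proj₂ bijective (q′ , q′∈)
    x = proj₁ (proj₁ preimage)
    x∈ = proj₂ (proj₁ preimage)
    f≡q′ : proj₁ (f (x , x∈)) ≡ q′
    f≡q′ = proj₂ preimage refl
    ωx : ω x ≡ l′
    ωx = trans (sym (label-preserving (x , x∈))) (trans (cong ω f≡q′) ωq′)

-- What a BJS-equivalence preserves

height≤ : ∀ {T T′ o o′ U V U′ V′} → (∀ k → U k ≤ V k) → Presents T o U V → Presents T′ o′ U′ V′ →
          (f : Box T → Box T′) → (∀ b b′ → proj₁ (f b) ≡ proj₁ (f b′) → proj₁ b ≡ proj₁ b′) →
          (∀ b → ω (proj₁ (f b)) ≡ ω (proj₁ b)) → ∀ k → V k ∸ U k ≤ V′ k ∸ U′ k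
height≤ {T} {T′} {o} {o′} {U} {V} {U′} {V′} U≤V presents presents′ f f-injective f-label k =
  Fin.injective⇒≤ {f = index} λ {i} {j} eq → Fin.toℕ-injective (ℕ.+-cancelˡ-≡ (U k) _ _
    (cong proj₂ (point-injective o _ _ (f-injective (box i) (box j) (begin
      proj₁ (f (box i))     ≡⟨ proj₂ (proj₂ (image i)) ⟩
      point o′ (k , r′ i)   ≡⟨ cong (λ r → point o′ (k , r)) (ℕ.∸-cancelʳ-≡ (U≤r′ i) (U≤r′ j) (begin
        r′ i ∸ U′ k           ≡⟨ Fin.toℕ-fromℕ< _ ⟨
        toℕ (index i)         ≡⟨ cong toℕ eq ⟩
        toℕ (index j)         ≡⟨ Fin.toℕ-fromℕ< _ ⟩
        r′ j ∸ U′ k           ∎)) ⟩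
      point o′ (k , r′ j)   ≡⟨ proj₂ (proj₂ (image j)) ⟨
      proj₁ (f (box j))     ∎)))))
  where
  open ≡-Reasoning
  box : Fin (V k ∸ U k) → Box T
  box i = point o (k , U k + toℕ i) , from (member presents _) (_ , (ℕ.m≤m+n _ _ ,
    subst (U k + toℕ i <_) (ℕ.m+[n∸m]≡n (U≤V k)) (ℕ.+-monoʳ-< (U k) (Fin.toℕ<n i))) , refl)

  image : ∀ i → ∃[ r ] Region U′ V′ (k , r) × proj₁ (f (box i)) ≡ point o′ (k , r)
  image i with to (member presents′ _) (proj₂ (f (box i)))
  ... | (k′ , r) , region , eq = r , subst (λ k → Region U′ V′ (k , r)) k′≡k region , trans eq
        (cong (λ k → point o′ (k , r)) k′≡k)
    where
    k′≡k : k′ ≡ k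
    k′≡k = ℤ.+-injective (trans (sym (ω-point o′ (k′ , r)))
      (trans (cong ω (sym eq)) (trans (f-label (box i)) (ω-point o (k , _)))))

  r′ : Fin (V k ∸ U k) → ℕ
  r′ i = proj₁ (image i)

  U≤r′ : ∀ i → U′ k ≤ r′ i
  U≤r′ i = proj₁ (proj₁ (proj₂ (image i)))

  index : Fin (V k ∸ U k) → Fin (V′ k ∸ U′ k)
  index i = fromℕ< (ℕ.∸-monoˡ-< (proj₂ (proj₁ (proj₂ (image i)))) (U≤r′ i))

BJS⇒heights : ∀ {T T′ o o′ U V U′ V′} → (∀ k → U k ≤ V k) → (∀ k → U′ k ≤ V′ k) →
              Presents T o U V → Presents T′ o′ U′ V′ → BJSEquivalent T T′ → ∀ k →
                V k + U′ k ≡ V′ k + U k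
BJS⇒heights {T} {T′} {o} {o′} {U} {V} {U′} {V′} U≤V U≤V′ presents presents′ equivalent k = begin
  V k + U′ k                  ≡⟨ cong (λ z → z + U′ k) (ℕ.m∸n+n≡m (U≤V k)) ⟨
  V k ∸ U k + U k + U′ k      ≡⟨ cong (λ z → z + U k + U′ k) same ⟩
  V′ k ∸ U′ k + U k + U′ k    ≡⟨ ℕ.+-assoc (V′ k ∸ U′ k) _ _ ⟩
  V′ k ∸ U′ k + (U k + U′ k)  ≡⟨ cong (λ z → V′ k ∸ U′ k + z) (ℕ.+-comm (U k) (U′ k)) ⟩
  V′ k ∸ U′ k + (U′ k + U k)  ≡⟨ ℕ.+-assoc (V′ k ∸ U′ k) _ _ ⟨
  V′ k ∸ U′ k + U′ k + U k    ≡⟨ cong (λ z → z + U k) (ℕ.m∸n+n≡m (U≤V′ k)) ⟩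
  V′ k + U k                  ∎
  where
  open ≡-Reasoning
  open BJSEquivalent equivalent
  inverse : Box T′ → Box T
  inverse b = proj₁ (proj₂ bijective b)
  f-inverse : ∀ b → proj₁ (f (inverse b)) ≡ proj₁ b
  f-inverse b = proj₂ (proj₂ bijective b) refl
  same : V k ∸ U k ≡ V′ k ∸ U′ k
  same = ℕ.≤-antisym
    (height≤ U≤V presents presents′ f (λ _ _ → proj₁ bijective) label-preserving k)
    (height≤ U≤V′ presents′ presents inverse
      (λ b b′ eq → trans (sym (f-inverse b)) (trans (congruent eq) (f-inverse b′)))
      (λ b → trans (sym (label-preserving (inverse b))) (cong ω (f-inverse b))) k)

module _ {U V U′ V′ : ℕ → ℕ} (p : Profile n U V) (p′ : Profile n U′ V′) {k : ℕ}
         (h : V k + U′ k ≡ V′ k + U k) (h⁺ : V (suc k) + U′ (suc k) ≡ V′ (suc k) + U (suc k))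
         (consistent : U (suc k) ≡ U k → V (suc k) ≡ V k → U k < V k →
                       U′ (suc k) ≡ suc (U′ k) → ¬ (V′ (suc k) ≡ suc (V′ k))) where

  private
    -- Equal heights on both diagonals mean that the increments satisfy ΔV + ΔU′ = ΔV′ + ΔU, so
    -- three of them determine the fourth.
    step-difference : ∀ {a b c} → V (suc k) ≡ a + V k → U (suc k) ≡ b + U k →
        U′ (suc k) ≡ c + U′ k →
                      a + c + V′ k ≡ b + V′ (suc k)
    step-difference {a} {b} {c} eqV eqU eqU′ = ℕ.+-cancelʳ-≡ (U k) _ _ (begin
      a + c + V′ k + U k           ≡⟨ ℕ.+-assoc (a + c) _ _ ⟩
      a + c + (V′ k + U k)         ≡⟨ cong (λ z → a + c + z) h ⟨
      a + c + (V k + U′ k)         ≡⟨ regroup a c (V k) (U′ k) ⟩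
      (a + V k) + (c + U′ k)       ≡⟨ cong₂ _+_ eqV eqU′ ⟨
      V (suc k) + U′ (suc k)       ≡⟨ h⁺ ⟩
      V′ (suc k) + U (suc k)       ≡⟨ cong (λ z → V′ (suc k) + z) eqU ⟩
      V′ (suc k) + (b + U k)       ≡⟨ regroup′ b (V′ (suc k)) (U k) ⟩
      b + V′ (suc k) + U k         ∎)
      where
      open ≡-Reasoning
      regroup : ∀ a c v u → a + c + (v + u) ≡ (a + v) + (c + u)
      regroup = ℕ-Solver.solve-∀
      regroup′ : ∀ b v u → v + (b + u) ≡ b + v + u
      regroup′ = ℕ-Solver.solve-∀

    U<V⇒U′<V′ : U k < V k → U′ k < V′ k
    U<V⇒U′<V′ U<V = ℕ.+-cancelʳ-< (U k) _ _ (begin-strict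
      U′ k + U k   ≡⟨ ℕ.+-comm (U′ k) (U k) ⟩
      U k + U′ k   <⟨ ℕ.+-monoˡ-< (U′ k) U<V ⟩
      V k + U′ k   ≡⟨ h ⟩
      V′ k + U k   ∎)
      where open ℕ.≤-Reasoning

  -- With equal heights the steps can differ only as two west steps against two south steps, which
  -- `consistent` excludes. In the last case V′ would have to rise by two.
  transfer-opens : NorthOpens U V k → NorthOpens U′ V′ k
  transfer-opens (U→ , U<V) with V-step p k | U-step p′ k
  ... | inj₁ V→ | inj₁ U→′ = U→′ , subst (U′ k <_) (step-difference V→ U→ U→′)
        (U<V⇒U′<V′ (subst (U k <_) V→ U<V))
  ... | inj₁ V→ | inj₂ U↓′ = contradiction (sym (step-difference V→ U→ U↓′))
        (consistent U→ V→ (subst (U k <_) V→ U<V) U↓′)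
  ... | inj₂ V↓ | inj₁ U→′ = U→′ , subst (U′ k <_) (step-difference V↓ U→ U→′) (s≤s (U≤V p′ k))
  ... | inj₂ V↓ | inj₂ U↓′ = contradiction (V-grows≤1 p′ k)
        (ℕ.<⇒≱ (ℕ.≤-reflexive (step-difference V↓ U→ U↓′)))

  transfer-closes : SouthCloses U V k → SouthCloses U′ V′ k
  transfer-closes (V→ , U<V) with U-step p k | U-step p′ k
  ... | inj₁ U→ | inj₁ U→′ = sym (step-difference V→ U→ U→′) , U<V⇒U′<V′ U<V
  ... | inj₁ U→ | inj₂ U↓′ = contradiction (sym (step-difference V→ U→ U↓′))
        (consistent U→ V→ U<V U↓′)
  ... | inj₂ U↓ | inj₁ U→′ = contradiction (V-grows p′ k)
        (ℕ.<⇒≱ (ℕ.≤-reflexive (sym (step-difference V→ U↓ U→′))))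
  ... | inj₂ U↓ | inj₂ U↓′ = ℕ.suc-injective (sym (step-difference V→ U↓ U↓′)) , U<V⇒U′<V′ U<V

module Extreme {T o U V} (presents : Presents T o U V) (k : ℕ) (U<V : U k < V k) where

  least∈ : point o (k , U k) ∈ˢ T
  least∈ = from (member presents _) (_ , (ℕ.≤-refl , U<V) , refl)

  -- After a south step the least box labelled k + 1 is the southern neighbour of the least box
  -- labelled k.
  least-along : U (suc k) ≡ suc (U k) → ∀ {q} → q ∈ˢ T → ω q ≡ + suc k → point o (k , U k) ≤ᴾ q
  least-along U↓ q∈ ωq with (l , r) , (U≤r , _) , refl ← to (member presents _) q∈
    with refl ← ℤ.+-injective (trans (sym (ω-point o (l , r))) ωq) =
    to (⊑⇔≤ᴾ o _ _) (ℕ.<⇒≤ U<r , ℕ.≤-trans (ℕ.≤-reflexive (ℕ.+-suc (U k) k)) (ℕ.+-monoˡ-≤ k U<r))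
    where
    U<r : U k < r
    U<r = subst (_≤ r) U↓ U≤r

  module _ (U→ : U (suc k) ≡ U k) where

    next∈ : V (suc k) ≡ V k → point o (suc k , U k) ∈ˢ T
    next∈ V→ = from (member presents _)
      (_ , (ℕ.≤-reflexive U→ , subst (U k <_) (sym V→) U<V) , refl)

    -- After a west step the box labelled k + 1 in the row U k is the western neighbour of the least
    -- box labelled k.
    next-least : ∀ {q} → q ∈ˢ T → ω q ≡ + k → point o (suc k , U k) ≤ᴾ q
    next-least q∈ ωq with (l , r) , (U≤r , _) , refl ← to (member presents _) q∈
      with refl ← ℤ.+-injective (trans (sym (ω-point o (l , r))) ωq) =
      to (⊑⇔≤ᴾ o _ _) (U≤r , ℕ.≤-trans (ℕ.+-monoˡ-≤ k U≤r) (ℕ.+-monoʳ-≤ r (ℕ.n≤1+n k)))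

module _ {d d′ : Diagram n} (equivalent : BJSEquivalent (Θ d) (Θ d′)) where

  private
    U = upperSouth d
    V = lowerSouth d
    U′ = upperSouth d′
    V′ = lowerSouth d′

    heights : ∀ k → V k + U′ k ≡ V′ k + U k
    heights = BJS⇒heights (U≤V (profile d)) (U≤V (profile d′)) (Θ-presents d) (Θ-presents d′)
      equivalent

    U<V⇔U′<V′ : ∀ {k} → U k < V k ⇔ U′ k < V′ k
    U<V⇔U′<V′ {k} = mk⇔
      (λ U<V → ℕ.+-cancelʳ-< (U k) _ _ (subst₂ _<_ (ℕ.+-comm (U k) (U′ k)) (heights k)
          (ℕ.+-monoˡ-< (U′ k) U<V)))
      (λ U<V → ℕ.+-cancelʳ-< (U′ k) _ _ (subst₂ _<_ (ℕ.+-comm (U′ k) (U k)) (sym (heights k))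
          (ℕ.+-monoˡ-< (U k) U<V)))

    -- Two west steps put the least box labelled k + 1 of `Θ d` before all boxes labelled k; two
    -- south steps put the least box labelled k of `Θ d′` before all boxes labelled k + 1.
    consistent : ∀ k → U (suc k) ≡ U k → V (suc k) ≡ V k → U k < V k →
                 U′ (suc k) ≡ suc (U′ k) → ¬ (V′ (suc k) ≡ suc (V′ k))
    consistent k U→ V→ U<V U↓′ _ = no-reversal equivalent (ℕ.1+n≢n ∘ ℤ.+-injective)
      (E.next∈ U→ V→) (ω-point 0ℤ (suc k , U k)) (E.next-least U→)
      E′.least∈ (ω-point 0ℤ (k , U′ k)) (E′.least-along U↓′)
      where
      module E = Extreme (Θ-presents d) k U<V
      module E′ = Extreme (Θ-presents d′) k (to U<V⇔U′<V′ U<V)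

    -- Monotonicity is given for `f` only, so this does not come from inverting the equivalence, but
    -- from `no-reversal` with the two labels exchanged.
    consistent′ : ∀ k → U′ (suc k) ≡ U′ k → V′ (suc k) ≡ V′ k → U′ k < V′ k →
                  U (suc k) ≡ suc (U k) → ¬ (V (suc k) ≡ suc (V k))
    consistent′ k U→′ V→′ U<V′ U↓ _ = no-reversal equivalent (ℕ.1+n≢n ∘ sym ∘ ℤ.+-injective)
      E.least∈ (ω-point 0ℤ (k , U k)) (E.least-along U↓)
      (E′.next∈ U→′ V→′) (ω-point 0ℤ (suc k , U′ k)) (E′.next-least U→′)
      where
      module E = Extreme (Θ-presents d) k (from U<V⇔U′<V′ U<V′)
      module E′ = Extreme (Θ-presents d′) k U<V′

  BJS⇒≈ : d ≈ d′
  BJS⇒≈ = north-opens⇔⇒≈ {d = d} {d′}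
    (λ j → ⇔-trans (north-opens (traces d) j) (⇔-trans
      (mk⇔ (transfer-opens (profile d) (profile d′) (heights _) (heights _) (consistent _))
           (transfer-opens (profile d′) (profile d) (sym (heights _)) (sym (heights _))
             (consistent′ _)))
      (⇔-sym (north-opens (traces d′) j))))
    (λ j → ⇔-trans (south-closes (traces d) j) (⇔-trans
      (mk⇔ (transfer-closes (profile d) (profile d′) (heights _) (heights _) (consistent _))
           (transfer-closes (profile d′) (profile d) (sym (heights _)) (sym (heights _))
             (consistent′ _)))
      (⇔-sym (south-closes (traces d′) j))))

-- Reading words

row-length : ∀ l {r} → 0 < row l r → r < length l
row-length (_ ∷ _) {zero}  _  = s≤s z≤n
row-length (_ ∷ l) {suc r} 0< = s≤s (row-length l 0<)

infix 4 _⋢_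

-- Mind the direction: the second cell is not weakly northwest of the first, as a linear extension
-- demands of a later cell.
_⋢_ : ℕ × ℕ → ℕ × ℕ → Set
(r , c) ⋢ (r′ , c′) = ¬ (r′ ≤ r × c′ ≤ c)

allPairs-map-∈ : ∀ {A : Set} {R R′ : A → A → Set} {xs} →
    (∀ {x y} → x ∈ xs → y ∈ xs → R x y → R′ x y) →
                 AllPairs R xs → AllPairs R′ xs
allPairs-map-∈ R⇒R′ []       = []
allPairs-map-∈ R⇒R′ (x ∷ xs) = All.tabulate (λ y∈ → R⇒R′ (here refl) (there y∈) (All.lookup x y∈)) ∷
  allPairs-map-∈ (λ x∈ y∈ → R⇒R′ (there x∈) (there y∈)) xs

allPairs-cartesianProduct : ∀ {A B : Set} {R : A × B → A × B → Set} {xs ys} →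
  AllPairs (λ x x′ → ∀ y y′ → R (x , y) (x′ , y′)) xs →
    AllPairs (λ y y′ → ∀ x → R (x , y) (x , y′)) ys →
  AllPairs R (cartesianProduct xs ys)
allPairs-cartesianProduct []       ys = []
allPairs-cartesianProduct {R = R} {x ∷ xs} {ys} (x< ∷ xs<) ys< = AllPairs.++⁺
  (AllPairs.map⁺ (AllPairs.map (λ R → R x) ys<)) (allPairs-cartesianProduct xs< ys<)
  (All.tabulate λ u∈ → All.tabulate λ v∈ → later u∈ v∈)
  where
  later : ∀ {u v} → u ∈ map (x ,_) ys → v ∈ cartesianProduct xs ys → R u v
  later u∈ v∈ with y , _ , refl ← ∈-map⁻ (x ,_) u∈ =
    All.lookup x< (proj₁ (∈-cartesianProduct⁻ xs ys v∈)) y _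

module _ (T : SkewShape) where

  private
    height = length (parts (λ′ T))
    breadth = row (parts (λ′ T)) 0

  cellsByRow cellsByColumn : List (ℕ × ℕ)
  cellsByRow    = filter (cell? T) (cartesianProduct (upTo height) (upTo breadth))
  cellsByColumn = filter (cell? T) (map swap (cartesianProduct (upTo breadth) (upTo height)))

  private
    upTo-increasing : ∀ m → AllPairs _<_ (upTo m)
    upTo-increasing m = AllPairs.applyUpTo⁺₁ (λ i → i) m (λ i<j _ → i<j)

  cellsByRow-ordered : AllPairs _⋢_ cellsByRow
  cellsByRow-ordered = AllPairs.filter⁺ (cell? T) (allPairs-cartesianProduct
    (AllPairs.map (λ r<r′ _ _ (r′≤r , _) → ℕ.<⇒≱ r<r′ r′≤r) (upTo-increasing height))
    (AllPairs.map (λ c<c′ _ (_ , c′≤c) → ℕ.<⇒≱ c<c′ c′≤c) (upTo-increasing breadth)))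

  cellsByColumn-ordered : AllPairs _⋢_ cellsByColumn
  cellsByColumn-ordered = AllPairs.filter⁺ (cell? T) (AllPairs.map⁺ (allPairs-cartesianProduct
    (AllPairs.map (λ c<c′ _ _ (_ , c′≤c) → ℕ.<⇒≱ c<c′ c′≤c) (upTo-increasing breadth))
    (AllPairs.map (λ r<r′ _ (r′≤r , _) → ℕ.<⇒≱ r<r′ r′≤r) (upTo-increasing height))))

  private
    cell-bounds : ∀ {r c} → Cell T (r , c) → r < height × c < breadth
    cell-bounds {r} (_ , c<λ) = row-length (parts (λ′ T)) (ℕ.≤-trans (s≤s z≤n) c<λ) ,
      ℕ.<-≤-trans c<λ (row≤row₀ (parts (λ′ T)) (decreasing (λ′ T)) r)

  ∈-cellsByRow : ∀ {rc} → rc ∈ cellsByRow ⇔ Cell T rc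
  ∈-cellsByRow = mk⇔ (λ rc∈ → proj₂
    (∈-filter⁻ (cell? T) {xs = cartesianProduct (upTo height) (upTo breadth)} rc∈))
    (λ cell → let r< , c< = cell-bounds cell
              in ∈-filter⁺ (cell? T) (∈-cartesianProduct⁺ (∈-upTo⁺ r<) (∈-upTo⁺ c<)) cell)

  ∈-cellsByColumn : ∀ {rc} → rc ∈ cellsByColumn ⇔ Cell T rc
  ∈-cellsByColumn = mk⇔ (λ rc∈ →
    proj₂ (∈-filter⁻ (cell? T) {xs = map swap (cartesianProduct (upTo breadth) (upTo height))} rc∈))
    (λ cell → let r< , c< = cell-bounds cell
              in ∈-filter⁺ (cell? T) (∈-map⁺ swap (∈-cartesianProduct⁺ (∈-upTo⁺ c<) (∈-upTo⁺ r<)))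
                cell)

  label : ℕ × ℕ → ℕ
  label rc = ℤ.∣ ω (corner T rc) ∣

  module _ {U V : ℕ → ℕ} (p : Profile n U V) (presents : Presents T (proj₁ (origin T)) U V)
           (cells : List (ℕ × ℕ)) (ordered : AllPairs _⋢_ cells)
               (enumerates : ∀ {rc} → rc ∈ cells ⇔ Cell T rc) where

    private
      o = proj₁ (origin T)

      labelled : ℕ × ℕ → ℕ × ℕ
      labelled (r , c) = label (r , c) , r

      labelled-point : ∀ {rc} → Cell T rc →
          corner T rc ≡ point o (labelled rc) × Region U V (labelled rc)
      labelled-point {r , c} cell with (k , r′) , region , eq ← to (member presents _)
        (_ , cell , refl)
        with refl ← ℕ.suc-injective (ℤ.+-injective (∙-cancelˡ o _ _ (cong proj₁ eq)))
        with refl ← cong ℤ.∣_∣ (trans (cong ω eq) (ω-point o (k , r))) = eq , region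

      corner-≤ : ∀ {rc rc′} → corner T rc ≤ᴾ corner T rc′ →
          proj₁ rc ≤ proj₁ rc′ × proj₂ rc ≤ proj₂ rc′
      corner-≤ (x≤ , y≤) = ℕ.s≤s⁻¹ (ℤ.drop‿+≤+ (+-cancelˡ-≤ o x≤)) ,
                           ℕ.s≤s⁻¹ (ℤ.drop‿+≤+ (+-cancelˡ-≤ (proj₂ (origin T)) y≤))

      region-cell : ∀ {b} → Region U V b → ∃[ rc ] Cell T rc × labelled rc ≡ b
      region-cell {b} region with rc , cell , eq ← from (member presents _) (b , region , refl) =
        rc , cell , point-injective o _ _ (trans (sym (proj₁ (labelled-point cell))) (sym eq))

    -- Readings by rows and by columns are treated at once, as listings in which no cell follows one
    -- weakly southeast of it.
    cells-read : ∃[ D ] Reads {n} (map label cells) D × Traces D U V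
    cells-read = subst (λ w → ∃[ D ] Reads w D × Traces D U V) (sym (map-∘ cells))
      (reading (map labelled cells) p
        (AllPairs.map⁺ (allPairs-map-∈
          (λ rc∈ rc′∈ later below → later (corner-≤ (subst₂ _≤ᴾ_
            (sym (proj₁ (labelled-point (to enumerates rc′∈))))
              (sym (proj₁ (labelled-point (to enumerates rc∈))))
            (to (⊑⇔≤ᴾ o _ _) below)))) ordered))
        (mk⇔ (λ b∈ → case ∈-map⁻ labelled b∈ of λ { (rc , rc∈ , refl) →
          proj₂ (labelled-point (to enumerates rc∈)) })
             (λ region → case region-cell region of λ { (rc , cell , refl) →
                 ∈-map⁺ labelled (from enumerates cell) })))

Θ-labels : (d : Diagram n) → LabelsBelow n (Θ d)
Θ-labels {n} d q q∈ with b , region , refl ← to (member (Θ-presents d) q) q∈ =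
  subst (λ z → 0ℤ ℤ.< z × z ℤ.< + n) (sym (ω-point 0ℤ b))
    (ℤ.+<+ (region-label>0 (profile d) region) , ℤ.+<+ (region-label< (profile d) region))

traces-resp-≈ : ∀ {d d′ : Diagram n} {U V} → d ≈ d′ → Traces d′ U V → Traces d U V
traces-resp-≈ d≈d′ t = record
  { north-opens  = λ j → subst (λ v → (¬ ArrivesFrom v (north j)) ⇔ _) (sym (d≈d′ (north j)))
    (north-opens t j)
  ; south-closes = λ j → subst (λ v → ArrivesFrom v (south j) ⇔ _) (sym (d≈d′ (south j)))
    (south-closes t j)
  ; through      = λ j U≡V U≡V′ → trans (d≈d′ (north j)) (through t j U≡V U≡V′)
  }

Θ-congruent : {d d′ : Diagram n} → d ≈ d′ → BJSEquivalent (Θ d) (Θ d′)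
Θ-congruent {d = d} {d′} d≈d′ =
  traces⇒BJS {d = d} {T = Θ d′} (profile d′) (traces-resp-≈ {d = d} {d′} d≈d′ (traces d′))
    (Θ-presents d′)

-- The preimage of the class of `T` is the diagram that the row reading of `T` spells.
traced : ∀ T → LabelsBelow n T → ∃[ D ] Traces {n} D (upperBoundary T) (lowerBoundary T)
traced T below = Product.map₂ proj₂
  (cells-read T (boundary-profile T below) (boundary-presents T below)
  (cellsByRow T) (cellsByRow-ordered T) (∈-cellsByRow T))

Θ-hits : ∀ T → LabelsBelow n T → (D : Diagram n) → Traces D (upperBoundary T) (lowerBoundary T) →
         ∀ {d} → d ≈ D → BJSEquivalent (Θ d) T
Θ-hits T below D D-traces {d} d≈D =
  traces⇒BJS {d = d} {T = T} (boundary-profile T below) (traces-resp-≈ {d = d} {D} d≈D D-traces)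
    (boundary-presents T below)

Θ-bijection : InducesBijection {n} Θ
Θ-bijection = Θ-labels , (λ {d} {d′} → Θ-congruent {d = d} {d′}) , (λ {d} {d′} → BJS⇒≈ {d = d} {d′})
  ,
  λ (T , below) → let D , D-traces = traced T below in D , λ {d} d≈D → Θ-hits T below D D-traces {d} d≈D

-- Words evaluated in the Temperley-Lieb algebra

module _ {c ℓ : Level} (𝕜 : CommutativeRing c ℓ) (δ : CommutativeRing.Carrier 𝕜) where

  open TemperleyLieb 𝕜 δ
  open CommutativeRing 𝕜 using (0#; 1#; *-identityʳ) renaming
    (sym to ≈-sym; trans to ≈-trans; reflexive to ≡⇒≈; _+_ to _+𝕜_)

  reads⇒evaluates : ∀ {w} {D : Diagram n} → Reads w D → Evaluates (map +_ w) ⟨ D ⟩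
  reads⇒evaluates []                           = empty
  reads⇒evaluates (prefix 0<i i<n product reads) = cons 0<i i<n (reads⇒evaluates reads)
    -- Without loops the coefficient is (1 * 1) * δ ^ 0.
    ((0 , product , ≈-sym (≈-trans (*-identityʳ _) (*-identityʳ _))) ∷ [])

  ≈⇒≋ : {D D′ : Diagram n} → D ≈ D′ → ⟨ D ⟩ ≋ ⟨ D′ ⟩
  ≈⇒≋ {D = D} {D′} D≈D′ X = ≡⇒≈ (cong (if_then 1# +𝕜 0# else 0#) (does-⇔ same (D ≈? X) (D′ ≈? X)))
    where
    same : D ≈ X ⇔ D′ ≈ X
    same = mk⇔ (λ D≈X v → trans (sym (D≈D′ v)) (D≈X v)) (λ D′≈X v → trans (D≈D′ v) (D′≈X v))

  reads⇒equals : ∀ {w} {D d : Diagram n} → Reads w D → D ≈ d → map +_ w Equals d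
  reads⇒equals {D = D} {d} reads D≈d = ⟨ D ⟩ , reads⇒evaluates reads , ≈⇒≋ {D = D} {d} D≈d

  -- The diagram spelled by the cells and `d` trace the same pair of paths, so they have the same
  -- closing vertices.
  cells-equal : (d : Diagram n) (cells : List (ℕ × ℕ)) → AllPairs _⋢_ cells →
      (∀ {rc} → rc ∈ cells ⇔ Cell (Θ d) rc) →
                map +_ (map (label (Θ d)) cells) Equals d
  cells-equal d cells ordered enumerates =
    let D , reads , D-traces = cells-read (Θ d) (profile d) (Θ-presents d) cells ordered enumerates
    in reads⇒equals {D = D} {d} reads (traces-unique {d = D} {d} D-traces (traces d))

sorted-unique : ∀ {xs ys} → AllPairs _<_ xs → AllPairs _<_ ys → (∀ {i} → i ∈ xs ⇔ i ∈ ys) → xs ≡ ys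
sorted-unique [] [] _ = refl
sorted-unique [] (_ ∷ _) same = case from same (here refl) of λ ()
sorted-unique (_ ∷ _) [] same = case to same (here refl) of λ ()
sorted-unique {x ∷ xs} {y ∷ ys} (x< ∷ xs<) (y< ∷ ys<) same =
  cong₂ _∷_ x≡y (sorted-unique xs< ys< (mk⇔ forth back))
  where
  x≡y : x ≡ y
  x≡y with to same (here refl) | from same (here refl)
  ... | here eq  | _        = eq
  ... | there _  | here eq  = sym eq
  ... | there x∈ | there y∈ = contradiction (All.lookup x< y∈) (ℕ.<-asym (All.lookup y< x∈))

  forth : ∀ {i} → i ∈ xs → i ∈ ys
  forth i∈ with to same (there i∈)
  ... | here refl = contradiction (All.lookup x< i∈) (ℕ.<-irrefl x≡y)
  ... | there i∈′ = i∈′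

  back : ∀ {i} → i ∈ ys → i ∈ xs
  back i∈ with from same (there i∈)
  ... | here refl = contradiction (All.lookup y< i∈) (ℕ.<-irrefl (sym x≡y))
  ... | there i∈′ = i∈′

filter-interval : ∀ {P : ℕ → Set} (P? : Unary.Decidable P) {lo hi m} → hi ≤ m →
    (∀ {i} → P i ⇔ (lo ≤ i × i < hi)) →
                  filter P? (upTo m) ≡ applyUpTo (λ i → lo + i) (hi ∸ lo)
filter-interval P? {lo} {hi} {m} hi≤m interval = sorted-unique
  (AllPairs.filter⁺ P? (AllPairs.applyUpTo⁺₁ (λ i → i) m λ i<j _ → i<j))
  (AllPairs.applyUpTo⁺₁ (λ i → lo + i) (hi ∸ lo) λ i<j _ → ℕ.+-monoʳ-< lo i<j)
  (mk⇔ forth back)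
  where
  forth : ∀ {i} → i ∈ filter P? (upTo m) → i ∈ applyUpTo (λ i → lo + i) (hi ∸ lo)
  forth {i} i∈ with lo≤i , i<hi ← to interval (proj₂ (∈-filter⁻ P? {xs = upTo m} i∈)) =
    subst (_∈ applyUpTo (λ i → lo + i) (hi ∸ lo)) (ℕ.m+[n∸m]≡n lo≤i)
      (∈-applyUpTo⁺ _ (ℕ.∸-monoˡ-< i<hi lo≤i))

  back : ∀ {i} → i ∈ applyUpTo (λ i → lo + i) (hi ∸ lo) → i ∈ filter P? (upTo m)
  back i∈ with i , i< , refl ← ∈-applyUpTo⁻ _ i∈ =
    let lo+i<hi = ℕ.<-≤-trans (ℕ.+-monoʳ-< lo i<) (ℕ.≤-reflexive (ℕ.m+[n∸m]≡n {lo} {hi} (ℕ.<⇒≤ (nonempty i<))))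
    in ∈-filter⁺ P? (∈-upTo⁺ (ℕ.<-≤-trans lo+i<hi hi≤m)) (from interval (ℕ.m≤m+n lo i , lo+i<hi))
    where
    nonempty : ∀ {i} → i < hi ∸ lo → lo < hi
    nonempty i< = ℕ.≰⇒> λ hi≤lo → ℕ.<⇒≱ i< (ℕ.≤-trans (ℕ.≤-reflexive (ℕ.m≤n⇒m∸n≡0 hi≤lo)) z≤n)

-- Jones normal forms

filter-map : ∀ {A B : Set} {P : B → Set} (P? : Unary.Decidable P) (f : A → B) xs →
             filter P? (map f xs) ≡ map f (filter (P? ∘ f) xs)
filter-map P? f [] = refl
filter-map P? f (x ∷ xs) with P? (f x)
... | yes _ = cong (f x ∷_) (filter-map P? f xs)
... | no _  = filter-map P? f xs

filter-cartesianProduct : ∀ {A B : Set} {P : A × B → Set} (P? : Unary.Decidable P) xs ys →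
  filter P? (cartesianProduct xs ys) ≡ concatMap (λ x → map (x ,_) (filter (λ y → P? (x , y)) ys))
    xs
filter-cartesianProduct P? []       ys = refl
filter-cartesianProduct P? (x ∷ xs) ys =
  trans (filter-++ P? (map (x ,_) ys) (cartesianProduct xs ys))
  (cong₂ _++_ (filter-map P? (x ,_) ys) (filter-cartesianProduct P? xs ys))

concatMap-cong-local : ∀ {A B : Set} {f g : A → List B} {xs} → (∀ {x} → x ∈ xs → f x ≡ g x) →
    concatMap f xs ≡ concatMap g xs
concatMap-cong-local f≡g = cong concat (map-cong-local (All.tabulate f≡g))

concatMap-filter : ∀ {A B : Set} {P : A → Set} (P? : Unary.Decidable P) (f : A → List B) →
    (∀ {x} → ¬ P x → f x ≡ []) →
                   ∀ xs → concatMap f (filter P? xs) ≡ concatMap f xs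
concatMap-filter P? f trivial [] = refl
concatMap-filter P? f trivial (x ∷ xs) with P? x
... | yes _  = cong (f x ++_) (concatMap-filter P? f trivial xs)
... | no ¬px = trans (concatMap-filter P? f trivial xs)
      (cong (_++ concatMap f xs) (sym (trivial ¬px)))

applyUpTo-cong : ∀ {A : Set} {f g : ℕ → A} m → (∀ {i} → i < m → f i ≡ g i) →
    applyUpTo f m ≡ applyUpTo g m
applyUpTo-cong zero    f≡g = refl
applyUpTo-cong (suc m) f≡g = cong₂ _∷_ (f≡g (s≤s z≤n)) (applyUpTo-cong m (f≡g ∘ s≤s))

applyUpTo≡applyDownFrom : ∀ {A : Set} {f g : ℕ → A} m → (∀ {i} → i < m → f i ≡ g (m ∸ suc i)) →
                          applyUpTo f m ≡ applyDownFrom g m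
applyUpTo≡applyDownFrom zero    f≡g = refl
applyUpTo≡applyDownFrom (suc m) f≡g =
  cong₂ _∷_ (f≡g (s≤s z≤n)) (applyUpTo≡applyDownFrom m (f≡g ∘ s≤s))

allPairs-framed : ∀ {ℓ} {R : Rel ℕ ℓ} {x xs y} → R x y → All (R x) xs → All (λ z → R z y) xs →
    AllPairs R xs →
                  Linked R (x ∷ xs ++ [ y ])
allPairs-framed xRy xR Ry pairs = AllPairs⇒Linked
  (All.++⁺ xR (xRy ∷ []) ∷ AllPairs.++⁺ pairs ([] ∷ []) (All.map (_∷ []) Ry))

row-antitone : ∀ (p : Partition) {r r′} → r ≤ r′ → row (parts p) r′ ≤ row (parts p) r
row-antitone p r≤r′ = lemma (ℕ.≤⇒≤′ r≤r′)
  where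
  lemma : ∀ {r r′} → r ℕ.≤′ r′ → row (parts p) r′ ≤ row (parts p) r
  lemma ℕ.≤′-refl        = ℕ.≤-refl
  lemma (ℕ.≤′-step r≤r′) = ℕ.≤-trans (row-grows (parts p) (decreasing p) _) (lemma r≤r′)

-- The hypotheses make all truncated subtractions exact.

row-label : ∀ {μ i λᵣ b r} → μ ≤ λᵣ → λᵣ ≤ b → i < λᵣ ∸ μ →
    b + r ∸ (μ + i) ≡ b + suc r ∸ λᵣ + (λᵣ ∸ μ ∸ suc i)
row-label {μ} {i} {λᵣ} {b} {r} μ≤λ λ≤b i< with λᵣ ∸ μ | ℕ.m+[n∸m]≡n μ≤λ | i<
... | l | refl | i<l with e , refl ← ℕ.m≤n⇒∃[o]m+o≡n i<l | f , refl ← ℕ.m≤n⇒∃[o]m+o≡n λ≤b = begin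
  μ + (suc i + e) + f + r ∸ (μ + i)
    ≡⟨ cong (_∸ (μ + i)) (regroup μ i e f r) ⟩
  μ + i + (f + suc r + e) ∸ (μ + i)
    ≡⟨ ℕ.m+n∸m≡n (μ + i) _ ⟩
  f + suc r + e
    ≡⟨ cong₂ _+_ (ℕ.m+n∸m≡n (μ + (suc i + e)) (f + suc r)) (ℕ.m+n∸m≡n (suc i) e) ⟨
  μ + (suc i + e) + (f + suc r) ∸ (μ + (suc i + e)) + (suc i + e ∸ suc i)
    ≡⟨ cong (λ z → z ∸ (μ + (suc i + e)) + (suc i + e ∸ suc i))
      (ℕ.+-assoc (μ + (suc i + e)) f (suc r)) ⟨
  μ + (suc i + e) + f + suc r ∸ (μ + (suc i + e)) + (suc i + e ∸ suc i)
    ∎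
  where
  open ≡-Reasoning
  regroup : ∀ μ i e f r → μ + (suc i + e) + f + r ≡ μ + i + (f + suc r + e)
  regroup = ℕ-Solver.solve-∀

row-run-length : ∀ {μ λᵣ b r} → μ ≤ λᵣ → λᵣ ≤ b → λᵣ ∸ μ ≡ suc (b + r ∸ μ) ∸ (b + suc r ∸ λᵣ)
row-run-length {μ} {_} {_} {r} μ≤λ λ≤b
  with l , refl ← ℕ.m≤n⇒∃[o]m+o≡n μ≤λ | f , refl ← ℕ.m≤n⇒∃[o]m+o≡n λ≤b = begin
  μ + l ∸ μ
    ≡⟨ ℕ.m+n∸m≡n μ l ⟩
  l
    ≡⟨ ℕ.m+n∸m≡n (f + suc r) l ⟨
  f + suc r + l ∸ (f + suc r)
    ≡⟨ cong (_∸ (f + suc r)) (regroup f r l) ⟩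
  suc (l + f + r) ∸ (f + suc r)
    ≡⟨ cong₂ (λ x y → suc x ∸ y) (ℕ.m+n∸m≡n μ (l + f + r)) (ℕ.m+n∸m≡n (μ + l) (f + suc r)) ⟨
  suc (μ + (l + f + r) ∸ μ) ∸ (μ + l + (f + suc r) ∸ (μ + l))
    ≡⟨ cong₂ (λ x y → suc (x ∸ μ) ∸ (y ∸ (μ + l))) (regroup′ μ l f r)
      (sym (ℕ.+-assoc (μ + l) f (suc r))) ⟩
  suc (μ + l + f + r ∸ μ) ∸ (μ + l + f + suc r ∸ (μ + l))
    ∎
  where
  open ≡-Reasoning
  regroup : ∀ f r l → f + suc r + l ≡ suc (l + f + r)
  regroup = ℕ-Solver.solve-∀
  regroup′ : ∀ μ l f r → μ + (l + f + r) ≡ μ + l + f + r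
  regroup′ = ℕ-Solver.solve-∀

column-label : ∀ {b c lo i} → c ≤ b → b + (lo + i) ∸ c ≡ b + lo ∸ c + i
column-label {b} {c} {lo} {i} c≤b = trans (cong (_∸ c) (sym (ℕ.+-assoc b lo i)))
  (ℕ.+-∸-comm i (ℕ.≤-trans c≤b (ℕ.m≤m+n b lo)))

column-run-length : ∀ {b c lo hi} → c < b → hi ∸ lo ≡ suc (b + hi ∸ suc c) ∸ (b + lo ∸ c)
column-run-length {_} {c} {lo} {hi} c<b with f , refl ← ℕ.m≤n⇒∃[o]m+o≡n c<b = begin
  hi ∸ lo
    ≡⟨ ℕ.[m+n]∸[m+o]≡n∸o (suc f) hi lo ⟨
  suc f + hi ∸ (suc f + lo)
    ≡⟨ cong₂ (λ x y → suc x ∸ y) (ℕ.m+n∸m≡n (suc c) (f + hi)) (ℕ.m+n∸m≡n c (suc f + lo)) ⟨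
  suc (suc c + (f + hi) ∸ suc c) ∸ (c + (suc f + lo) ∸ c)
    ≡⟨ cong₂ (λ x y → suc (x ∸ suc c) ∸ (y ∸ c)) (sym (ℕ.+-assoc (suc c) f hi)) (regroup c f lo) ⟩
  suc (suc c + f + hi ∸ suc c) ∸ (suc c + f + lo ∸ c)
    ∎
  where
  open ≡-Reasoning
  regroup : ∀ c f lo → c + (suc f + lo) ≡ suc c + f + lo
  regroup = ℕ-Solver.solve-∀

module _ (d : Diagram n) where

  private
    b = width d
    Λ = youngDiagram (lowerPath d)
    M = youngDiagram (upperPath d)
    λ-row = row (parts Λ)
    μ-row = row (parts M)
    height = length (parts Λ)
    breadth = λ-row 0

    λ≤b : ∀ r → λ-row r ≤ b
    λ≤b = row≤westSteps (lowerPath d)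

    μ≤λ : ∀ r → μ-row r ≤ λ-row r
    μ≤λ = μ⊆λ (Θ d)

    label≡ : ∀ {r c} → c ≤ b → label (Θ d) (r , c) ≡ b + r ∸ c
    label≡ {r} {c} c≤b = cong ℤ.∣_∣
      (trans (cong ω (corner≡point {b = b} (ℕ.m+[n∸m]≡n (ℕ.≤-trans c≤b (ℕ.m≤m+n b r)))))
      (ω-point 0ℤ (b + r ∸ c , r)))

    cell-label : ∀ {r c} → Cell (Θ d) (r , c) → b + r ∸ c < n
    cell-label {r} {c} cell = subst (_< n) (label≡ (ℕ.≤-trans (ℕ.<⇒≤ (proj₂ cell)) (λ≤b r)))
      (ℤ.drop‿+<+ (subst (ℤ._< + n) (sym (ℤ.0≤i⇒+∣i∣≡i (ℤ.<⇒≤ (proj₁ labels)))) (proj₂ labels)))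
      where labels = Θ-labels d _ (_ , cell , refl)

    integral : ∀ {cells} → (∀ {rc} → rc ∈ cells ⇔ Cell (Θ d) rc) →
               map (λ rc → ω (corner (Θ d) rc)) cells ≡ map (+_ ∘ label (Θ d)) cells
    integral enumerates = map-cong-local (All.tabulate λ rc∈ →
      sym (ℤ.0≤i⇒+∣i∣≡i (ℤ.<⇒≤ (proj₁ (Θ-labels d _ (_ , to enumerates rc∈ , refl))))))

    -- The labels of the first and the last cell of row r. In an empty row the second number exceeds
    -- the first by one.
    rowRun : ℕ → ℕ × ℕ
    rowRun r = b + r ∸ μ-row r , b + suc r ∸ λ-row r

    row-labels : ∀ r → map (label (Θ d))
        (map (r ,_) (filter (λ c → cell? (Θ d) (r , c)) (upTo breadth))) ≡ descending (rowRun r)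
    row-labels r = begin
      map (label (Θ d)) (map (r ,_) (filter (λ c → cell? (Θ d) (r , c)) (upTo breadth)))
        ≡⟨ cong (map (label (Θ d)) ∘ map (r ,_))
          (filter-interval (λ c → cell? (Θ d) (r , c)) (row-antitone Λ {0} z≤n)
            (mk⇔ (λ x → x) (λ x → x))) ⟩
      map (label (Θ d)) (map (r ,_) (applyUpTo (λ i → μ-row r + i) (λ-row r ∸ μ-row r)))
        ≡⟨ trans (cong (map (label (Θ d))) (map-applyUpTo (λ i → μ-row r + i) (r ,_) len))
          (map-applyUpTo (λ i → r , μ-row r + i) (label (Θ d)) len) ⟩
      applyUpTo (λ i → label (Θ d) (r , μ-row r + i)) len
        ≡⟨ applyUpTo≡applyDownFrom len
          (λ {i} i<len → trans (label≡ {r} (ℕ.≤-trans (bounded i<len) (λ≤b r)))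
              (row-label (μ≤λ r) (λ≤b r) i<len)) ⟩
      applyDownFrom (λ i → b + suc r ∸ λ-row r + i) len
        ≡⟨ cong (applyDownFrom (λ i → b + suc r ∸ λ-row r + i)) (row-run-length (μ≤λ r) (λ≤b r)) ⟩
      descending (rowRun r)
        ∎
      where
      open ≡-Reasoning
      len = λ-row r ∸ μ-row r
      bounded : ∀ {i} → i < len → μ-row r + i ≤ λ-row r
      bounded i<len = ℕ.≤-trans (ℕ.+-monoʳ-≤ (μ-row r) (ℕ.<⇒≤ i<len))
        (ℕ.≤-reflexive (ℕ.m+[n∸m]≡n (μ≤λ r)))

    -- Empty rows between nonempty ones must be dropped, since a normal form has no empty factors;
    -- the word does not change, `descending` being empty on them.
    rowRuns : List (ℕ × ℕ)
    rowRuns = filter (λ (j , k) → k ℕ.≤? j) (map rowRun (upTo height))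

    cellsByRow-labels : map (label (Θ d)) (cellsByRow (Θ d)) ≡ concatMap descending rowRuns
    cellsByRow-labels = begin
      map (label (Θ d)) (cellsByRow (Θ d))
        ≡⟨ cong (map (label (Θ d))) (filter-cartesianProduct (cell? (Θ d)) (upTo height)
          (upTo breadth)) ⟩
      map (label (Θ d)) (concatMap (λ r →
        map (r ,_) (filter (λ c → cell? (Θ d) (r , c)) (upTo breadth))) (upTo height))
        ≡⟨ map-concatMap (label (Θ d)) _ (upTo height) ⟩
      concatMap (λ r → map (label (Θ d))
        (map (r ,_) (filter (λ c → cell? (Θ d) (r , c)) (upTo breadth)))) (upTo height)
        ≡⟨ concatMap-cong-local {xs = upTo height} (λ {r} _ → row-labels r) ⟩
      concatMap (descending ∘ rowRun) (upTo height)
        ≡⟨ concatMap-map descending rowRun (upTo height) ⟨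
      concatMap descending (map rowRun (upTo height))
        ≡⟨ concatMap-filter (λ (j , k) → k ℕ.≤? j) descending
          (λ k≰j → cong (applyDownFrom _) (ℕ.m≤n⇒m∸n≡0 (ℕ.≰⇒> k≰j))) (map rowRun (upTo height)) ⟨
      concatMap descending rowRuns
        ∎
      where open ≡-Reasoning

    rowRun-bounds : ∀ r → proj₂ (rowRun r) ≤ proj₁ (rowRun r) →
        0 < proj₂ (rowRun r) × proj₁ (rowRun r) < n
    rowRun-bounds r k≤j = ℕ.m<n⇒0<n∸m
      (ℕ.≤-<-trans (λ≤b r) (ℕ.≤-trans (ℕ.m≤n+m (suc b) r)
        (ℕ.≤-reflexive (trans (ℕ.+-comm r (suc b)) (sym (ℕ.+-suc b r)))))) ,
      -- The first label is below n as the label of an actual cell: if μ reached the end of the row,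
      -- then k would exceed j.
      cell-label (ℕ.≤-refl , ℕ.≰⇒> λ λ≤μ → ℕ.<⇒≱ (ℕ.<-≤-trans
        (ℕ.∸-monoˡ-< (ℕ.+-monoʳ-< b (ℕ.n<1+n r))
          (ℕ.≤-trans (ℕ.≤-trans (μ≤λ r) (λ≤b r)) (ℕ.m≤m+n b r)))
        (ℕ.∸-monoʳ-≤ (b + suc r) λ≤μ)) k≤j)

    -- The row index grows while the row length does not. With s = 0 this applies to the first
    -- labels and with s = 1 to the last.
    runs-increase : ∀ (p : Partition) → (∀ r → row (parts p) r ≤ b) → ∀ s {r r′} → r < r′ →
                    b + (s + r) ∸ row (parts p) r < b + (s + r′) ∸ row (parts p) r′
    runs-increase p ≤b s {r} {r′} r<r′ = ℕ.≤-<-trans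
      (ℕ.∸-monoʳ-≤ (b + (s + r)) (row-antitone p (ℕ.<⇒≤ r<r′)))
      (ℕ.∸-monoˡ-< (ℕ.+-monoʳ-< b (ℕ.+-monoʳ-< s r<r′)) (ℕ.≤-trans (≤b r′) (ℕ.m≤m+n b _)))

    rowRuns-bounded : All (λ (j , k) → 0 < k × k ≤ j × j < n) rowRuns
    rowRuns-bounded = All.tabulate λ jk∈ →
      bounded (∈-filter⁻ (λ (j , k) → k ℕ.≤? j) {xs = map rowRun (upTo height)} jk∈)
      where
      bounded : ∀ {jk} → jk ∈ map rowRun (upTo height) × proj₂ jk ≤ proj₁ jk →
          0 < proj₂ jk × proj₂ jk ≤ proj₁ jk × proj₁ jk < n
      bounded (jk∈ , k≤j) with r , _ , refl ← ∈-map⁻ rowRun jk∈ = let 0<k , j<n = rowRun-bounds r k≤j in 0<k , k≤j , j<n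

    rowRuns-increasing : AllPairs (λ jk jk′ → proj₁ jk < proj₁ jk′ × proj₂ jk < proj₂ jk′) rowRuns
    rowRuns-increasing = AllPairs.filter⁺ (λ (j , k) → k ℕ.≤? j)
      (AllPairs.map⁺ (AllPairs.applyUpTo⁺₁ (λ r → r) height
      λ r<r′ _ → runs-increase M (λ r → ℕ.≤-trans (μ≤λ r) (λ≤b r)) 0 r<r′ , runs-increase Λ λ≤b 1
        r<r′))

  rowReading-labels : rowReading (Θ d) ≡ map +_ (map (label (Θ d)) (cellsByRow (Θ d)))
  rowReading-labels = trans (integral (∈-cellsByRow (Θ d))) (map-∘ (cellsByRow (Θ d)))

  rowReading-normal : 1 ≤ n → JonesNormal n (rowReading (Θ d))
  rowReading-normal 0<n = rowRuns ,
    -- When there are no runs, the frame around them reduces to 0 < n.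
    allPairs-framed 0<n
      (All.map⁺ (All.map (λ (0<k , k≤j , _) → ℕ.<-≤-trans 0<k k≤j) rowRuns-bounded))
      (All.map⁺ (All.map (λ (_ , _ , j<n) → j<n) rowRuns-bounded))
      (AllPairs.map⁺ (AllPairs.map proj₁ rowRuns-increasing)) ,
    allPairs-framed 0<n
      (All.map⁺ (All.map (λ (0<k , _) → 0<k) rowRuns-bounded))
      (All.map⁺ (All.map (λ (_ , k≤j , j<n) → ℕ.≤-<-trans k≤j j<n) rowRuns-bounded))
      (AllPairs.map⁺ (AllPairs.map proj₂ rowRuns-increasing)) ,
    All.map (λ (_ , k≤j , _) → k≤j) rowRuns-bounded ,
    trans rowReading-labels (cong (λ w → map +_ w) cellsByRow-labels)

  private
    module _ (c : ℕ) where

      open Threshold (λ r → c ℕ.<? λ-row r) using () renaming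
        (threshold to λ-threshold; threshold≤ to λ-threshold≤; <threshold⇒P to <λ-threshold⇒;
          P⇒<threshold to ⇒<λ-threshold)
      open Threshold (λ r → c ℕ.<? μ-row r) using () renaming
        (threshold to μ-threshold; <threshold⇒P to <μ-threshold⇒; P⇒<threshold to ⇒<μ-threshold)

      -- The parts with index c of the conjugate partitions.
      λ-column μ-column : ℕ
      λ-column = λ-threshold height
      μ-column = μ-threshold height

      λ-column≤height : λ-column ≤ height
      λ-column≤height = λ-threshold≤ height

      <λ-column : ∀ {r} → r < λ-column ⇔ c < λ-row r
      <λ-column = mk⇔ (<λ-threshold⇒
        (λ c<λ → ℕ.<-≤-trans c<λ (row-grows (parts Λ) (decreasing Λ) _)) height)
        (λ c<λ → ⇒<λ-threshold (λ c<λ → ℕ.<-≤-trans c<λ (row-grows (parts Λ) (decreasing Λ) _))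
            height
          (row-length (parts Λ) (ℕ.≤-trans (s≤s z≤n) c<λ)) c<λ)

      <μ-column : ∀ {r} → r < μ-column ⇔ c < μ-row r
      <μ-column = mk⇔ (<μ-threshold⇒
        (λ c<μ → ℕ.<-≤-trans c<μ (row-grows (parts M) (decreasing M) _)) height)
        (λ c<μ → ⇒<μ-threshold (λ c<μ → ℕ.<-≤-trans c<μ (row-grows (parts M) (decreasing M) _))
            height
          (row-length (parts Λ) (ℕ.≤-trans (s≤s z≤n) (ℕ.<-≤-trans c<μ (μ≤λ _)))) c<μ)

      cell⇔column : ∀ {r} → Cell (Θ d) (r , c) ⇔ (μ-column ≤ r × r < λ-column)
      cell⇔column = mk⇔
        (λ (μ≤c , c<λ) → ℕ.≮⇒≥ (λ r<μ → ℕ.<⇒≱ (to <μ-column r<μ) μ≤c) , from <λ-column c<λ)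
        (λ (μ≤r , r<λ) → ℕ.≮⇒≥ (λ c<μ → ℕ.<⇒≱ (from <μ-column c<μ) μ≤r) , to <λ-column r<λ)

      -- The labels of the top and the bottom cell of column c, the bottom one lying in row
      -- `λ-column` - 1.
      columnRun : ℕ × ℕ
      columnRun = b + μ-column ∸ c , b + λ-column ∸ suc c

      column-labels : c < b → map (label (Θ d))
          (map swap (map (c ,_) (filter (λ r → cell? (Θ d) (r , c)) (upTo height)))) ≡ ascending
            columnRun
      column-labels c<b = begin
        map (label (Θ d)) (map swap (map (c ,_) (filter (λ r → cell? (Θ d) (r , c)) (upTo height))))
          ≡⟨ trans (sym (map-∘ _)) (sym (map-∘ _)) ⟩
        map (λ r → label (Θ d) (r , c)) (filter (λ r → cell? (Θ d) (r , c)) (upTo height))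
          ≡⟨ cong (map (λ r → label (Θ d) (r , c)))
            (filter-interval (λ r → cell? (Θ d) (r , c)) λ-column≤height cell⇔column) ⟩
        map (λ r → label (Θ d) (r , c)) (applyUpTo (λ i → μ-column + i) len)
          ≡⟨ map-applyUpTo (λ i → μ-column + i) (λ r → label (Θ d) (r , c)) len ⟩
        applyUpTo (λ i → label (Θ d) (μ-column + i , c)) len
          ≡⟨ applyUpTo-cong len (λ {i} _ → trans (label≡ {μ-column + i} (ℕ.<⇒≤ c<b))
            (column-label {lo = μ-column} (ℕ.<⇒≤ c<b))) ⟩
        applyUpTo (λ i → b + μ-column ∸ c + i) len
          ≡⟨ cong (applyUpTo (λ i → b + μ-column ∸ c + i)) (column-run-length {lo = μ-column} c<b) ⟩
        ascending columnRun
          ∎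
        where
        open ≡-Reasoning
        len = λ-column ∸ μ-column

      columnRun-bounds : c < b → proj₁ columnRun ≤ proj₂ columnRun →
          0 < proj₁ columnRun × proj₂ columnRun < n
      columnRun-bounds c<b a≤b′ = ℕ.m<n⇒0<n∸m (ℕ.<-≤-trans c<b (ℕ.m≤m+n b _)) , below λ-column refl
        where
        nonempty : μ-column < λ-column
        nonempty = ℕ.≰⇒> λ λ≤μ → ℕ.<⇒≱ (ℕ.<-≤-trans
          (ℕ.∸-monoʳ-< (ℕ.n<1+n c) (ℕ.≤-trans c<b (ℕ.m≤m+n b _)))
          (ℕ.∸-monoˡ-≤ c (ℕ.+-monoʳ-≤ b λ≤μ))) a≤b′

        -- The column length is split as suc h in order to name the row h of the bottom cell, whose
        -- label is bounded by n.
        below : ∀ hi → hi ≡ λ-column → b + hi ∸ suc c < n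
        below zero    eq = contradiction (subst (μ-column <_) (sym eq) nonempty) λ ()
        below (suc h) eq = subst (_< n) (cong (_∸ suc c) (sym (ℕ.+-suc b h)))
          (cell-label (from cell⇔column (ℕ.s≤s⁻¹ (subst (μ-column <_) (sym eq) nonempty) ,
            ℕ.≤-reflexive eq)))

    breadth≤b : breadth ≤ b
    breadth≤b = λ≤b 0

    λ-column-antitone : ∀ {c c′} → c ≤ c′ → λ-column c′ ≤ λ-column c
    λ-column-antitone {c} {c′} c≤c′ = ℕ.≮⇒≥ λ lt →
      ℕ.<-irrefl refl (from (<λ-column c) (ℕ.≤-<-trans c≤c′ (to (<λ-column c′) lt)))

    μ-column-antitone : ∀ {c c′} → c ≤ c′ → μ-column c′ ≤ μ-column c
    μ-column-antitone {c} {c′} c≤c′ = ℕ.≮⇒≥ λ lt →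
      ℕ.<-irrefl refl (from (<μ-column c) (ℕ.≤-<-trans c≤c′ (to (<μ-column c′) lt)))

    -- Further east the columns begin and end no lower, while the column index subtracted from the
    -- row becomes larger.
    runs-decrease : ∀ {lo lo′ c c′} → lo′ ≤ lo → c < c′ → c′ ≤ b → b + lo′ ∸ c′ < b + lo ∸ c
    runs-decrease {lo} {lo′} {c} {c′} lo′≤lo c<c′ c′≤b = ℕ.≤-<-trans
      (ℕ.∸-monoˡ-≤ c′ (ℕ.+-monoʳ-≤ b lo′≤lo)) (ℕ.∸-monoʳ-< c<c′ (ℕ.≤-trans c′≤b (ℕ.m≤m+n b lo)))

    columnRuns : List (ℕ × ℕ)
    columnRuns = filter (λ (a , b′) → a ℕ.≤? b′) (map columnRun (upTo breadth))

    cellsByColumn-labels : map (label (Θ d)) (cellsByColumn (Θ d)) ≡ concatMap ascending columnRuns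
    cellsByColumn-labels = begin
      map (label (Θ d)) (cellsByColumn (Θ d))
        ≡⟨ cong (map (label (Θ d))) (filter-map (cell? (Θ d)) swap
          (cartesianProduct (upTo breadth) (upTo height))) ⟩
      map (label (Θ d)) (map swap (filter (cell? (Θ d) ∘ swap)
        (cartesianProduct (upTo breadth) (upTo height))))
        ≡⟨ cong (map (label (Θ d)) ∘ map swap)
          (filter-cartesianProduct (cell? (Θ d) ∘ swap) (upTo breadth) (upTo height)) ⟩
      map (label (Θ d)) (map swap (concatMap
        (λ c → map (c ,_) (filter (λ r → cell? (Θ d) (r , c)) (upTo height))) (upTo breadth)))
        ≡⟨ trans (cong (map (label (Θ d))) (map-concatMap swap _ (upTo breadth)))
          (map-concatMap (label (Θ d)) _ (upTo breadth)) ⟩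
      concatMap (λ c → map (label (Θ d))
        (map swap (map (c ,_) (filter (λ r → cell? (Θ d) (r , c)) (upTo height))))) (upTo breadth)
        ≡⟨ concatMap-cong-local {xs = upTo breadth}
          (λ {c} c∈ → column-labels c (ℕ.<-≤-trans (∈-upTo⁻ c∈) breadth≤b)) ⟩
      concatMap (ascending ∘ columnRun) (upTo breadth)
        ≡⟨ concatMap-map ascending columnRun (upTo breadth) ⟨
      concatMap ascending (map columnRun (upTo breadth))
        ≡⟨ concatMap-filter (λ (a , b′) → a ℕ.≤? b′) ascending
          (λ a≰b′ → cong (applyUpTo _) (ℕ.m≤n⇒m∸n≡0 (ℕ.≰⇒> a≰b′))) (map columnRun (upTo breadth)) ⟨
      concatMap ascending columnRuns
        ∎
      where open ≡-Reasoning

    columnRuns-bounded : All (λ (a , b′) → 0 < a × a ≤ b′ × b′ < n) columnRuns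
    columnRuns-bounded = All.tabulate λ ab∈ →
      bounded (∈-filter⁻ (λ (a , b′) → a ℕ.≤? b′) {xs = map columnRun (upTo breadth)} ab∈)
      where
      bounded : ∀ {ab} → ab ∈ map columnRun (upTo breadth) × proj₁ ab ≤ proj₂ ab →
          0 < proj₁ ab × proj₁ ab ≤ proj₂ ab × proj₂ ab < n
      bounded (ab∈ , a≤b′) with c , c∈ , refl ← ∈-map⁻ columnRun ab∈ =
        let 0<a , b′<n = columnRun-bounds c (ℕ.<-≤-trans (∈-upTo⁻ c∈) breadth≤b) a≤b′ in 0<a , a≤b′ , b′<n

    columnRuns-decreasing : AllPairs (λ ab ab′ → proj₁ ab > proj₁ ab′ × proj₂ ab > proj₂ ab′)
        columnRuns
    columnRuns-decreasing = AllPairs.filter⁺ (λ (a , b′) → a ℕ.≤? b′)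
      (AllPairs.map⁺ (AllPairs.applyUpTo⁺₁ (λ c → c) breadth
      λ c<c′ c′<breadth → let c′<b = ℕ.<-≤-trans c′<breadth breadth≤b in
        runs-decrease (μ-column-antitone (ℕ.<⇒≤ c<c′)) c<c′ (ℕ.<⇒≤ c′<b) ,
        runs-decrease (λ-column-antitone (ℕ.<⇒≤ c<c′)) (s≤s c<c′) c′<b))

  columnReading-labels : columnReading (Θ d) ≡ map +_ (map (label (Θ d)) (cellsByColumn (Θ d)))
  columnReading-labels = trans (integral (∈-cellsByColumn (Θ d))) (map-∘ (cellsByColumn (Θ d)))

  columnReading-normal : 1 ≤ n → DualJonesNormal n (columnReading (Θ d))
  columnReading-normal 0<n = columnRuns ,
    allPairs-framed 0<n
      (All.map⁺ (All.map (λ (_ , a≤b′ , b′<n) → ℕ.≤-<-trans a≤b′ b′<n) columnRuns-bounded))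
      (All.map⁺ (All.map (λ (0<a , _) → 0<a) columnRuns-bounded))
      (AllPairs.map⁺ (AllPairs.map proj₁ columnRuns-decreasing)) ,
    allPairs-framed 0<n
      (All.map⁺ (All.map (λ (_ , _ , b′<n) → b′<n) columnRuns-bounded))
      (All.map⁺ (All.map (λ (0<a , a≤b′ , _) → ℕ.<-≤-trans 0<a a≤b′) columnRuns-bounded))
      (AllPairs.map⁺ (AllPairs.map proj₂ columnRuns-decreasing)) ,
    All.map (λ (_ , a≤b′ , _) → a≤b′) columnRuns-bounded ,
    trans columnReading-labels (cong (λ w → map +_ w) cellsByColumn-labels)

theorem7p5 : ∀ {c ℓ : Level} (n : ℕ) → 1 ≤ n →
    Σ[ Θ ∈ (Diagram n → SkewShape) ]
    (∀ d → IsΘ d (Θ d)) ×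
    InducesBijection Θ ×
    ((𝕜 : CommutativeRing c ℓ) (δ : CommutativeRing.Carrier 𝕜) (d : Diagram n) →
    let open TemperleyLieb 𝕜 δ in
    IsJonesNormalFormOf d (rowReading (Θ d)) ×
    IsDualJonesNormalFormOf d (columnReading (Θ d)))
theorem7p5 n 0<n = Θ , Θ-isΘ , Θ-bijection , λ 𝕜 δ d →
  let open TemperleyLieb 𝕜 δ in
  (rowReading-normal d 0<n , subst (_Equals d) (sym (rowReading-labels d))
    (cells-equal 𝕜 δ d _ (cellsByRow-ordered (Θ d)) (∈-cellsByRow (Θ d)))) ,
  (columnReading-normal d 0<n , subst (_Equals d) (sym (columnReading-labels d))
    (cells-equal 𝕜 δ d _ (cellsByColumn-ordered (Θ d)) (∈-cellsByColumn (Θ d))))
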